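{- Let $\mathbf{h}\in\mathcal{H}^{m,\star}$ and let $(P^\star(\mathbf{h}),Q^\star(\mathbf{h}))=\star(\mathbf{h})$. For $1\leqslant i<m$: (1) $f^\star_i(\mathbf{h})\neq0$ if and only if $f_i(Q^\star(\mathbf{h}))\neq0$; (2) if $f^\star_i(\mathbf{h})\neq0$, then $Q^\star(f^\star_i(\mathbf{h}))=f_i(Q^\star(\mathbf{h}))$.
   Context: The 0-Hecke monoid: words in positive integers modulo the equivalence generated by $pq=qp$ ($|p-q|>1$), $pqp=qpq$, $pp=p$ on consecutive subwords; a word is fully-commutative if no minimal-length word equivalent to it contains a consecutive subword $i(i+1)i$ or $i(i-1)i$. $\mathcal{H}^{m,\star}$ is the set of decreasing factorizations $\mathbf{h}=h^m\cdots h^1$ (each $h^i$ a possibly empty strictly decreasing word) whose concatenation is fully-commutative. $\star$-crystal operator $f^\star_i$: pair letters $b$ of $h^{i+1}$, in decreasing order, each with the smallest not-yet-paired letter $a\geqslant b$ of $h^i$ if one exists. If all letters of $h^i$ are paired, $f^\star_i(\mathbf{h})=0$; else with $x$ the largest unpaired letter of $h^i$: if $x+1\in h^i\cap h^{i+1}$, remove $x+1$ from $h^i$ and add $x$ to $h^{i+1}$; otherwise move $x$ from $h^i$ to $h^{i+1}$. $\star$-insertion of $\mathbf{h}$: regard $\mathbf{h}$ as the sequence of pairs (factor index $q$, letter $x$) listing the letters of $h^m$, then of $h^{m-1}$, ..., then of $h^1$, in the order written. Process these pairs from last to first, starting with empty tableaux $P,Q$ (French notation, rows from the bottom): insert $x$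 into the bottom row of $P$, where inserting $x$ into a row $R$ means: Case 1: if $R$ is empty or $x>\max(R)$, append $x$ to $R$, add a cell with entry $q$ to $Q$ at the same position, and stop; Case 2: otherwise if $x\notin R$, replace the smallest $y\in R$ with $y>x$ by $x$ and insert $y$ into the next row up; Case 3: if $x\in R$, leave $R$ unchanged and insert into the next row up the smallest $y\in R$ with $[y,x]\subseteq R$. The result $Q^\star(\mathbf{h})$ is a semistandard Young tableau with entries in $[m]$. On semistandard Young tableaux with entries in $[m]$, $f_i$ denotes the standard type $A_{m-1}$ (Kashiwara–Nakashima) crystal operator defined via the signature rule on $i$ and $i+1$, with $f_i(Q)=0$ when it is not defined. -}

module Defs where

open import Data.Nat using (ℕ; zero; suc; _≤_; _<_; _⊔_; ∣_-_∣; _≡ᵇ_; _<ᵇ_; _≤ᵇ_)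
open import Data.Bool using (Bool; true; false; if_then_else_; not; _∧_)
open import Data.List using (List; []; _∷_; _++_; [_]; length; reverse; concat; foldl; foldr; map)
open import Data.Bool.ListAction using (any; all)
open import Data.List.Relation.Unary.Linked using (Linked)
open import Data.List.Relation.Unary.All as LAll using ()
open import Data.Vec using (Vec; toList)
import Data.Vec as Vec
open import Data.Vec.Relation.Unary.All as VAll using ()
open import Data.Maybe using (Maybe; just; nothing)
import Data.Maybe as Maybe
open import Data.Product using (_×_; _,_; proj₁; proj₂)
open import Relation.Binary.PropositionalEquality using (_≡_; _≢_)
open import Relation.Binary.Construct.Closure.Equivalence using (EqClosure)

Word : Set
Word = List ℕ

data HeckeStep : Word → Word → Set where
  comm  : ∀ u v p q → 1 < ∣ p - q ∣ →
          HeckeStep (u ++ p ∷ q ∷ v) (u ++ q ∷ p ∷ v)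
  braid : ∀ u v p q →
          HeckeStep (u ++ p ∷ q ∷ p ∷ v) (u ++ q ∷ p ∷ q ∷ v)
  idem  : ∀ u v p →
          HeckeStep (u ++ p ∷ p ∷ v) (u ++ p ∷ v)

_≈H_ : Word → Word → Set
_≈H_ = EqClosure HeckeStep

MinimalEquiv : Word → Word → Set
MinimalEquiv w u = (u ≈H w) × (∀ v → v ≈H w → length u ≤ length v)

FullyCommutative : Word → Set
FullyCommutative w =
  ∀ u → MinimalEquiv w u → ∀ (pre suf : Word) (i : ℕ) →
    (u ≢ pre ++ i ∷ suc i ∷ i ∷ suf) × (u ≢ pre ++ suc i ∷ i ∷ suc i ∷ suf)

-- Decreasing factorizations.  A factorization h = h^m ⋯ h^1 is stored
-- as a vector  h^1 ∷ h^2 ∷ ⋯ ∷ h^m  (position j-1 holds h^j).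

Factorization : ℕ → Set
Factorization m = Vec (List ℕ) m

concatWord : ∀ {m} → Factorization m → Word
concatWord h = concat (reverse (toList h))

StrictlyDecreasing : List ℕ → Set
StrictlyDecreasing = Linked (λ a b → b < a)

Positive : List ℕ → Set
Positive = LAll.All (λ a → 1 ≤ a)

InHstar : ∀ {m} → Factorization m → Set
InHstar h = VAll.All StrictlyDecreasing h × VAll.All Positive h
          × FullyCommutative (concatWord h)

elem : ℕ → List ℕ → Bool
elem x = any (λ y → y ≡ᵇ x)

remove : ℕ → List ℕ → List ℕ
remove x [] = []
remove x (y ∷ ys) = if y ≡ᵇ x then remove x ys else y ∷ remove x ys

insertDec : ℕ → List ℕ → List ℕ
insertDec x [] = [ x ]
insertDec x (y ∷ ys) =
  if y ≡ᵇ x then y ∷ ys else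
  (if y <ᵇ x then x ∷ y ∷ ys else y ∷ insertDec x ys)

minGE : ℕ → List ℕ → Maybe ℕ
minGE b = foldr step nothing
  where
  step : ℕ → Maybe ℕ → Maybe ℕ
  step a acc = if b ≤ᵇ a
    then (Maybe.maybe (λ c → just (if a <ᵇ c then a else c)) (just a) acc)
    else acc

pairOff : List ℕ → ℕ → List ℕ
pairOff U b = Maybe.maybe (λ a → remove a U) U (minGE b U)

-- unpaired letters of h^i, letters b of h^{i+1} processed in decreasing order
unpaired : List ℕ → List ℕ → List ℕ
unpaired hi hi1 = foldl pairOff hi hi1

fstarPair : List ℕ → List ℕ → Maybe (List ℕ × List ℕ)
fstarPair hi hi1 with unpaired hi hi1
... | [] = nothing
... | u ∷ us =
  let x = foldr _⊔_ u us in
  if elem (suc x) hi ∧ elem (suc x) hi1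
    then just (remove (suc x) hi , insertDec x hi1)
    else just (remove x hi , insertDec x hi1)

-- apply at positions k (= h^{k+1}) and k+1 (= h^{k+2})
atPair : ∀ {n} → ℕ → Vec (List ℕ) n → Maybe (Vec (List ℕ) n)
atPair zero Vec.[] = nothing
atPair zero (a Vec.∷ Vec.[]) = nothing
atPair zero (a Vec.∷ b Vec.∷ rest) =
  Maybe.map (λ p → proj₁ p Vec.∷ proj₂ p Vec.∷ rest) (fstarPair a b)
atPair (suc k) Vec.[] = nothing
atPair (suc k) (a Vec.∷ rest) = Maybe.map (a Vec.∷_) (atPair k rest)

-- f⋆_i (for 1 ≤ i < m); nothing plays the role of 0
fstar : ∀ {m} → ℕ → Factorization m → Maybe (Factorization m)
fstar zero h = nothing
fstar (suc k) h = atPair k h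

-- Tableaux (French notation): list of rows, bottom row first,
-- each row listed left to right.

Tableau : Set
Tableau = List (List ℕ)

-- smallest y with [y,x] ⊆ R (given x ∈ R)
chainDown : List ℕ → ℕ → ℕ
chainDown R zero = zero
chainDown R (suc n) = if elem n R then chainDown R n else suc n

replaceFirst : ℕ → List ℕ → List ℕ × ℕ
replaceFirst x [] = ([] , x)
replaceFirst x (y ∷ ys) with x <ᵇ y
... | true = (x ∷ ys , y)
... | false = let r = replaceFirst x ys in (y ∷ proj₁ r , proj₂ r)

rowIns : ℕ → List ℕ → List ℕ × Maybe ℕ
rowIns x R =
  if all (λ y → y <ᵇ x) R then (R ++ [ x ] , nothing)
  else (if elem x R then (R , just (chainDown R x))
        else (let r = replaceFirst x R in (proj₁ r , just (proj₂ r))))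

insertP : ℕ → Tableau → Tableau × ℕ
insertP x [] = ([ [ x ] ] , 0)
insertP x (R ∷ Rs) = go (rowIns x R)
  where
  go : List ℕ × Maybe ℕ → Tableau × ℕ
  go (R' , nothing) = (R' ∷ Rs , 0)
  go (R' , just y)  = let r = insertP y Rs in (R' ∷ proj₁ r , suc (proj₂ r))

addCell : ℕ → ℕ → Tableau → Tableau
addCell q zero [] = [ [ q ] ]
addCell q zero (R ∷ Rs) = (R ++ [ q ]) ∷ Rs
addCell q (suc k) [] = [ [ q ] ]
addCell q (suc k) (R ∷ Rs) = R ∷ addCell q k Rs

-- pairs (q , x) in processing order (last to first of the listing
-- h^m, ..., h^1): letters of h^1 from last to first, then h^2, ...
processingOrder : ℕ → List (List ℕ) → List (ℕ × ℕ)
processingOrder j [] = []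
processingOrder j (w ∷ ws) = map (λ x → (j , x)) (reverse w) ++ processingOrder (suc j) ws

starStep : Tableau × Tableau → ℕ × ℕ → Tableau × Tableau
starStep (P , Q) (q , x) = let r = insertP x P in (proj₁ r , addCell q (proj₂ r) Q)

star : ∀ {m} → Factorization m → Tableau × Tableau
star h = foldl starStep ([] , []) (processingOrder 1 (toList h))

Pstar Qstar : ∀ {m} → Factorization m → Tableau
Pstar h = proj₁ (star h)
Qstar h = proj₂ (star h)

-- Kashiwara–Nakashima crystal operator f_i on tableaux via the
-- signature rule on the row reading word (rows top to bottom, each
-- left to right): each i+1 is bracketed with a later i; f_i changes
-- the rightmost unbracketed i into i+1 (0 if there is none).

indexed : ℕ → List ℕ → List (ℕ × ℕ)
indexed j [] = []
indexed j (x ∷ xs) = (j , x) ∷ indexed (suc j) xs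

rowCells : ℕ → List (List ℕ) → List (List (ℕ × ℕ × ℕ))
rowCells r [] = []
rowCells r (R ∷ Rs) = map (λ p → (r , proj₁ p , proj₂ p)) (indexed 0 R) ∷ rowCells (suc r) Rs

readingCells : Tableau → List (ℕ × ℕ × ℕ)
readingCells T = concat (reverse (rowCells 0 T))

-- scan with number of open (unbracketed) i+1's and last unbracketed i
bracketScan : ℕ → ℕ → Maybe (ℕ × ℕ) → List (ℕ × ℕ × ℕ) → Maybe (ℕ × ℕ)
bracketScan i opn cand [] = cand
bracketScan i opn cand ((r , c , v) ∷ cs) =
  if v ≡ᵇ i
    then (Maybe.maybe′ (λ _ → bracketScan i (Data.Nat.pred opn) cand cs)
                       (bracketScan i 0 (just (r , c)) cs)
                       (isPos opn))
    else (if v ≡ᵇ suc i then bracketScan i (suc opn) cand cs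
          else bracketScan i opn cand cs)
  where
  isPos : ℕ → Maybe ℕ
  isPos zero = nothing
  isPos (suc n) = just n

updateAt : ∀ {A : Set} → ℕ → (A → A) → List A → List A
updateAt k f [] = []
updateAt zero f (x ∷ xs) = f x ∷ xs
updateAt (suc k) f (x ∷ xs) = x ∷ updateAt k f xs

setCell : ℕ → ℕ → ℕ → Tableau → Tableau
setCell r c v = updateAt r (updateAt c (λ _ → v))

fKN : ℕ → Tableau → Maybe Tableau
fKN i T = Maybe.map (λ p → setCell (proj₁ p) (proj₂ p) (suc i) T)
                    (bracketScan i 0 nothing (readingCells T))

{-# OPTIONS --safe #-}
module Submission where

open import Defs
open import Algebra.Properties.CommutativeSemigroup using (interchange)
open import Data.Bool using (Bool; true; false; if_then_else_; _∧_; T)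
open import Data.Bool.ListAction using (all)
open import Data.Bool.Properties using (T-≡; ∧-zeroʳ)
open import Data.Empty using (⊥; ⊥-elim)
open import Data.List using (List; []; _∷_; _++_; [_]; take; drop; length; map; reverse; concat; foldl; foldr; replicate)
open import Data.List.Properties using (++-assoc; ++-identityʳ; unfold-reverse; reverse-++; reverse-involutive; foldl-++; drop-drop; length-++; length-replicate; map-++; map-id; map-∘; concat-++)
open import Data.List.Relation.Unary.All as All using (All; []; _∷_)
import Data.List.Relation.Unary.All.Properties as All
open import Data.List.Relation.Unary.AllPairs using (AllPairs; []; _∷_)
open import Data.List.Relation.Unary.Linked.Properties using (Linked⇒AllPairs)
open import Data.Maybe using (Maybe; just; nothing)
import Data.Maybe as Maybe
open import Data.Maybe.Properties using (just-injective)
open import Data.Nat using (ℕ; zero; suc; _+_; _∸_; _≤_; _<_; z≤n; s≤s; pred; _<ᵇ_; _≡ᵇ_; _≤ᵇ_; ∣_-_∣; _≟_; _⊔_)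
open import Data.Nat.Properties hiding (_≟_)
open import Data.Product using (_×_; _,_; proj₁; proj₂; ∃-syntax)
open import Data.Sum using (_⊎_; inj₁; inj₂)
open import Data.Unit using (⊤; tt)
open import Data.Vec as Vec using (toList)
import Data.Vec.Relation.Unary.All.Properties as VecAll
open import Function using (_∘_; Equivalence)
open import Function.Bundles using (_⇔_; mk⇔)
open import Relation.Binary.Construct.Closure.Equivalence as EqClosure using ()
open import Relation.Binary.Construct.Closure.ReflexiveTransitive using (ε; _◅_)
open import Relation.Binary.Construct.Closure.Symmetric using (fwd; bwd)
open import Relation.Binary.Definitions using (tri<; tri≈; tri>)
open import Relation.Binary.PropositionalEquality using (_≡_; _≢_; refl; sym; trans; cong; cong₂; subst; subst₂; module ≡-Reasoning)
open import Relation.Nullary using (¬_; yes; no)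

-- Insert the factors a = h^i and b = h^{i+1} row by row: an increasing sequence inserted into a row R
-- bumps an increasing sequence into the next row and appends some letters to R. If a and b bump ã and
-- b̃ and append α and β letters, then row R of the recording tableau receives α entries i and β
-- entries i + 1. Pair the letters as brackets, those of b opening and those of a closing; let ε̃ be
-- the number of unpaired letters of b̃. Then b has β + max(0, ε̃ - α) unpaired letters, which is how
-- the signature rule evolves along the reading word. If α > ε̃, inserting f⋆(a, b) gives the same R, ã
-- and b̃, but α - 1 and β + 1 new letters; if α ≤ ε̃, it gives the same R, α and β and bumps f⋆(ã, b̃).
-- Induction over the rows gives the theorem. The statement about one row is proved by scanning the
-- values upwards: insertion into a row is then a transducer with a counter, and the runs on (a, b)
-- and on f⋆(a, b) are compared step by step.
--
-- Full commutativity enters through a condition invariant under commutations, idempotents and the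
-- insertion: between two consecutive letters x there are both or none of the letters x - 1, x + 1.

-- The delicate point in a row is Case 3: inserting `x` again into an interval `[y, x]` of the row
-- bumps `y`, so an upward scan has to emit `y` before it meets `x`. The transducer is therefore
-- nondeterministic: `start` guesses at `y` that such an `x` will come. The original and the lowered
-- runs may guess differently, which causes most of the cases in their comparison. The original runs
-- use full commutativity. The lowered ones are built from them step by step under weaker side
-- conditions, so the lowered factorization never has to be shown fully commutative. On the side of
-- words, a good word contains no factor `p q p` with `p` and `q` adjacent. Goodness is thus an
-- invariant of whole Hecke classes and can be verified on a word of minimal length. It is phrased
-- as a negation because such a word is obtained only up to double negation.

Bits : Set
Bits = List Bool

-- Bracketing of a pair of sets

-- (number of unpaired closing brackets, number of open brackets)
Brackets : Set
Brackets = ℕ × ℕ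

open₁ close₁ : Brackets → Brackets
open₁ (u , o) = (u , suc o)
close₁ (u , zero) = (suc u , zero)
close₁ (u , suc o) = (u , o)

-- A letter of h^{i+1} opens and a letter of h^i closes; at equal values the opening comes first.
feed : Bool → Bool → Brackets → Brackets
feed false false s = s
feed false true s = open₁ s
feed true false s = close₁ s
feed true true s = s

scan : Brackets → Bits → Bits → Brackets
scan s (a ∷ A) (b ∷ B) = scan (feed a b s) A B
scan s _ _ = s

opens closes : ℕ → Brackets → Brackets
opens zero s = s
opens (suc d) s = open₁ (opens d s)
closes zero s = s
closes (suc c) s = close₁ (closes c s)

opens-open : ∀ d s → opens d (open₁ s) ≡ open₁ (opens d s)
opens-open zero s = refl
opens-open (suc d) s = cong open₁ (opens-open d s)

closes-close : ∀ c s → closes c (close₁ s) ≡ close₁ (closes c s)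
closes-close zero s = refl
closes-close (suc c) s = cong close₁ (closes-close c s)

-- Row insertion as a transducer scanning the values upwards

-- gap and full: whether the value just below lies in the resulting row; sealed: it does, and the
-- next value is moreover not in the original row.
data Prev : Set where
  gap full sealed : Prev

-- norm c f: each of c letters inserted so far has still to bump a letter, or to be appended.
-- chain: inside an interval [y, x] of the row into which x is inserted again; y is already bumped.
data State : Set where
  norm : ℕ → Prev → State
  chain : State

-- Runs with `g = true` come from good words: a value inserted into a row that contains it, with the
-- value below not inserted, has no successor in the row. Nothing of this kind is known for the
-- lowered pair, whose runs have `g = false`.
seal : Bool → Prev
seal true = sealed
seal false = full

Free : Prev → Set
Free sealed = ⊥
Free _ = ⊤

NonGap : Prev → Set
NonGap gap = ⊥
NonGap _ = ⊤

after : Bool → Prev → Prev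
after g gap = seal g
after g f = f

-- Inserting the set of bits a into the row of bits r gives the row of bits r₁ and bumps the letters
-- of bits ã; g tells whether sealing is imposed.
data Step (g : Bool) : State → (a r ã r₁ : Bool) → State → Set where
  idle  : ∀ {c f} → Step g (norm c f) false false false false (norm c gap)
  add   : ∀ {c f} → Step g (norm c f) true false false true (norm (suc c) full)
  bump  : ∀ {c f} → Free f → Step g (norm (suc c) f) false true true false (norm c gap)
  swap  : ∀ {c f} → Free f → Step g (norm (suc c) f) true true true true (norm (suc c) (after g f))
  swap₀ : Step g (norm 0 gap) true true true true (norm 0 (seal g))
  stay  : ∀ {f} → Free f → Step g (norm 0 f) false true false true (norm 0 full)
  start : Step g (norm 0 gap) false true true true chain
  mid   : Step g chain false true false true chain
  end   : Step g chain true true false true (norm 0 (seal g))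

data Run (g : Bool) : State → (A R Ã R₁ : Bits) → ℕ → Set where
  done : ∀ {c f} → Run g (norm c f) [] [] [] [] c
  _∷_  : ∀ {s s′ a r ã r₁ A R Ã R₁ α} → Step g s a r ã r₁ s′ → Run g s′ A R Ã R₁ α →
         Run g s (a ∷ A) (r ∷ R) (ã ∷ Ã) (r₁ ∷ R₁) α

unsealP : Prev → Prev
unsealP sealed = full
unsealP f = f

unseal : State → State
unseal (norm c f) = norm c (unsealP f)
unseal chain = chain

free-unseal : ∀ f → Free (unsealP f)
free-unseal gap = tt
free-unseal full = tt
free-unseal sealed = tt

loosen-step : ∀ {s a r ã r₁ s′} → Step true s a r ã r₁ s′ → Step false (unseal s) a r ã r₁ (unseal s′)
loosen-step idle = idle
loosen-step add = add
loosen-step (bump {f = f} p) = bump (free-unseal f)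
loosen-step (swap {f = gap} p) = swap tt
loosen-step (swap {f = full} p) = swap tt
loosen-step swap₀ = swap₀
loosen-step (stay {f} p) = stay (free-unseal f)
loosen-step start = start
loosen-step mid = mid
loosen-step end = end

loosen : ∀ {s A R Ã R₁ α} → Run true s A R Ã R₁ α → Run false (unseal s) A R Ã R₁ α
loosen done = done
loosen (x ∷ xs) = loosen-step x ∷ loosen xs

-- Brackets of the inserted and of the bumped letters

-- The brackets i of the inserted letters in terms of the brackets o of the bumped letters, for two
-- runs in the given states; pending letters of the first run count as closing brackets, those of the
-- second run as opening ones.
Rel : State → State → Brackets → Brackets → Set
Rel (norm c f) (norm d e) i o = i ≡ opens d (closes c o)
Rel (norm zero sealed) chain i o = i ≡ close₁ o
Rel (norm zero f) chain i o = o ≡ open₁ i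
Rel (norm (suc c) f) chain i o = i ≡ closes (suc (suc c)) o
Rel chain (norm zero gap) i o = i ≡ open₁ o
Rel chain (norm zero f) i o = (i ≡ open₁ o) ⊎ (o ≡ close₁ i)
Rel chain (norm (suc d) e) i o = i ≡ opens (suc (suc d)) o
Rel chain chain i o = i ≡ o

rel-opens : ∀ d e {i o} → i ≡ opens (suc d) o → Rel chain (norm d e) i o
rel-opens zero gap eq = eq
rel-opens zero full eq = inj₁ eq
rel-opens zero sealed eq = inj₁ eq
rel-opens (suc d) e eq = eq

rel-closes : ∀ c f {i o} → Rel (norm c f) chain i o → i ≡ closes (suc c) o
rel-closes zero gap refl = refl
rel-closes zero full refl = refl
rel-closes zero sealed eq = eq
rel-closes (suc c) f eq = eq

-- `add` turns a bracket of `i` into a pending one, and `bump` turns a pending one into a bracket of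
-- `o`. Inside a chain the bumped letter is recorded in `o` before its cause is recorded in `i`. As
-- `close₁` undoes `open₁` but not conversely, these states cannot be treated by moving the missing
-- bracket to the other side, and `Rel` has separate clauses for them.
rel-step : ∀ {g sa sb a r ã r₁ sa′ b b̃ r₂ sb′ i o} →
  Step true sa a r ã r₁ sa′ → Step g sb b r₁ b̃ r₂ sb′ → Rel sa sb i o →
  Rel sa′ sb′ (feed a b i) (feed ã b̃ o)
rel-step idle idle q = q
rel-step idle add q = cong open₁ q
rel-step {o = o} (bump {c} _) (idle {d}) refl = cong (opens d) (sym (closes-close c o))
rel-step {o = o} (bump {c} _) (add {d}) refl = cong (λ z → open₁ (opens d z)) (sym (closes-close c o))
rel-step {o = o} (add {c}) (bump {d} _) refl = cong (opens d) (closes-close c (open₁ o))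
rel-step {o = o} (add {c}) (swap {d} _) refl = cong (λ z → open₁ (opens d z)) (closes-close c (open₁ o))
rel-step {o = o} (add {c}) swap₀ refl = closes-close c (open₁ o)
rel-step add (stay _) refl = refl
rel-step {o = o} (add {c}) start refl = cong close₁ (closes-close c (open₁ o))
rel-step (add {c} {f}) mid q = cong close₁ (rel-closes c f q)
rel-step (add {c} {f}) end q = rel-closes c f q
rel-step (swap _) (bump _) refl = refl
rel-step (swap _) (swap _) refl = refl
rel-step (swap _) swap₀ refl = refl
rel-step {o = o} (swap {c} _) (stay _) refl = cong close₁ (sym (closes-close c o))
rel-step {o = o} (swap {c} _) start refl = refl
rel-step {o = o} (swap {c} _) mid refl = cong (λ z → close₁ (close₁ z)) (sym (closes-close c o))
rel-step {o = o} (swap {c} _) end refl = cong close₁ (sym (closes-close c o))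
rel-step swap₀ (bump _) refl = refl
rel-step swap₀ (swap _) refl = refl
rel-step swap₀ swap₀ refl = refl
rel-step swap₀ (stay _) refl = refl
rel-step swap₀ start refl = refl
rel-step swap₀ mid refl = refl
rel-step swap₀ end refl = refl
rel-step {o = o} (stay _) (bump {d} _) refl = sym (opens-open d o)
rel-step {o = o} (stay _) (swap {d} _) refl = cong open₁ (sym (opens-open d o))
rel-step (stay _) swap₀ refl = refl
rel-step (stay _) (stay _) refl = refl
rel-step (stay _) start refl = refl
rel-step (stay {gap} _) mid refl = refl
rel-step (stay {full} _) mid refl = refl
rel-step (stay {gap} _) end refl = refl
rel-step (stay {full} _) end refl = refl
rel-step start (bump {d} _) refl = rel-opens d gap refl
rel-step start (swap _) refl = refl
rel-step start swap₀ refl = rel-opens 0 _ refl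
rel-step start (stay _) refl = inj₂ refl
rel-step start start refl = refl
rel-step start mid refl = refl
rel-step start end refl = rel-opens 0 _ refl
rel-step {o = o} mid (bump {d} _) refl = rel-opens d gap (cong open₁ (sym (opens-open d o)))
rel-step {o = o} mid (swap {d} _) refl = cong open₁ (cong open₁ (sym (opens-open d o)))
rel-step mid swap₀ refl = rel-opens 0 _ refl
rel-step mid (stay {gap} _) q = inj₁ q
rel-step mid (stay {full} _) q = q
rel-step mid start refl = refl
rel-step mid mid q = q
rel-step mid end refl = rel-opens 0 _ refl
rel-step {o = o} end (bump {d} _) refl = sym (opens-open d o)
rel-step {o = o} end (swap {d} _) refl = cong open₁ (sym (opens-open d o))
rel-step end swap₀ refl = refl
rel-step end (stay {gap} _) refl = refl
rel-step end (stay {full} _) (inj₁ refl) = refl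
rel-step end (stay {full} _) (inj₂ refl) = refl
rel-step end start refl = refl
rel-step end mid refl = refl
rel-step end end refl = refl

record Matched (sa sb : State) (i o : Brackets) : Set where
  constructor matched
  field rel : Rel sa sb i o

matched-step : ∀ {g sa sb a r ã r₁ sa′ b b̃ r₂ sb′ i o} →
  Step true sa a r ã r₁ sa′ → Step g sb b r₁ b̃ r₂ sb′ → Matched sa sb i o →
  Matched sa′ sb′ (feed a b i) (feed ã b̃ o)
matched-step x y (matched q) = matched (rel-step x y q)

-- The letters pending at the end of a run are those appended to the row, so `Rel` turns into the
-- signature rule for a row with `α` closing entries followed by `β` opening ones.
matched-run : ∀ {g sa sb A R Ã R₁ α B B̃ R₂ β i o} →
  Run true sa A R Ã R₁ α → Run g sb B R₁ B̃ R₂ β → Matched sa sb i o →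
  scan i A B ≡ opens β (closes α (scan o Ã B̃))
matched-run done done (matched q) = q
matched-run (x ∷ xs) (y ∷ ys) q = matched-run xs ys (matched-step x y q)

-- Pairs without further unpaired closing letters

record Paired (s : Brackets) (A B : Bits) : Set where
  constructor paired
  field none-added : proj₁ (scan s A B) ≡ proj₁ s

feed-mono : ∀ a b s → proj₁ s ≤ proj₁ (feed a b s)
feed-mono false false s = ≤-refl
feed-mono false true s = ≤-refl
feed-mono true false (u , zero) = n≤1+n u
feed-mono true false (u , suc o) = ≤-refl
feed-mono true true s = ≤-refl

scan-mono : ∀ s A B → proj₁ s ≤ proj₁ (scan s A B)
scan-mono s [] [] = ≤-refl
scan-mono s [] (x ∷ B) = ≤-refl
scan-mono s (a ∷ A) [] = ≤-refl
scan-mono s (a ∷ A) (b ∷ B) = ≤-trans (feed-mono a b s) (scan-mono (feed a b s) A B)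

paired-feed : ∀ {s} a b A B → Paired s (a ∷ A) (b ∷ B) → proj₁ (feed a b s) ≡ proj₁ s
paired-feed {s} a b A B (paired p) =
  ≤-antisym (≤-trans (scan-mono (feed a b s) A B) (≤-reflexive p)) (feed-mono a b s)

paired-tail : ∀ {s} a b {A B} → Paired s (a ∷ A) (b ∷ B) → Paired (feed a b s) A B
paired-tail a b {A} {B} (paired p) = paired (trans p (sym (paired-feed a b A B (paired p))))

closing-unpaired : ∀ {s A B} → proj₂ s ≡ 0 → Paired s (true ∷ A) (false ∷ B) → ⊥
closing-unpaired {u , zero} {A} {B} refl p = 1+n≢n (paired-feed {u , 0} true false A B p)

proj₁-opens : ∀ d s → proj₁ (opens d s) ≡ proj₁ s
proj₁-opens zero s = refl
proj₁-opens (suc d) s = proj₁-opens d s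

proj₂-opens : ∀ d s → proj₂ (opens d s) ≡ d + proj₂ s
proj₂-opens zero s = refl
proj₂-opens (suc d) s = cong suc (proj₂-opens d s)

close-mono : ∀ s → proj₁ s ≤ proj₁ (close₁ s)
close-mono = feed-mono true false

proj₂-close : ∀ s → proj₂ (close₁ s) ≡ proj₂ s ∸ 1
proj₂-close (u , zero) = refl
proj₂-close (u , suc o) = refl

closes-mono : ∀ c s → proj₁ s ≤ proj₁ (closes c s)
closes-mono zero s = ≤-refl
closes-mono (suc c) s = ≤-trans (closes-mono c s) (close-mono (closes c s))

proj₂-closes : ∀ c s → proj₂ (closes c s) ≡ proj₂ s ∸ c
proj₂-closes zero s = refl
proj₂-closes (suc c) s = begin
  proj₂ (close₁ (closes c s)) ≡⟨ proj₂-close (closes c s) ⟩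
  proj₂ (closes c s) ∸ 1      ≡⟨ cong (_∸ 1) (proj₂-closes c s) ⟩
  proj₂ s ∸ c ∸ 1             ≡⟨ ∸-+-assoc (proj₂ s) c 1 ⟩
  proj₂ s ∸ (c + 1)           ≡⟨ cong (proj₂ s ∸_) (+-comm c 1) ⟩
  proj₂ s ∸ suc c             ∎
  where open ≡-Reasoning

closes-bounded : ∀ c s → proj₁ (closes c s) ≡ proj₁ s → c ≤ proj₂ s
closes-bounded zero s eq = z≤n
closes-bounded (suc c) (u , zero) eq = ⊥-elim (1+n≰n (≤-trans (≤-trans (closes-mono c (suc u , 0))
  (≤-reflexive (cong proj₁ (closes-close c (u , 0))))) (≤-reflexive eq)))
closes-bounded (suc c) (u , suc o) eq =
  s≤s (closes-bounded c (u , o) (trans (cong proj₁ (closes-close c (u , suc o))) eq))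

opens-closes-zero : ∀ d c o → proj₂ (opens d (closes c o)) ≡ 0 → d ≡ 0 × proj₂ o ≤ c
opens-closes-zero zero c o eq = refl , m∸n≡0⇒m≤n (trans (sym (proj₂-closes c o)) eq)

-- By `matched-run` the final count of unpaired closing brackets is reached from the bumped letters
-- and `α` further closings. Counts never decrease, so if the inserted letters add nothing, neither
-- part does; in particular each of the `α` closings finds an open bracket.
paired-out : ∀ {sa sb A R Ã R₁ α B B̃ R₂ β i o} →
  Run true sa A R Ã R₁ α → Run true sb B R₁ B̃ R₂ β → Matched sa sb i o →
  proj₁ i ≡ proj₁ o → Paired i A B → Paired o Ã B̃ × α ≤ proj₂ (scan o Ã B̃)
paired-out {A = A} {Ã = Ã} {α = α} {B = B} {B̃ = B̃} {β = β} {i = i} {o} ra rb rel eq (paired p) =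
  paired (≤-antisym (≤-trans (closes-mono α s) (≤-reflexive u≡)) (scan-mono o Ã B̃)) ,
  closes-bounded α s (trans u≡ (≤-antisym (scan-mono o Ã B̃) (≤-trans (closes-mono α s) (≤-reflexive u≡))))
  where
  s = scan o Ã B̃
  u≡ : proj₁ (closes α s) ≡ proj₁ o
  u≡ = trans (sym (proj₁-opens β (closes α s)))
         (trans (sym (cong proj₁ (matched-run ra rb rel))) (trans p eq))

-- Lowering a pair and its effect on one row

NotBoth : Bits → Bits → Set
NotBoth (true ∷ _) (true ∷ _) = ⊥
NotBoth _ _ = ⊤

-- The operator f⋆ on a pair of bit lists; the two ways to hit the largest unpaired letter x
-- correspond to x + 1 not lying, respectively lying, in both factors.
data Lower : Brackets → (A B A′ B′ : Bits) → Set where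
  skip : ∀ {s a b A B A′ B′} → Lower (feed a b s) A B A′ B′ →
         Lower s (a ∷ A) (b ∷ B) (a ∷ A′) (b ∷ B′)
  hit  : ∀ {u A B} → NotBoth A B → Paired (suc u , 0) A B →
         Lower (u , 0) (true ∷ A) (false ∷ B) (false ∷ A) (true ∷ B)
  hit₂ : ∀ {u A B} → Paired (suc u , 0) A B →
         Lower (u , 0) (true ∷ true ∷ A) (false ∷ true ∷ B) (true ∷ false ∷ A) (true ∷ true ∷ B)

-- Inserting the lowered pair (A′ , B′) instead of the original one: either the bumped letters are
-- lowered in turn, or they are unchanged and one new cell of the row passes from h^i to h^{i+1}.
data Outcome (pa pb : State) (A′ B′ R R₂ Ã B̃ : Bits) (α β : ℕ) (o : Brackets) : Set where
  lowered : ∀ {R₁′ Ã′ B̃′} → Run false pa A′ R Ã′ R₁′ α → Run false pb B′ R₁′ B̃′ R₂ β →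
            Lower o Ã B̃ Ã′ B̃′ → α ≤ proj₂ (scan o Ã B̃) → Outcome pa pb A′ B′ R R₂ Ã B̃ α β o
  moved   : ∀ {R₁′ α′} → Run false pa A′ R Ã R₁′ α′ → Run false pb B′ R₁′ B̃ R₂ (suc β) →
            α ≡ suc α′ → proj₂ (scan o Ã B̃) ≤ α′ → Outcome pa pb A′ B′ R R₂ Ã B̃ α β o

prefix : ∀ {pa pb a r ã r₁ pa₁ b b̃ r₂ pb₁ A′ B′ R R₂ Ã B̃ α β o} →
  Step false pa a r ã r₁ pa₁ → Step false pb b r₁ b̃ r₂ pb₁ →
  Outcome pa₁ pb₁ A′ B′ R R₂ Ã B̃ α β (feed ã b̃ o) →
  Outcome pa pb (a ∷ A′) (b ∷ B′) (r ∷ R) (r₂ ∷ R₂) (ã ∷ Ã) (b̃ ∷ B̃) α β o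
prefix x y (lowered ra rb l p) = lowered (x ∷ ra) (y ∷ rb) (skip l) p
prefix x y (moved ra rb e p) = moved (x ∷ ra) (y ∷ rb) e p

-- Both runs reach the same state after the original run has bumped a letter of R with the last
-- pending letter of h^i, and the other run with a letter of h^{i+1}.
merge : ∀ {d e A R Ã R₁ α B B̃ R₂ β u pb b r₂} →
  Run true (norm 0 gap) A R Ã R₁ α → Run true (norm d e) B R₁ B̃ R₂ β →
  Paired (opens d (suc u , 0)) A B → Step false pb b true true r₂ (norm d (unsealP e)) →
  Outcome (norm 0 gap) pb (false ∷ A) (b ∷ B) (true ∷ R) (r₂ ∷ R₂) (true ∷ Ã) (false ∷ B̃) α β (u , 0)
merge {d} {u = u} ra rb p y with paired-out ra rb (matched refl) (proj₁-opens d (suc u , 0)) p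
merge done done p y | q , le = lowered (stay tt ∷ done) (y ∷ done) (hit tt q) le
merge (idle ∷ ra) rb p y | q , le = lowered (stay tt ∷ idle ∷ loosen ra) (y ∷ loosen rb) (hit tt q) le
merge (add ∷ ra) rb p y | q , le = lowered (stay tt ∷ add ∷ loosen ra) (y ∷ loosen rb) (hit tt q) le
merge (stay _ ∷ ra) rb p y | q , le = lowered (stay tt ∷ stay tt ∷ loosen ra) (y ∷ loosen rb) (hit tt q) le
-- The next value now lies in both bumped sets, so these are lowered by `hit₂`. The lowered first
-- run has kept the letter below in its row; repeating the next value therefore bumps that letter,
-- the bottom of a two-element interval.
merge (swap₀ ∷ ra) (bump f ∷ rb) p y | q , le =
  lowered (start ∷ end ∷ loosen ra) (y ∷ loosen (bump f ∷ rb)) (hit₂ (paired-tail true true q)) le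
merge (swap₀ ∷ ra) (swap f ∷ rb) p y | q , le =
  lowered (start ∷ end ∷ loosen ra) (y ∷ loosen (swap f ∷ rb)) (hit₂ (paired-tail true true q)) le
merge (swap₀ ∷ ra) (swap₀ ∷ rb) p y | q , le =
  lowered (start ∷ end ∷ loosen ra) (y ∷ loosen (swap₀ ∷ rb)) (hit₂ (paired-tail true true q)) le
merge (swap₀ ∷ ra) (stay f ∷ rb) p y | q , le = ⊥-elim (closing-unpaired refl p)
merge (swap₀ ∷ ra) (start ∷ rb) p y | q , le = ⊥-elim (closing-unpaired refl p)
merge (start ∷ ra) (bump f ∷ rb) p y | q , le =
  lowered (start ∷ mid ∷ loosen ra) (y ∷ loosen (bump f ∷ rb)) (hit₂ (paired-tail true true q)) le
merge (start ∷ ra) (swap f ∷ rb) p y | q , le =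
  lowered (start ∷ mid ∷ loosen ra) (y ∷ loosen (swap f ∷ rb)) (hit₂ (paired-tail true true q)) le
merge (start ∷ ra) (swap₀ ∷ rb) p y | q , le =
  lowered (start ∷ mid ∷ loosen ra) (y ∷ loosen (swap₀ ∷ rb)) (hit₂ (paired-tail true true q)) le
merge (start ∷ ra) (start ∷ rb) p y | q , le =
  lowered (start ∷ mid ∷ loosen ra) (y ∷ loosen (start ∷ rb)) (hit₂ (paired-tail true true q)) le
merge (start ∷ ra) (stay f ∷ rb) p y | q , le = ⊥-elim (closing-unpaired refl q)

-- Compares the states norm (suc c) f and norm d e of the original runs with norm c f′ of the
-- other first run, which has one letter less pending.
data Ahead : (f : Prev) (c : ℕ) (f′ : Prev) (d : ℕ) (e : Prev) → Set where
  level : ∀ {c d e} → Ahead gap c gap d e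
  high  : ∀ {f c d e} → Ahead f (suc c) full d e
  tight : ∀ {d e} → Ahead sealed 0 full d e
  entry : ∀ {f c e} → NonGap e → Ahead f c gap 0 e

opens-count : ∀ d c o → proj₂ o ≤ c → proj₂ (opens d (closes c o)) ≡ d
opens-count d c o le = begin
  proj₂ (opens d (closes c o)) ≡⟨ proj₂-opens d (closes c o) ⟩
  d + proj₂ (closes c o)       ≡⟨ cong (d +_) (trans (proj₂-closes c o) (m≤n⇒m∸n≡0 le)) ⟩
  d + 0                        ≡⟨ +-identityʳ d ⟩
  d                            ∎
  where open ≡-Reasoning

close-≤ : ∀ {c} o → proj₂ o ≤ suc c → proj₂ (close₁ o) ≤ c
close-≤ (u , zero) le = z≤n
close-≤ (u , suc o) (s≤s le) = le

ahead-free : ∀ {f c f′ d e} → Ahead f c f′ d e → Free f′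
ahead-free level = tt
ahead-free high = tt
ahead-free tight = tt
ahead-free (entry _) = tt

swap-unsealed : ∀ {d} e → Step false (norm (suc d) (unsealP e)) true true true true (norm (suc d) full)
swap-unsealed gap = swap tt
swap-unsealed full = swap tt
swap-unsealed sealed = swap tt

swap-ahead : ∀ {f c f′ d e} → Ahead f (suc c) f′ d e →
  Step false (norm (suc c) f′) true true true true (norm (suc c) full)
swap-ahead level = swap tt
swap-ahead high = swap tt
swap-ahead (entry _) = swap tt

-- The bound `proj₂ o ≤ c` says that the pending letters left in the lowered run suffice to close
-- all open brackets of `o`. Hence at `c = 0` the letter bumped by the extra pending letter is an
-- unpaired closing one, as `hit` and `hit₂` require.
ahead : ∀ {f c f′ d e A R Ã R₁ α B B̃ R₂ β i o} →
  Run true (norm (suc c) f) A R Ã R₁ α → Run true (norm d e) B R₁ B̃ R₂ β →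
  Matched (norm (suc c) f) (norm d e) i o → Ahead f c f′ d e → proj₂ o ≤ c → Paired i A B →
  Outcome (norm c f′) (norm (suc d) (unsealP e)) A B R R₂ Ã B̃ α β o
-- The extra letter stays pending to the end and becomes a new cell.
ahead done done rel h le p = moved done done refl le
ahead (x@idle ∷ ra) (y@idle ∷ rb) rel h le p = prefix idle idle
  (ahead ra rb (matched-step x y rel) level le (paired-tail false false p))
ahead (x@idle ∷ ra) (y@add ∷ rb) rel h le p = prefix idle add
  (ahead ra rb (matched-step x y rel) level le (paired-tail false true p))
-- Only the original first run has a letter left to bump with. In the lowered pair the second
-- factor, which is one pending letter ahead, removes this letter of the row; `tight` cannot occur
-- since a sealed state does not bump.
ahead {c = zero} {e = e} {o = u , _} (bump f ∷ ra) (idle ∷ rb) (matched refl) level z≤n p =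
  merge ra rb (paired-tail false false p) (bump (free-unseal e))
ahead {c = zero} {e = e} {o = u , _} (bump f ∷ ra) (idle ∷ rb) (matched refl) (entry _) z≤n p =
  merge ra rb (paired-tail false false p) (bump (free-unseal e))
ahead {c = zero} {e = e} {o = u , _} (bump f ∷ ra) (add ∷ rb) (matched refl) level z≤n p =
  merge ra rb (paired-tail false true p) (swap-unsealed e)
ahead {c = zero} {e = e} {o = u , _} (bump f ∷ ra) (add ∷ rb) (matched refl) (entry _) z≤n p =
  merge ra rb (paired-tail false true p) (swap-unsealed e)
ahead {c = suc c} {o = o} (x@(bump f) ∷ ra) (y@idle ∷ rb) rel h le p = prefix (bump (ahead-free h)) idle
  (ahead ra rb (matched-step x y rel) level (close-≤ o le) (paired-tail false false p))
ahead {c = suc c} {o = o} (x@(bump f) ∷ ra) (y@add ∷ rb) rel h le p = prefix (bump (ahead-free h)) add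
  (ahead ra rb (matched-step x y rel) level (close-≤ o le) (paired-tail false true p))
ahead (x@add ∷ ra) (y@(bump {d} f) ∷ rb) rel h le p = prefix add (loosen-step (bump {c = suc d} f))
  (ahead ra rb (matched-step x y rel) high (s≤s le) (paired-tail true false p))
ahead (x@add ∷ ra) (y@(swap {d} f) ∷ rb) rel h le p = prefix add (loosen-step (swap {c = suc d} f))
  (ahead ra rb (matched-step x y rel) high (s≤s le) (paired-tail true true p))
ahead (x@add ∷ ra) (y@swap₀ ∷ rb) rel h le p = prefix add (swap tt)
  (ahead ra rb (matched-step x y rel) high (s≤s le) (paired-tail true true p))
-- The `suc c` pending closings exhaust the at most `c` open brackets of `o`, so nothing is open in
-- `i` and this letter of `A` would be unpaired, above the largest unpaired one.
ahead {c = c} {o = o} (add ∷ ra) (stay f ∷ rb) (matched refl) h le p =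
  ⊥-elim (closing-unpaired (opens-count 0 (suc c) o (m≤n⇒m≤1+n le)) p)
ahead {c = c} {o = o} (add ∷ ra) (start ∷ rb) (matched refl) h le p =
  ⊥-elim (closing-unpaired (opens-count 0 (suc c) o (m≤n⇒m≤1+n le)) p)
ahead {c = zero} (x@(swap f) ∷ ra) (y@(bump {d} f′) ∷ rb) rel level le p = prefix swap₀ (loosen-step (bump {c = suc d} f′))
  (ahead ra rb (matched-step x y rel) tight le (paired-tail true false p))
ahead {c = zero} (x@(swap f) ∷ ra) (y@(swap {d} f′) ∷ rb) rel level le p = prefix swap₀ (loosen-step (swap {c = suc d} f′))
  (ahead ra rb (matched-step x y rel) tight le (paired-tail true true p))
ahead {c = zero} (x@(swap f) ∷ ra) (y@swap₀ ∷ rb) rel level le p = prefix swap₀ (swap tt)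
  (ahead ra rb (matched-step x y rel) tight le (paired-tail true true p))
ahead {c = suc c} (x@(swap f) ∷ ra) (y@(bump {d} f′) ∷ rb) rel h le p =
  prefix (swap-ahead h) (loosen-step (bump {c = suc d} f′))
  (ahead ra rb (matched-step x y rel) high le (paired-tail true false p))
ahead {c = suc c} (x@(swap f) ∷ ra) (y@(swap {d} f′) ∷ rb) rel h le p =
  prefix (swap-ahead h) (loosen-step (swap {c = suc d} f′))
  (ahead ra rb (matched-step x y rel) high le (paired-tail true true p))
ahead {c = suc c} (x@(swap f) ∷ ra) (y@swap₀ ∷ rb) rel h le p = prefix (swap-ahead h) (swap tt)
  (ahead ra rb (matched-step x y rel) high le (paired-tail true true p))
ahead {c = c} {o = o} (swap f ∷ ra) (stay f′ ∷ rb) (matched refl) h le p =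
  ⊥-elim (closing-unpaired (opens-count 0 (suc c) o (m≤n⇒m≤1+n le)) p)
ahead {c = c} {o = o} (swap f ∷ ra) (start ∷ rb) (matched refl) h le p =
  ⊥-elim (closing-unpaired (opens-count 0 (suc c) o (m≤n⇒m≤1+n le)) p)

-- The second run scans the row left by the first. A value absent from that row enters the second
-- row only by being inserted, and is then pending; so if nothing is pending a gap below persists,
-- and no chain extends over it.
Coherent : State → State → Set
Coherent (norm c gap) (norm zero gap) = ⊤
Coherent (norm c gap) (norm zero _) = ⊥
Coherent (norm c gap) chain = ⊥
Coherent _ _ = ⊤

coherent-gap : ∀ c d → Coherent (norm c gap) (norm d gap)
coherent-gap c zero = tt
coherent-gap c (suc d) = tt

coherent-step : ∀ {sa sb a r ã r₁ sa′ b b̃ r₂ sb′} →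
  Step true sa a r ã r₁ sa′ → Step true sb b r₁ b̃ r₂ sb′ → Coherent sa′ sb′
coherent-step (idle {c}) (idle {d}) = coherent-gap c d
coherent-step idle add = tt
coherent-step (bump {c} _) (idle {d}) = coherent-gap c d
coherent-step (bump _) add = tt
coherent-step add _ = tt
coherent-step (swap {f = gap} _) _ = tt
coherent-step (swap {f = full} _) _ = tt
coherent-step swap₀ _ = tt
coherent-step (stay _) _ = tt
coherent-step start _ = tt
coherent-step mid _ = tt
coherent-step end _ = tt

-- In these states the next value can belong to the new row only by being inserted.
data Busy : ℕ → Prev → Set where
  pending : ∀ {c} → Busy (suc c) full
  shut    : ∀ {c} → Busy c sealed

busy-after : ∀ {c} f → Free f → Busy (suc c) (after true f)
busy-after gap _ = shut
busy-after full _ = pending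

-- The open chain forces the next value into the row, hence into `A` by `Busy`. If it is not in `B`
-- it is a larger unpaired letter; if it is, `NotBoth` is violated.
hit-before-chain-end : ∀ {c f A R Ã R₁ α B B̃ R₂ β i} →
  Run true (norm c f) A R Ã R₁ α → Run true chain B R₁ B̃ R₂ β →
  Busy c f → proj₂ i ≡ 0 → NotBoth A B → Paired i A B → ⊥
hit-before-chain-end (add ∷ _) (mid ∷ _) h eq nb p = closing-unpaired eq p
hit-before-chain-end (add ∷ _) (end ∷ _) h eq nb p = nb
hit-before-chain-end (swap _ ∷ _) (mid ∷ _) h eq nb p = closing-unpaired eq p
hit-before-chain-end (swap _ ∷ _) (end ∷ _) h eq nb p = nb
hit-before-chain-end (stay () ∷ _) rb shut eq nb p

no-double : ∀ {s r ã r₁ s′ b̃ r₂ s″} →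
  Step true s true r ã r₁ s′ → Step true (norm 0 full) true r₁ b̃ r₂ s″ → ⊥
no-double add ()
no-double (swap _) ()
no-double swap₀ ()
no-double end ()

-- This is the value `x + 1` of `hit₂`. Originally the first factor puts it into the row and the
-- second repeats it, ending a chain; after lowering the first factor lacks it and the second adds
-- it as a new letter.
special : ∀ {c f A R Ã R₁ α B B̃ R₂ β i o} →
  Run true (norm c f) (true ∷ A) R Ã R₁ α → Run true chain (true ∷ B) R₁ B̃ R₂ β →
  Busy c f → Matched (norm c f) chain i o → proj₂ o ≤ c → Paired i A B →
  Outcome (norm c (unsealP f)) (norm 0 full) (false ∷ A) (true ∷ B) R R₂ Ã B̃ α β o
special (x@add ∷ ra) (y@end ∷ rb) h m le p =
  prefix idle add (ahead ra rb (matched-step x y m) (entry tt) le p)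
special {o = o} (x@(swap _) ∷ ra) (y@end ∷ rb) pending m le p =
  prefix (bump tt) add (ahead ra rb (matched-step x y m) (entry tt) (close-≤ o le) p)

-- In the crossed case the original first run and the other second run are inside a chain started
-- at the same letter, which is the one that the outputs have lowered.
data Lowered (A′ B′ R R₂ Ã B̃ : Bits) (α β : ℕ) (i o : Brackets) : (sa sb : State) → Set where
  plain   : ∀ {sa sb} → Outcome (unseal sa) (unseal sb) A′ B′ R R₂ Ã B̃ α β o →
            Lowered A′ B′ R R₂ Ã B̃ α β i o sa sb
  crossed : ∀ {e R₁′} → NonGap e → proj₂ i ≡ 0 →
            Run false (norm 0 full) A′ R Ã R₁′ α → Run false chain B′ R₁′ B̃ R₂ β →
            NotBoth Ã B̃ → Paired o Ã B̃ → α ≤ proj₂ (scan o Ã B̃) →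
            Lowered A′ B′ R R₂ Ã B̃ α β i o chain (norm 0 e)

lowered-skip : ∀ {sa sb a r ã r₁ sa′ b b̃ r₂ sb′ A′ B′ R R₂ Ã B̃ α β i o} →
  Step true sa a r ã r₁ sa′ → Step true sb b r₁ b̃ r₂ sb′ → Matched sa sb i o → Coherent sa sb →
  Lowered A′ B′ R R₂ Ã B̃ α β (feed a b i) (feed ã b̃ o) sa′ sb′ →
  Lowered (a ∷ A′) (b ∷ B′) (r ∷ R) (r₂ ∷ R₂) (ã ∷ Ã) (b̃ ∷ B̃) α β i o sa sb
lowered-skip x y m h (plain out) = plain (prefix (loosen-step x) (loosen-step y) out)
-- The crossing is resolved at the bottom of the chain: this letter is bumped by the first factor
-- originally and by the second after lowering.
lowered-skip {i = u , zero} start (stay {gap} _) (matched refl) h (crossed ng eq ra rb nb p le) =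
  plain (lowered (stay tt ∷ ra) (start ∷ rb) (hit nb p) le)
lowered-skip start (stay {full} _) m () (crossed ng eq ra rb nb p le)
lowered-skip mid (stay {gap} _) (matched refl) h (crossed ng () ra rb nb p le)
lowered-skip mid (stay {full} _) m h (crossed ng eq ra rb nb (paired p) le) =
  crossed tt eq (stay tt ∷ ra) (mid ∷ rb) tt (paired p) le

sealed-notBoth : ∀ {c A R Ã R₁ α} B̃ → Run true (norm c sealed) A R Ã R₁ α → NotBoth Ã B̃
sealed-notBoth _ done = tt
sealed-notBoth _ (idle ∷ _) = tt
sealed-notBoth _ (add ∷ _) = tt

lower-run : ∀ {sa sb A R Ã R₁ α B B̃ R₂ β i o A′ B′} →
  Run true sa A R Ã R₁ α → Run true sb B R₁ B̃ R₂ β → Matched sa sb i o → Coherent sa sb →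
  Lower i A B A′ B′ → Lowered A′ B′ R R₂ Ã B̃ α β i o sa sb
lower-run (x ∷ ra) (y ∷ rb) m h (skip l) =
  lowered-skip x y m h (lower-run ra rb (matched-step x y m) (coherent-step x y) l)
lower-run {o = o} (x@(add {c}) ∷ ra) (y@(stay _) ∷ rb) m@(matched q) h (hit nb p) =
  plain (prefix idle add (ahead ra rb (matched-step x y m) (entry tt)
    (proj₂ (opens-closes-zero 0 c o (sym (cong proj₂ q)))) p))
lower-run (add ∷ ra) (start ∷ rb) m h (hit nb p) =
  ⊥-elim (hit-before-chain-end ra rb pending refl nb p)
lower-run (add ∷ ra) (mid ∷ rb) m h (hit nb p) =
  ⊥-elim (hit-before-chain-end ra rb pending refl nb p)
lower-run {o = o} (x@(swap {c} {f} _) ∷ ra) (y@(stay _) ∷ rb) m@(matched q) h (hit nb p) =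
  plain (prefix (bump (free-unseal f)) add (ahead ra rb (matched-step x y m) (entry tt)
    (close-≤ o (proj₂ (opens-closes-zero 0 (suc c) o (sym (cong proj₂ q))))) p))
lower-run (swap {f = f} g ∷ ra) (start ∷ rb) m h (hit nb p) =
  ⊥-elim (hit-before-chain-end ra rb (busy-after f g) refl nb p)
lower-run (swap {f = f} g ∷ ra) (mid ∷ rb) m h (hit nb p) =
  ⊥-elim (hit-before-chain-end ra rb (busy-after f g) refl nb p)
lower-run (x@swap₀ ∷ ra) (y@(stay {gap} _) ∷ rb) m@(matched refl) h (hit nb p)
  with paired-out ra rb (matched-step x y m) refl p
... | p′ , le = plain (lowered (stay tt ∷ loosen ra) (swap₀ ∷ loosen rb) (hit (sealed-notBoth _ ra) p′) le)
lower-run (swap₀ ∷ ra) (start ∷ rb) m h (hit nb p) =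
  ⊥-elim (hit-before-chain-end ra rb shut refl nb p)
lower-run (end ∷ ra) (start ∷ rb) (matched ()) h (hit nb p)
lower-run (end ∷ ra) (stay {gap} _ ∷ rb) (matched ()) h (hit nb p)
-- The letter hit ends a chain of the first run. After lowering the second factor repeats it, so the
-- chain passes to the second run, and the bumped letter to be lowered is the bottom of the chain,
-- further down.
lower-run (x@end ∷ ra) (y@(stay {full} _) ∷ rb) m@(matched (inj₂ refl)) h (hit nb p)
  with paired-out ra rb (matched-step x y m) refl p
... | paired p′ , le = crossed tt refl (stay tt ∷ loosen ra) (end ∷ loosen rb) tt (paired p′) le
lower-run (end ∷ ra) (mid ∷ rb) m h (hit nb p) =
  ⊥-elim (hit-before-chain-end ra rb shut refl nb p)
lower-run (_ ∷ x ∷ _) (stay _ ∷ y ∷ _) m h (hit₂ p) = ⊥-elim (no-double x y)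
lower-run {o = o} (x@(add {c}) ∷ ra) (y@start ∷ rb) m@(matched q) h (hit₂ p) =
  plain (prefix add swap₀ (special ra rb pending (matched-step x y m)
    (s≤s (proj₂ (opens-closes-zero 0 c o (sym (cong proj₂ q))))) p))
lower-run {o = o} (x@(add {c} {f}) ∷ ra) (y@mid ∷ rb) m@(matched q) h (hit₂ p) =
  plain (prefix add end (special ra rb pending (matched-step x y m)
    (proj₂ (opens-closes-zero 0 (suc c) o (sym (cong proj₂ (rel-closes c f q))))) p))
lower-run {o = o} (x@(swap {c} {f} g) ∷ ra) (y@start ∷ rb) m@(matched q) h (hit₂ p) =
  plain (prefix (loosen-step x) swap₀ (special ra rb (busy-after f g) (matched-step x y m)
    (proj₂ (opens-closes-zero 0 (suc c) o (sym (cong proj₂ q)))) p))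
lower-run {o = o} (x@(swap {c} {f} g) ∷ ra) (y@mid ∷ rb) m@(matched q) h (hit₂ p) =
  plain (prefix (loosen-step x) end (special ra rb (busy-after f g) (matched-step x y m)
    (close-≤ o (proj₂ (opens-closes-zero 0 (suc (suc c)) o (sym (cong proj₂ q))))) p))
lower-run (x@swap₀ ∷ ra) (y@start ∷ rb) m@(matched refl) h (hit₂ p) =
  plain (prefix swap₀ swap₀ (special ra rb shut (matched-step x y m) z≤n p))
lower-run (end ∷ ra) (start ∷ rb) (matched ()) h (hit₂ p)
lower-run (x@end ∷ ra) (y@mid ∷ rb) m@(matched refl) h (hit₂ p) =
  plain (prefix end end (special ra rb shut (matched-step x y m) z≤n p))
lower-run (add ∷ _) (bump _ ∷ _) (matched ()) h (hit₂ p)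
lower-run (swap _ ∷ _) (bump _ ∷ _) (matched ()) h (hit₂ p)
lower-run (swap₀ ∷ _) (bump _ ∷ _) (matched ()) h (hit₂ p)
lower-run (end ∷ _) (bump _ ∷ _) (matched ()) h (hit₂ p)

lower-exists : ∀ s A B → Paired s A B ⊎ ∃[ A′ ] ∃[ B′ ] Lower s A B A′ B′
lower-exists s [] [] = inj₁ (paired refl)
lower-exists s [] (_ ∷ _) = inj₁ (paired refl)
lower-exists s (_ ∷ _) [] = inj₁ (paired refl)
lower-exists s (a ∷ A) (b ∷ B) with lower-exists (feed a b s) A B
... | inj₂ (_ , _ , l) = inj₂ (_ , _ , skip l)
lower-exists s (false ∷ A) (false ∷ B) | inj₁ (paired p) = inj₁ (paired p)
lower-exists s (false ∷ A) (true ∷ B) | inj₁ (paired p) = inj₁ (paired p)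
lower-exists s (true ∷ A) (true ∷ B) | inj₁ (paired p) = inj₁ (paired p)
lower-exists (u , suc o) (true ∷ A) (false ∷ B) | inj₁ (paired p) = inj₁ (paired p)
lower-exists (u , zero) (true ∷ true ∷ A) (false ∷ true ∷ B) | inj₁ (paired p) = inj₂ (_ , _ , hit₂ (paired p))
lower-exists (u , zero) (true ∷ true ∷ A) (false ∷ false ∷ B) | inj₁ p = inj₂ (_ , _ , hit tt p)
lower-exists (u , zero) (true ∷ true ∷ A) (false ∷ []) | inj₁ p = inj₂ (_ , _ , hit tt p)
lower-exists (u , zero) (true ∷ false ∷ A) (false ∷ B) | inj₁ p = inj₂ (_ , _ , hit tt p)
lower-exists (u , zero) (true ∷ []) (false ∷ B) | inj₁ p = inj₂ (_ , _ , hit tt p)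

lower-unpaired : ∀ {s A B A′ B′} → Lower s A B A′ B′ → Paired s A B → ⊥
lower-unpaired (skip {a = a} {b} l) p = lower-unpaired l (paired-tail a b p)
lower-unpaired (hit _ _) p = closing-unpaired refl p
lower-unpaired (hit₂ _) p = closing-unpaired refl p

-- The outcome `crossed` needs a first run inside a chain, whereas a row begins in `norm 0 gap`.
row-lower : ∀ {A B R R₁ R₂ Ã B̃ α β A′ B′} →
  Run true (norm 0 gap) A R Ã R₁ α → Run true (norm 0 gap) B R₁ B̃ R₂ β → Lower (0 , 0) A B A′ B′ →
  Outcome (norm 0 gap) (norm 0 gap) A′ B′ R R₂ Ã B̃ α β (0 , 0)
row-lower ra rb l with lower-run ra rb (matched refl) tt l
... | plain out = out

row-paired : ∀ {A B R R₁ R₂ Ã B̃ α β} →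
  Run true (norm 0 gap) A R Ã R₁ α → Run true (norm 0 gap) B R₁ B̃ R₂ β → Paired (0 , 0) A B →
  Paired (0 , 0) Ã B̃ × α ≤ proj₂ (scan (0 , 0) Ã B̃)
row-paired ra rb = paired-out ra rb (matched refl) refl

row-opens : ∀ {A B R R₁ R₂ Ã B̃ α β} →
  Run true (norm 0 gap) A R Ã R₁ α → Run true (norm 0 gap) B R₁ B̃ R₂ β →
  proj₂ (scan (0 , 0) A B) ≡ β + (proj₂ (scan (0 , 0) Ã B̃) ∸ α)
row-opens {Ã = Ã} {B̃} {α} {β} ra rb = trans (cong proj₂ (matched-run ra rb (matched refl)))
  (trans (proj₂-opens β _) (cong (β +_) (proj₂-closes α (scan (0 , 0) Ã B̃))))

-- Row insertion of sets given as bit lists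

letters : ℕ → Bits → List ℕ
letters v [] = []
letters v (true ∷ A) = v ∷ letters (suc v) A
letters v (false ∷ A) = letters (suc v) A

letters-≥ : ∀ v A → All (v ≤_) (letters v A)
letters-≥ v [] = []
letters-≥ v (true ∷ A) = ≤-refl ∷ All.map <⇒≤ (letters-≥ (suc v) A)
letters-≥ v (false ∷ A) = All.map <⇒≤ (letters-≥ (suc v) A)

T⇒≡ : ∀ {b} → T b → b ≡ true
T⇒≡ = Equivalence.to T-≡

¬T⇒≡ : ∀ {b} → ¬ T b → b ≡ false
¬T⇒≡ {true} h = ⊥-elim (h tt)
¬T⇒≡ {false} h = refl

<ᵇ-true : ∀ {m n} → m < n → (m <ᵇ n) ≡ true
<ᵇ-true p = T⇒≡ (<⇒<ᵇ p)

<ᵇ-false : ∀ {m n} → n ≤ m → (m <ᵇ n) ≡ false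
<ᵇ-false {m} {n} p = ¬T⇒≡ (λ t → ≤⇒≯ p (<ᵇ⇒< m n t))

≡ᵇ-refl : ∀ m → (m ≡ᵇ m) ≡ true
≡ᵇ-refl m = T⇒≡ (≡⇒≡ᵇ m m refl)

≡ᵇ-false : ∀ {m n} → m ≢ n → (m ≡ᵇ n) ≡ false
≡ᵇ-false {m} {n} p = ¬T⇒≡ (p ∘ ≡ᵇ⇒≡ m n)

all-< : ∀ {x R} → All (_< x) R → all (λ y → y <ᵇ x) R ≡ true
all-< [] = refl
all-< (p ∷ ps) rewrite <ᵇ-true p = all-< ps

all-≮ : ∀ {x y} L {zs} → x ≤ y → all (λ y → y <ᵇ x) (L ++ y ∷ zs) ≡ false
all-≮ [] p rewrite <ᵇ-false p = refl
all-≮ {x} (l ∷ L) p with l <ᵇ x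
... | true = all-≮ L p
... | false = refl

elem-false : ∀ {x R} → All (_≢ x) R → elem x R ≡ false
elem-false [] = refl
elem-false (p ∷ ps) rewrite ≡ᵇ-false p = elem-false ps

elem-mid : ∀ x L {zs} → elem x (L ++ x ∷ zs) ≡ true
elem-mid x [] rewrite ≡ᵇ-refl x = refl
elem-mid x (l ∷ L) with l ≡ᵇ x
... | true = refl
... | false = elem-mid x L

replaceFirst-mid : ∀ {x z} L {zs} → All (_< x) L → x < z → replaceFirst x (L ++ z ∷ zs) ≡ (L ++ x ∷ zs , z)
replaceFirst-mid [] [] p rewrite <ᵇ-true p = refl
replaceFirst-mid {x} {z} (l ∷ L) {zs} (q ∷ qs) p
  rewrite <ᵇ-false (<⇒≤ q) | replaceFirst-mid {x} {z} L {zs} qs p = refl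

rowIns-append : ∀ {x R} → All (_< x) R → rowIns x R ≡ (R ++ [ x ] , nothing)
rowIns-append p rewrite all-< p = refl

rowIns-replace : ∀ {x z} L {zs} → All (_< x) L → All (x <_) (z ∷ zs) →
  rowIns x (L ++ z ∷ zs) ≡ (L ++ x ∷ zs , just z)
rowIns-replace {x} {z} L {zs} p (q ∷ qs)
  rewrite all-≮ {x} L {zs} (<⇒≤ q)
        | elem-false {x} {L ++ z ∷ zs} (All.++⁺ (All.map <⇒≢ p) (All.map >⇒≢ (q ∷ qs)))
        | replaceFirst-mid {x} {z} L {zs} p q = refl

rowIns-present : ∀ x L {zs} → rowIns x (L ++ x ∷ zs) ≡ (L ++ x ∷ zs , just (chainDown (L ++ x ∷ zs) x))
rowIns-present x L {zs} rewrite all-≮ {x} L {zs} ≤-refl | elem-mid x L {zs} = refl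

consOut : Maybe ℕ → List ℕ × List ℕ × ℕ → List ℕ × List ℕ × ℕ
consOut nothing (R , ys , k) = R , ys , suc k
consOut (just y) (R , ys , k) = R , y ∷ ys , k

-- Resulting row, letters bumped out of it in the order of their removal, and number of new cells.
insRow : List ℕ → List ℕ → List ℕ × List ℕ × ℕ
insRow [] R = R , [] , 0
insRow (x ∷ xs) R = consOut (proj₂ (rowIns x R)) (insRow xs (proj₁ (rowIns x R)))

-- The letters above `v` do not affect the search; quantifying over them keeps the fact usable
-- whatever has been bumped there meanwhile.
Chain : (y v : ℕ) → List ℕ → Set
Chain y v L = ∀ {zs} → All (v <_) zs → chainDown (L ++ v ∷ zs) v ≡ y

chain-gap : ∀ {v L} → All (_< v) L → Chain (suc v) (suc v) L
chain-gap {v} {L} p {zs} q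
  rewrite elem-false {v} {L ++ suc v ∷ zs} (All.++⁺ (All.map <⇒≢ p) (1+n≢n ∷ All.map (>⇒≢ ∘ <⇒≤) q)) = refl

chain-suc : ∀ {y v L} → Chain y v L → Chain y (suc v) (L ++ [ v ])
chain-suc {y} {v} {L} h {zs} q
  rewrite ++-assoc L [ v ] (suc v ∷ zs) | elem-mid v L {suc v ∷ zs} = h (≤-refl ∷ All.map <⇒≤ q)

below-suc : ∀ {v} L → All (_< v) L → All (_< suc v) (L ++ [ v ])
below-suc L p = All.++⁺ (All.map m≤n⇒m≤1+n p) (≤-refl ∷ [])

-- Actual insertion bumps at once, the transducer only when it meets the letter. At value `v` the
-- row thus consists of its final part `L` and the old letters from `v` on without the first `c`,
-- which the pending letters have already bumped; pending letters in excess of the old ones have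
-- been appended.
Inserts : (A R Ã R₁ : Bits) (α c v : ℕ) (L : List ℕ) → Set
Inserts A R Ã R₁ α c v L = ∃[ ys ] ∃[ k ]
  (insRow (letters v A) (L ++ drop c (letters v R)) ≡ (L ++ letters v R₁ , ys , k)) ×
  (letters v Ã ≡ take c (letters v R) ++ ys) × (α ≡ (c ∸ length (letters v R)) + k)

insRow-cons : ∀ x R xs {R′ m} → rowIns x R ≡ (R′ , m) → insRow (x ∷ xs) R ≡ consOut m (insRow xs R′)
insRow-cons x R xs eq rewrite eq = refl

insRow-append : ∀ {v L} A {R₁ ys k} → All (_< v) L →
  insRow A ((L ++ [ v ]) ++ []) ≡ ((L ++ [ v ]) ++ R₁ , ys , k) →
  insRow (v ∷ A) (L ++ []) ≡ (L ++ v ∷ R₁ , ys , suc k)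
insRow-append {v} {L} A {R₁} {ys} {k} p eq =
  trans (insRow-cons v (L ++ []) A (trans (cong (rowIns v) (++-identityʳ L)) (rowIns-append p)))
    (cong (consOut nothing) (trans (cong (insRow A) (sym (++-identityʳ (L ++ [ v ]))))
      (trans eq (cong (_, ys , k) (++-assoc L [ v ] R₁)))))

insert-pending : ∀ c v L zs A {R₁ ys k} → All (_< v) L → All (v <_) zs →
  insRow A ((L ++ [ v ]) ++ drop (suc c) zs) ≡ ((L ++ [ v ]) ++ R₁ , ys , k) →
  ∃[ ys′ ] ∃[ k′ ] (insRow (v ∷ A) (L ++ drop c zs) ≡ (L ++ v ∷ R₁ , ys′ , k′)) ×
    (take (suc c) zs ++ ys ≡ take c zs ++ ys′) × ((suc c ∸ length zs) + k ≡ (c ∸ length zs) + k′)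
insert-pending zero v L [] A {R₁} {ys} {k} p q eq =
  ys , suc k , insRow-append A p eq , refl , refl
insert-pending (suc c) v L [] A {R₁} {ys} {k} p q eq =
  ys , suc k , insRow-append A p eq , refl , sym (+-suc (suc c) k)
insert-pending zero v L (z ∷ zs) A {R₁} {ys} {k} p q eq =
  z ∷ ys , k ,
  trans (insRow-cons v (L ++ z ∷ zs) A (rowIns-replace L p q))
    (cong (consOut (just z)) (trans (cong (insRow A) (sym (++-assoc L [ v ] zs)))
      (trans eq (cong (_, ys , k) (++-assoc L [ v ] R₁))))) ,
  refl , cong (_+ k) (0∸n≡0 (length zs))
insert-pending (suc c) v L (z ∷ zs) A p (_ ∷ q) eq with insert-pending c v L zs A p q eq
... | ys′ , k′ , e₁ , e₂ , e₃ = ys′ , k′ , e₁ , cong (z ∷_) e₂ , e₃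

insert-present : ∀ {y v} L {zs} A {R₁ ys k} → Chain y v L → All (v <_) zs →
  insRow A ((L ++ [ v ]) ++ zs) ≡ ((L ++ [ v ]) ++ R₁ , ys , k) →
  insRow (v ∷ A) (L ++ v ∷ zs) ≡ (L ++ v ∷ R₁ , y ∷ ys , k)
insert-present {y} {v} L {zs} A {R₁} {ys} {k} h q eq =
  trans (insRow-cons v (L ++ v ∷ zs) A (trans (rowIns-present v L) (cong (λ t → _ , just t) (h q))))
    (cong (consOut (just y)) (trans (cong (insRow A) (sym (++-assoc L [ v ] zs)))
      (trans eq (cong (_, ys , k) (++-assoc L [ v ] R₁)))))

insert-kept : ∀ {v} L {zs} A {R₁ ys k} →
  insRow A ((L ++ [ v ]) ++ zs) ≡ ((L ++ [ v ]) ++ R₁ , ys , k) →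
  insRow A (L ++ v ∷ zs) ≡ (L ++ v ∷ R₁ , ys , k)
insert-kept {v} L {zs} A {R₁} {ys} {k} eq =
  trans (cong (insRow A) (sym (++-assoc L [ v ] zs))) (trans eq (cong (_, ys , k) (++-assoc L [ v ] R₁)))

GapBelow : Prev → ℕ → List ℕ → Set
GapBelow gap v L = Chain v v L
GapBelow _ v L = ⊤

full-after : ∀ {v L} f → GapBelow (after false f) v L
full-after gap = tt
full-after full = tt
full-after sealed = tt

run-inserts : ∀ {c f A R Ã R₁ α} v L → Run false (norm c f) A R Ã R₁ α →
  All (_< v) L → GapBelow f v L → Inserts A R Ã R₁ α c v L
-- Nothing is inserted between `y` and the end of the chain, so `y` is the next letter bumped, and
-- emitting it early does not change the order.
chain-inserts : ∀ {A R Ã R₁ α y} v L → Run false chain A R Ã R₁ α → All (_< v) L → Chain y v L →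
  insRow (letters v A) (L ++ letters v R) ≡ (L ++ letters v R₁ , y ∷ letters v Ã , α)

run-inserts {zero} v L done p h = [] , 0 , refl , refl , refl
run-inserts {suc c} v L done p h = [] , 0 , refl , refl , sym (+-identityʳ (suc c))
run-inserts v L (idle ∷ ra) p h = run-inserts (suc v) L ra (All.map m≤n⇒m≤1+n p) (chain-gap p)
run-inserts {c} v L (_∷_ {A = A} {R} add ra) p h with run-inserts (suc v) (L ++ [ v ]) ra (below-suc L p) tt
... | ys , k , e₁ , e₂ , e₃ with insert-pending c v L (letters (suc v) R) (letters (suc v) A) p (letters-≥ (suc v) R) e₁
...   | ys′ , k′ , e₁′ , e₂′ , e₃′ = ys′ , k′ , e₁′ , trans e₂ e₂′ , trans e₃ e₃′
run-inserts v L (bump _ ∷ ra) p h with run-inserts (suc v) L ra (All.map m≤n⇒m≤1+n p) (chain-gap p)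
... | ys , k , e₁ , e₂ , e₃ = ys , k , e₁ , cong (v ∷_) e₂ , e₃
run-inserts v L (_∷_ {A = A} {R} (swap {c} {f} _) ra) p h
  with run-inserts (suc v) (L ++ [ v ]) ra (below-suc L p) (full-after f)
... | ys , k , e₁ , e₂ , e₃ with insert-pending c v L (letters (suc v) R) (letters (suc v) A) p (letters-≥ (suc v) R) e₁
...   | ys′ , k′ , e₁′ , e₂′ , e₃′ = ys′ , k′ , e₁′ , cong (v ∷_) (trans e₂ e₂′) , trans e₃ e₃′
run-inserts v L (_∷_ {A = A} {R} swap₀ ra) p h with run-inserts (suc v) (L ++ [ v ]) ra (below-suc L p) tt
... | ys , k , e₁ , refl , e₃ =
  v ∷ ys , k , insert-present L (letters (suc v) A) h (letters-≥ (suc v) R) e₁ , refl ,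
  trans e₃ (cong (_+ k) (0∸n≡0 (length (letters (suc v) R))))
run-inserts v L (_∷_ {A = A} {R} (stay _) ra) p h with run-inserts (suc v) (L ++ [ v ]) ra (below-suc L p) tt
... | ys , k , e₁ , e₂ , e₃ =
  ys , k , insert-kept L (letters (suc v) A) e₁ , e₂ , trans e₃ (cong (_+ k) (0∸n≡0 (length (letters (suc v) R))))
run-inserts v L (_∷_ {A = A} start ra) p h =
  _ , _ , insert-kept L (letters (suc v) A) (chain-inserts (suc v) (L ++ [ v ]) ra (below-suc L p) (chain-suc h)) , refl , refl

chain-inserts v L (_∷_ {A = A} mid ra) p h =
  insert-kept L (letters (suc v) A) (chain-inserts (suc v) (L ++ [ v ]) ra (below-suc L p) (chain-suc h))
chain-inserts v L (_∷_ {A = A} {R} end ra) p h with run-inserts (suc v) (L ++ [ v ]) ra (below-suc L p) tt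
... | ys , k , e₁ , refl , e₃ =
  trans (insert-present L (letters (suc v) A) h (letters-≥ (suc v) R) e₁)
    (cong (λ t → _ , _ , t) (sym (trans e₃ (cong (_+ k) (0∸n≡0 (length (letters (suc v) R)))))))

insRow-run : ∀ {A R Ã R₁ α} → Run false (norm 0 gap) A R Ã R₁ α →
  insRow (letters 0 A) (letters 0 R) ≡ (letters 0 R₁ , letters 0 Ã , α)
insRow-run {R = R} ra with run-inserts 0 [] ra [] (λ _ → refl)
... | ys , k , e₁ , refl , e₃ = trans e₁ (cong (λ t → _ , _ , t) (sym (trans e₃ (cong (_+ k) (0∸n≡0 (length (letters 0 R)))))))

-- Existence of runs

NextOff : Bits → Set
NextOff (true ∷ _) = ⊥
NextOff _ = ⊤

-- If x lies in A and R but x - 1 not in A, then x + 1 is not in R, as the word of A followed by that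
-- of R would otherwise contain x (x + 1) x up to commutations. Here p is the bit of A just below.
Sparse : (p : Bool) (A R : Bits) → Set
Sparse p [] [] = ⊤
Sparse p (true ∷ A) (true ∷ R) = (p ≡ false → NextOff R) × Sparse true A R
Sparse p (a ∷ A) (_ ∷ R) = Sparse a A R
Sparse p _ _ = ⊥

-- The lookahead deciding between `start` and `stay`.
chainAhead : Bits → Bits → Bool
chainAhead (false ∷ A) (true ∷ R) = chainAhead A R
chainAhead (true ∷ A) (true ∷ R) = true
chainAhead _ _ = false

Runs : State → Bits → Bits → Set
Runs s A R = ∃[ Ã ] ∃[ R₁ ] ∃[ α ] Run true s A R Ã R₁ α

_∷ʳᵘⁿ_ : ∀ {s s′ a r ã r₁ A R} → Step true s a r ã r₁ s′ → Runs s′ A R → Runs s (a ∷ A) (r ∷ R)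
x ∷ʳᵘⁿ (_ , _ , _ , ra) = _ , _ , _ , x ∷ ra

-- Each state has its own hypotheses, chosen to exclude the inputs on which it has no step:
-- `NextOff`, obtained from `Sparse` at the moment of sealing, for `sealed`, and the lookahead for
-- `chain` and for kept letters.
runs-gap : ∀ c A R → Sparse false A R → Runs (norm c gap) A R
runs-full : ∀ c A R → Sparse true A R → Runs (norm (suc c) full) A R
runs-kept : ∀ A R → Sparse false A R → chainAhead A R ≡ false → Runs (norm 0 full) A R
runs-sealed : ∀ c A R → Sparse true A R → NextOff R → Runs (norm c sealed) A R
runs-chain : ∀ A R → Sparse false A R → chainAhead A R ≡ true → Runs chain A R

runs-gap c [] [] h = _ , _ , _ , done
runs-gap c (false ∷ A) (false ∷ R) h = idle ∷ʳᵘⁿ runs-gap c A R h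
runs-gap c (true ∷ A) (false ∷ R) h = add ∷ʳᵘⁿ runs-full c A R h
runs-gap (suc c) (false ∷ A) (true ∷ R) h = bump tt ∷ʳᵘⁿ runs-gap c A R h
runs-gap zero (false ∷ A) (true ∷ R) h with chainAhead A R in eq
... | true = start ∷ʳᵘⁿ runs-chain A R h eq
... | false = stay tt ∷ʳᵘⁿ runs-kept A R h eq
runs-gap (suc c) (true ∷ A) (true ∷ R) (n , h) = swap tt ∷ʳᵘⁿ runs-sealed (suc c) A R h (n refl)
runs-gap zero (true ∷ A) (true ∷ R) (n , h) = swap₀ ∷ʳᵘⁿ runs-sealed zero A R h (n refl)

runs-full c [] [] h = _ , _ , _ , done
runs-full c (false ∷ A) (false ∷ R) h = idle ∷ʳᵘⁿ runs-gap (suc c) A R h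
runs-full c (true ∷ A) (false ∷ R) h = add ∷ʳᵘⁿ runs-full (suc c) A R h
runs-full c (false ∷ A) (true ∷ R) h = bump tt ∷ʳᵘⁿ runs-gap c A R h
runs-full c (true ∷ A) (true ∷ R) (n , h) = swap tt ∷ʳᵘⁿ runs-full c A R h

runs-kept [] [] h eq = _ , _ , _ , done
runs-kept (false ∷ A) (false ∷ R) h eq = idle ∷ʳᵘⁿ runs-gap 0 A R h
runs-kept (true ∷ A) (false ∷ R) h eq = add ∷ʳᵘⁿ runs-full 0 A R h
runs-kept (false ∷ A) (true ∷ R) h eq = stay tt ∷ʳᵘⁿ runs-kept A R h eq

runs-sealed c [] [] h n = _ , _ , _ , done
runs-sealed c (false ∷ A) (false ∷ R) h n = idle ∷ʳᵘⁿ runs-gap c A R h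
runs-sealed c (true ∷ A) (false ∷ R) h n = add ∷ʳᵘⁿ runs-full c A R h

runs-chain (false ∷ A) (true ∷ R) h eq = mid ∷ʳᵘⁿ runs-chain A R h eq
runs-chain (true ∷ A) (true ∷ R) (n , h) eq = end ∷ʳᵘⁿ runs-sealed 0 A R h (n refl)

-- Words up to commutations and idempotents

-- What has been seen since the last letter i: a letter i - 1, a letter i + 1; dead once two
-- consecutive letters i have had exactly one of the two between them.
data Watch : Set where
  dead : Watch
  seen : (below over : Bool) → Watch

data Loc : (i x : ℕ) → Set where
  at    : ∀ {i} → Loc i i
  below : ∀ {x} → Loc (suc x) x
  over  : ∀ {i} → Loc i (suc i)
  far   : ∀ {i x} → x ≢ i → suc x ≢ i → x ≢ suc i → Loc i x

locate : ∀ i x → Loc i x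
locate i x with x ≟ i | suc x ≟ i | x ≟ suc i
... | yes refl | _ | _ = at
... | no _ | yes refl | _ = below
... | no _ | no _ | yes refl = over
... | no p | no q | no r = far p q r

watch : ∀ {i x} → Loc i x → Watch → Watch
watch _ dead = dead
watch at (seen true false) = dead
watch at (seen false true) = dead
watch at (seen _ _) = seen false false
watch below (seen _ r) = seen true r
watch over (seen l _) = seen l true
watch (far _ _ _) s = s

read : ℕ → List ℕ → Watch → Watch
read i [] s = s
read i (x ∷ w) s = read i w (watch (locate i x) s)

read-++ : ∀ i u v s → read i (u ++ v) s ≡ read i v (read i u s)
read-++ i [] v s = refl
read-++ i (x ∷ u) v s = read-++ i u v _

read-dead : ∀ i w → read i w dead ≡ dead
read-dead i [] = refl
read-dead i (x ∷ w) = read-dead i w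

watch-loc : ∀ {i x} (l l′ : Loc i x) s → watch l s ≡ watch l′ s
watch-loc at at s = refl
watch-loc at (far p _ _) s = ⊥-elim (p refl)
watch-loc below below s = refl
watch-loc below (far _ p _) s = ⊥-elim (p refl)
watch-loc over over s = refl
watch-loc over (far _ _ p) s = ⊥-elim (p refl)
watch-loc (far p _ _) at s = ⊥-elim (p refl)
watch-loc (far _ p _) below s = ⊥-elim (p refl)
watch-loc (far _ _ p) over s = ⊥-elim (p refl)
watch-loc (far _ _ _) (far _ _ _) dead = refl
watch-loc (far _ _ _) (far _ _ _) (seen _ _) = refl

infix 4 _~_
-- Equality of readings replaces the congruence generated by commutations and idempotents: it
-- contains it, is compatible with concatenation by construction, and preserves `Good`.
record _~_ (u v : List ℕ) : Set where
  constructor same-reading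
  field reads : ∀ i s → read i u s ≡ read i v s
open _~_

~-refl : ∀ {u} → u ~ u
~-refl = same-reading λ i s → refl

~-reflexive : ∀ {u v} → u ≡ v → u ~ v
~-reflexive refl = ~-refl

~-sym : ∀ {u v} → u ~ v → v ~ u
~-sym p = same-reading λ i s → sym (reads p i s)

~-trans : ∀ {u v w} → u ~ v → v ~ w → u ~ w
~-trans p q = same-reading λ i s → trans (reads p i s) (reads q i s)

~-++ : ∀ {u u′ v v′} → u ~ u′ → v ~ v′ → u ++ v ~ u′ ++ v′
~-++ {u} {u′} {v} {v′} p q = same-reading λ i s → begin
  read i (u ++ v) s         ≡⟨ read-++ i u v s ⟩
  read i v (read i u s)     ≡⟨ reads q i _ ⟩
  read i v′ (read i u s)    ≡⟨ cong (read i v′) (reads p i s) ⟩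
  read i v′ (read i u′ s)   ≡⟨ read-++ i u′ v′ s ⟨
  read i (u′ ++ v′) s       ∎
  where open ≡-Reasoning

~-∷ : ∀ x {u v} → u ~ v → x ∷ u ~ x ∷ v
~-∷ x p = same-reading λ i s → reads p i _

Apart : ℕ → ℕ → Set
Apart p q = 1 < ∣ p - q ∣

adjacent : ∀ n → ∣ n - suc n ∣ ≡ 1
adjacent zero = refl
adjacent (suc n) = adjacent n

not-apart : ∀ {n} → ¬ Apart n (suc n)
not-apart {n} h = <-irrefl (sym (adjacent n)) h

not-apart′ : ∀ {n} → ¬ Apart (suc n) n
not-apart′ {n} h = not-apart {n} (subst (1 <_) (∣-∣-comm (suc n) n) h)

watch-far : ∀ {i x} p q r s → watch (far {i} {x} p q r) s ≡ s
watch-far p q r dead = refl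
watch-far p q r (seen _ _) = refl

watch-comm : ∀ {i p q} → Apart p q → (l : Loc i p) (m : Loc i q) → ∀ s → watch m (watch l s) ≡ watch l (watch m s)
watch-comm h l m dead = refl
watch-comm h at at (seen _ _) = refl
watch-comm {q = q} h at below (seen _ _) = ⊥-elim (not-apart′ {q} h)
watch-comm {p = p} h at over (seen _ _) = ⊥-elim (not-apart {p} h)
watch-comm {p = p} h below at (seen _ _) = ⊥-elim (not-apart {p} h)
watch-comm {q = q} h over at (seen _ _) = ⊥-elim (not-apart′ {q} h)
watch-comm h below below (seen _ _) = refl
watch-comm h below over (seen _ _) = refl
watch-comm h over below (seen _ _) = refl
watch-comm h over over (seen _ _) = refl
watch-comm h l (far _ _ _) s@(seen _ _) = watch-far _ _ _ (watch l s)
watch-comm h (far _ _ _) m s@(seen _ _) = sym (watch-far _ _ _ (watch m s))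

watch-idem : ∀ {i p} (l : Loc i p) s → watch l (watch l s) ≡ watch l s
watch-idem l dead = refl
watch-idem at (seen false false) = refl
watch-idem at (seen false true) = refl
watch-idem at (seen true false) = refl
watch-idem at (seen true true) = refl
watch-idem below (seen _ _) = refl
watch-idem over (seen _ _) = refl
watch-idem (far _ _ _) (seen _ _) = refl

~-comm : ∀ {p q} → Apart p q → ∀ w → p ∷ q ∷ w ~ q ∷ p ∷ w
~-comm {p} {q} h w = same-reading λ i s → cong (read i w) (watch-comm h (locate i p) (locate i q) s)

~-idem : ∀ p w → p ∷ p ∷ w ~ p ∷ w
~-idem p w = same-reading λ i s → cong (read i w) (watch-idem (locate i p) s)

~-past : ∀ x w → All (Apart x) w → ∀ v → x ∷ (w ++ v) ~ w ++ x ∷ v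
~-past x [] [] v = ~-refl
~-past x (y ∷ w) (p ∷ ps) v = ~-trans (~-comm p (w ++ v)) (~-∷ y (~-past x w ps v))

-- Requiring only that some initial state not die makes every factor of a good word good.
record Good (w : List ℕ) : Set where
  constructor good
  field alive : ∀ i → ¬ (∀ s → read i w s ≡ dead)
open Good

good-~ : ∀ {u v} → u ~ v → Good u → Good v
good-~ p g = good λ i h → alive g i (λ s → trans (reads p i s) (h s))

good-++ʳ : ∀ u {v} → Good (u ++ v) → Good v
good-++ʳ u {v} g = good λ i h → alive g i (λ s → trans (read-++ i u v s) (h _))

good-++ˡ : ∀ u {v} → Good (u ++ v) → Good u
good-++ˡ u {v} g = good λ i h → alive g i (λ s → trans (read-++ i u v s) (trans (cong (read i v) (h s)) (read-dead i v)))

Far : ℕ → ℕ → Set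
Far i x = x ≢ i × suc x ≢ i × x ≢ suc i

read-far : ∀ {i w} → All (Far i) w → ∀ s → read i w s ≡ s
read-far [] s = refl
read-far {i} {x ∷ w} ((p , q , r) ∷ ps) s =
  trans (cong (read i w) (trans (watch-loc (locate i x) (far p q r) s) (watch-far p q r s))) (read-far ps s)

watch-at : ∀ s → watch (at {0}) s ≡ dead ⊎ watch (at {0}) s ≡ seen false false
watch-at dead = inj₁ refl
watch-at (seen false false) = inj₂ refl
watch-at (seen false true) = inj₁ refl
watch-at (seen true false) = inj₁ refl
watch-at (seen true true) = inj₂ refl

watch-at-irrelevant : ∀ i j s → watch (at {i}) s ≡ watch (at {j}) s
watch-at-irrelevant i j dead = refl
watch-at-irrelevant i j (seen false false) = refl
watch-at-irrelevant i j (seen false true) = refl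
watch-at-irrelevant i j (seen true false) = refl
watch-at-irrelevant i j (seen true true) = refl

after-letter : ∀ i w s → read i (i ∷ w) s ≡ dead ⊎ read i (i ∷ w) s ≡ read i w (seen false false)
after-letter i w s rewrite watch-loc (locate i i) at s | watch-at-irrelevant i 0 s with watch-at s
... | inj₁ eq rewrite eq = inj₁ (read-dead i w)
... | inj₂ eq rewrite eq = inj₂ refl

dead-over : ∀ i m w → All (Far i) m → ∀ s → read i (i ∷ m ++ suc i ∷ i ∷ w) s ≡ dead
dead-over i m w p s with after-letter i (m ++ suc i ∷ i ∷ w) s
... | inj₁ eq = eq
... | inj₂ eq = trans eq (trans (read-++ i m _ _) (trans (cong (read i (suc i ∷ i ∷ w)) (read-far p _)) dies))
  where
  dies : read i (suc i ∷ i ∷ w) (seen false false) ≡ dead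
  dies rewrite watch-loc (locate i (suc i)) over (seen false false)
             | watch-loc (locate i i) at (seen false true) = read-dead i w

dead-below : ∀ i w s → read (suc i) (suc i ∷ i ∷ suc i ∷ w) s ≡ dead
dead-below i w s with after-letter (suc i) (i ∷ suc i ∷ w) s
... | inj₁ eq = eq
... | inj₂ eq = trans eq dies
  where
  dies : read (suc i) (i ∷ suc i ∷ w) (seen false false) ≡ dead
  dies rewrite watch-loc (locate (suc i) i) below (seen false false)
             | watch-loc (locate (suc i) (suc i)) at (seen true false) = read-dead (suc i) w

good-over : ∀ u i m w → All (Far i) m → ¬ Good (u ++ i ∷ m ++ suc i ∷ i ∷ w)
good-over u i m w p g = alive (good-++ʳ u g) i (dead-over i m w p)

good-below : ∀ u i w → ¬ Good (u ++ suc i ∷ i ∷ suc i ∷ w)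
good-below u i w g = alive (good-++ʳ u g) (suc i) (dead-below i w)

-- Decreasing words of rows

all-reverse : ∀ {P : ℕ → Set} {xs} → All P xs → All P (reverse xs)
all-reverse [] = []
all-reverse {P} {x ∷ xs} (p ∷ ps) = subst (All P) (sym (unfold-reverse x xs)) (All.++⁺ (all-reverse ps) (p ∷ []))

down : ℕ → Bits → List ℕ
down v A = reverse (letters v A)

down-true : ∀ v A → down v (true ∷ A) ≡ down (suc v) A ++ [ v ]
down-true v A = unfold-reverse v (letters (suc v) A)

down-≥ : ∀ v A → All (v ≤_) (down v A)
down-≥ v A = all-reverse (letters-≥ v A)

-- As the scan ascends, `low` and `rest` receive the letters of `A` and of `R` below `v`. If `v` is
-- in `A` and `R`, `v + 1` in `R` and `v - 1` not in `A`, the word contains `v`, then letters far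
-- from `v`, then `v + 1` and `v`, contrary to `good-over`.
sparse : ∀ p v A R low rest → length A ≡ length R → All (_< v) low →
  (p ≡ false → All (λ y → suc y < v) low) → Good (down v A ++ low ++ down v R ++ rest) → Sparse p A R
sparse p v [] [] low rest eq l q g = tt
sparse p v (false ∷ A) (false ∷ R) low rest eq l q g =
  sparse false (suc v) A R low rest (suc-injective eq) (All.map m≤n⇒m≤1+n l) (λ _ → All.map s≤s l) g
sparse p v (false ∷ A) (true ∷ R) low rest eq l q g =
  sparse false (suc v) A R low (v ∷ rest) (suc-injective eq) (All.map m≤n⇒m≤1+n l) (λ _ → All.map s≤s l)
    (subst (λ t → Good (down (suc v) A ++ low ++ t)) (trans (cong (_++ rest) (down-true v R)) (++-assoc (down (suc v) R) [ v ] rest)) g)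
sparse p v (true ∷ A) (false ∷ R) low rest eq l q g =
  sparse true (suc v) A R (v ∷ low) rest (suc-injective eq) (≤-refl ∷ All.map m≤n⇒m≤1+n l) (λ ())
    (subst Good (trans (cong (_++ _) (down-true v A)) (++-assoc (down (suc v) A) [ v ] _)) g)
sparse p v (true ∷ A) (true ∷ R) low rest eq l q g =
  next R eq g′ , sparse true (suc v) A R (v ∷ low) (v ∷ rest) (suc-injective eq) (≤-refl ∷ All.map m≤n⇒m≤1+n l) (λ ()) g′
  where
  g′ : Good (down (suc v) A ++ v ∷ low ++ down (suc v) R ++ v ∷ rest)
  g′ = subst Good (trans (cong₂ (λ s t → s ++ low ++ t) (down-true v A)
         (trans (cong (_++ rest) (down-true v R)) (++-assoc (down (suc v) R) [ v ] rest)))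
         (++-assoc (down (suc v) A) [ v ] _)) g
  next : ∀ R → suc (length A) ≡ suc (length R) → Good (down (suc v) A ++ v ∷ low ++ down (suc v) R ++ v ∷ rest) → p ≡ false → NextOff R
  next [] eq g e = tt
  next (false ∷ R) eq g e = tt
  next (true ∷ R) eq g e = good-over (down (suc v) A) v (low ++ down (suc (suc v)) R) rest
    (All.++⁺ (All.map (λ h → <⇒≢ (<⇒≤ h) , <⇒≢ h , <⇒≢ (m≤n⇒m≤1+n (<⇒≤ h))) (q e))
             (All.map (λ h → >⇒≢ (<⇒≤ h) , >⇒≢ (m≤n⇒m≤1+n (<⇒≤ h)) , >⇒≢ h) (down-≥ (suc (suc v)) R)))
    (subst (λ t → Good (down (suc v) A ++ v ∷ t))
      (trans (cong (λ t → low ++ t ++ v ∷ rest) (down-true (suc v) R))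
        (trans (cong (low ++_) (++-assoc (down (suc (suc v)) R) [ suc v ] (v ∷ rest))) (sym (++-assoc low _ _)))) g)

good-runs : ∀ A R → length A ≡ length R → Good (down 0 A ++ down 0 R) → Runs (norm 0 gap) A R
good-runs A R eq g = runs-gap 0 A R (sparse false 0 A R [] [] eq [] (λ _ → [])
  (subst (λ t → Good (down 0 A ++ t)) (sym (++-identityʳ (down 0 R))) g))

Sorted : List ℕ → Set
Sorted = AllPairs _<_

apart-< : ∀ {p q} → suc p < q → Apart p q
apart-< {zero} {suc q} h = h
apart-< {suc p} {suc q} (s≤s h) = apart-< h

apart-> : ∀ {p q} → suc q < p → Apart p q
apart-> {p} {q} h = subst (1 <_) (∣-∣-comm q p) (apart-< {q} {p} h)

sorted-++ : ∀ {x} L {Z} → Sorted (L ++ Z) → All (_< x) L → All (x <_) Z → Sorted (L ++ x ∷ Z)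
sorted-++ [] s [] q = q ∷ s
sorted-++ {x} (l ∷ L) {Z} (h ∷ s) (p ∷ ps) q =
  All.++⁺ (All.++⁻ˡ L h) (p ∷ All.map (<-trans p) q) ∷ sorted-++ L s ps q

sorted-drop : ∀ L {z Z} → Sorted (L ++ z ∷ Z) → Sorted (L ++ Z) × All (_< z) L × All (z <_) Z
sorted-drop [] (h ∷ s) = s , [] , h
sorted-drop (l ∷ L) {z} {Z} (h ∷ s) with sorted-drop L s | All.++⁻ʳ L h
... | s′ , p , q | h′ ∷ hs = All.++⁺ (All.++⁻ˡ L h) hs ∷ s′ , h′ ∷ p , q

data Place (x : ℕ) : List ℕ → Set where
  last    : ∀ {R} → All (_< x) R → Place x R
  replace : ∀ L z zs → All (_< x) L → x < z → Place x (L ++ z ∷ zs)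
  present : ∀ L zs → Place x (L ++ x ∷ zs)

place : ∀ x R → Sorted R → Place x R
place x [] [] = last []
place x (r ∷ R) (h ∷ s) with <-cmp r x
... | tri≈ _ refl _ = present [] R
... | tri> _ _ r>x = replace [] r R [] r>x
... | tri< r<x _ _ with place x R s
...   | last p = last (r<x ∷ p)
...   | replace L z zs p q = replace (r ∷ L) z zs (r<x ∷ p) q
...   | present L zs = present (r ∷ L) zs

reverse-mid : ∀ (L : List ℕ) z zs → reverse (L ++ z ∷ zs) ≡ reverse zs ++ z ∷ reverse L
reverse-mid L z zs = trans (reverse-++ L (z ∷ zs))
  (trans (cong (_++ reverse L) (unfold-reverse z zs)) (++-assoc (reverse zs) [ z ] (reverse L)))

reverse-∷ʳ : ∀ (L : List ℕ) z → reverse (L ++ [ z ]) ≡ z ∷ reverse L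
reverse-∷ʳ L z = reverse-++ L [ z ]

elem-split : ∀ x R → elem x R ≡ true → ∃[ L ] ∃[ Z ] R ≡ L ++ x ∷ Z
elem-split x (r ∷ R) eq with r ≟ x
... | yes refl = [] , R , refl
... | no r≢x rewrite ≡ᵇ-false r≢x with elem-split x R eq
...   | L , Z , refl = r ∷ L , Z , refl

elem-false⁻ : ∀ x R → elem x R ≡ false → All (_≢ x) R
elem-false⁻ x [] eq = []
elem-false⁻ x (r ∷ R) eq with r ≟ x
... | yes refl rewrite ≡ᵇ-refl r with () ← eq
... | no r≢x rewrite ≡ᵇ-false r≢x = r≢x ∷ elem-false⁻ x R eq

chainDown-bottom : ∀ R x → elem x R ≡ true →
  elem (chainDown R x) R ≡ true × (∀ n → suc n ≡ chainDown R x → elem n R ≡ false)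
chainDown-bottom R zero h = h , λ n ()
chainDown-bottom R (suc x) h with elem x R in eq
... | true = chainDown-bottom R x eq
... | false = h , λ { n refl → eq }

-- `x` commutes with the letters above `z`, and `z` with those below `x`: the respective other
-- letter lies strictly between.
~-replace : ∀ {x z} L zs → Sorted (L ++ z ∷ zs) → All (_< x) L → x < z →
  x ∷ reverse (L ++ z ∷ zs) ~ reverse (L ++ x ∷ zs) ++ [ z ]
~-replace {x} {z} L zs s p q with sorted-drop L s
... | _ , _ , h = ~-trans (~-reflexive (cong (x ∷_) (reverse-mid L z zs)))
  (~-trans (~-past x (reverse zs) (all-reverse (All.map (λ z<y → apart-< (≤-<-trans q z<y)) h)) _)
  (~-trans (~-++ (~-refl {reverse zs}) (~-∷ x
    (~-trans (~-reflexive (cong (z ∷_) (sym (++-identityʳ (reverse L)))))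
      (~-past z (reverse L) (all-reverse (All.map (λ y<x → apart-> (≤-<-trans y<x q)) p)) []))))
  (~-reflexive (trans (sym (++-assoc (reverse zs) (x ∷ reverse L) [ z ]))
    (cong (_++ [ z ]) (sym (reverse-mid L x zs)))))))

no-successor : ∀ {x} L zs → Sorted (L ++ x ∷ zs) → Good (x ∷ reverse (L ++ x ∷ zs)) → All (suc x <_) zs
no-successor L [] s g = []
no-successor {x} L (z ∷ zs) s g with sorted-drop L s
... | _ , _ , h ∷ _ with m≤n⇒m<n∨m≡n h
...   | inj₁ lt = lt ∷ All.map (<-trans lt) (proj₂ (proj₂ (sorted-drop (L ++ [ x ]) (subst Sorted (sym (++-assoc L [ x ] (z ∷ zs))) s))))
...   | inj₂ refl = ⊥-elim (good-over [] x (reverse zs) (reverse L)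
        (all-reverse (All.map (λ h → >⇒≢ (<⇒≤ h) , >⇒≢ (m≤n⇒m≤1+n (<⇒≤ h)) , >⇒≢ h)
          (proj₂ (proj₂ (sorted-drop (L ++ [ x ]) (subst Sorted (sym (++-assoc L [ x ] (z ∷ zs))) s))))))
        (subst (λ t → Good (x ∷ t)) (trans (reverse-mid L x (suc x ∷ zs))
          (trans (cong (_++ x ∷ reverse L) (unfold-reverse (suc x) zs)) (++-assoc (reverse zs) [ suc x ] _))) g))

~-absorb : ∀ {x} L zs → All (suc x <_) zs → x ∷ reverse (L ++ x ∷ zs) ~ reverse (L ++ x ∷ zs)
~-absorb {x} L zs h = ~-trans (~-reflexive (cong (x ∷_) (reverse-mid L x zs)))
  (~-trans (~-past x (reverse zs) (all-reverse (All.map apart-< h)) _)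
  (~-trans (~-++ (~-refl {reverse zs}) (~-idem x (reverse L)))
  (~-reflexive (sym (reverse-mid L x zs)))))

~-emit : ∀ {y} L zs → All (λ l → suc l < y) L → reverse (L ++ y ∷ zs) ++ [ y ] ~ reverse (L ++ y ∷ zs)
~-emit {y} L zs h = ~-trans (~-reflexive (trans (cong (_++ [ y ]) (reverse-mid L y zs)) (++-assoc (reverse zs) (y ∷ reverse L) [ y ])))
  (~-trans (~-++ (~-refl {reverse zs}) (~-trans (~-∷ y (~-sym
    (~-trans (~-reflexive (cong (y ∷_) (sym (++-identityʳ (reverse L))))) (~-past y (reverse L) (all-reverse (All.map apart-> h)) []))))
    (~-idem y (reverse L))))
  (~-reflexive (sym (reverse-mid L y zs))))

data Inserted (P : ℕ → Set) (x : ℕ) (R : List ℕ) : Set where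
  appended : ∀ {R′} → rowIns x R ≡ (R′ , nothing) → Sorted R′ → All P R′ →
             x ∷ reverse R ~ reverse R′ → Inserted P x R
  bumped   : ∀ {R′ y} → rowIns x R ≡ (R′ , just y) → Sorted R′ → All P R′ → P y →
             x ∷ reverse R ~ reverse R′ ++ [ y ] → Inserted P x R

-- Case 3 uses idempotency twice: `x` is absorbed by its copy in the row, and the bottom `y` of the
-- interval is doubled. The required moves are commutations, as `x + 1` is absent by goodness and
-- `y - 1` by the choice of `y`.
row-inserted : ∀ {P x R} → Sorted R → All P R → P x → Good (x ∷ reverse R) → Inserted P x R
row-inserted {P} {x} {R} s ps px g with place x R s
... | last p = appended (rowIns-append p)
    (sorted-++ R (subst Sorted (sym (++-identityʳ R)) s) p [])
    (All.++⁺ ps (px ∷ [])) (~-reflexive (sym (reverse-∷ʳ R x)))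
... | replace L z zs p q with sorted-drop L s | All.++⁻ L ps
...   | s′ , _ , h | pl , pz ∷ pzs = bumped (rowIns-replace L p (q ∷ All.map (<-trans q) h))
      (sorted-++ L s′ p (All.map (<-trans q) h)) (All.++⁺ pl (px ∷ pzs)) pz (~-replace L zs s p q)
row-inserted {P} {x} s ps px g | present L zs
  with chainDown-bottom (L ++ x ∷ zs) x (elem-mid x L)
... | e , n with elem-split _ (L ++ x ∷ zs) e
...   | L′ , zs′ , eq = bumped (rowIns-present x L) s ps (P-y (subst (All P) eq ps))
        (~-trans (~-absorb L zs (no-successor L zs s g))
        (~-trans (~-reflexive (cong reverse eq))
        (~-trans (~-sym (~-emit L′ zs′ (lower L′ (proj₁ (proj₂ (sorted-drop L′ (subst Sorted eq s))))
                          (λ n′ e′ → All.++⁻ˡ L′ (subst (All (_≢ n′)) eq (elem-false⁻ n′ _ (n n′ e′)))))))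
        (~-reflexive (cong (λ t → reverse t ++ _) (sym eq))))))
  where
  P-y : ∀ {y} → All P (L′ ++ y ∷ zs′) → P y
  P-y h with _ , py ∷ _ ← All.++⁻ L′ h = py
  lower : ∀ {y} L → All (_< y) L → (∀ n → suc n ≡ y → All (_≢ n) L) → All (λ l → suc l < y) L
  lower [] [] h = []
  lower (l ∷ L) (p ∷ ps) h = ≤∧≢⇒< p (λ e → All.head (h l e) refl) ∷ lower L ps (λ n e → All.tail (h n e))

insRow-~ : ∀ xs R → Sorted R → Good (reverse xs ++ reverse R) →
  reverse xs ++ reverse R ~ reverse (proj₁ (insRow xs R)) ++ reverse (proj₁ (proj₂ (insRow xs R)))
insRow-~ [] R s g = ~-reflexive (sym (++-identityʳ (reverse R)))
insRow-~ (x ∷ xs) R s g = step (row-inserted {λ _ → ⊤} {x} s (All.universal (λ _ → tt) R) tt (good-++ʳ (reverse xs) g′))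
  where
  eq : ∀ v → reverse (x ∷ xs) ++ v ≡ reverse xs ++ x ∷ v
  eq v = trans (cong (_++ v) (unfold-reverse x xs)) (++-assoc (reverse xs) [ x ] v)
  g′ : Good (reverse xs ++ x ∷ reverse R)
  g′ = subst Good (eq (reverse R)) g
  step : Inserted (λ _ → ⊤) x R → reverse (x ∷ xs) ++ reverse R ~
    reverse (proj₁ (insRow (x ∷ xs) R)) ++ reverse (proj₁ (proj₂ (insRow (x ∷ xs) R)))
  step (appended {R′} e s′ _ h) rewrite e =
    ~-trans (~-reflexive (eq (reverse R))) (~-trans h′ (insRow-~ xs R′ s′ (good-~ h′ g′)))
    where
    h′ : reverse xs ++ x ∷ reverse R ~ reverse xs ++ reverse R′
    h′ = ~-++ (~-refl {reverse xs}) h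
  step (bumped {R′} {y} e s′ _ _ h) rewrite e =
    ~-trans (~-reflexive (eq (reverse R))) (~-trans h′
      (~-trans (~-++ (insRow-~ xs R′ s′ (good-++ˡ _ (good-~ h′ g′))) (~-refl {[ y ]}))
        (~-reflexive (trans (++-assoc (reverse (proj₁ (insRow xs R′))) _ [ y ])
          (cong (reverse (proj₁ (insRow xs R′)) ++_) (sym (unfold-reverse y (proj₁ (proj₂ (insRow xs R′))))))))))
    where
    h′ : reverse xs ++ x ∷ reverse R ~ (reverse xs ++ reverse R′) ++ [ y ]
    h′ = ~-trans (~-++ (~-refl {reverse xs}) h) (~-reflexive (sym (++-assoc (reverse xs) (reverse R′) [ y ])))

readT : Tableau → List ℕ
readT P = concat (map reverse P)

record Rows (N : ℕ) (P : Tableau) : Set where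
  constructor rows
  field
    sorted  : All Sorted P
    bounded : All (All (_< N)) P

insertP-rows : ∀ {N x} P → Rows N P → x < N → Good (x ∷ readT P) →
  Rows N (proj₁ (insertP x P)) × x ∷ readT P ~ readT (proj₁ (insertP x P))
insertP-rows [] (rows [] []) px g = rows (([] ∷ []) ∷ []) ((px ∷ []) ∷ []) , ~-refl
insertP-rows {N} {x} (R ∷ Rs) (rows (s ∷ ss) (b ∷ bs)) px g
  with row-inserted {_< N} {x} s b px (good-++ˡ (x ∷ reverse R) g)
... | appended e s′ b′ h rewrite e = rows (s′ ∷ ss) (b′ ∷ bs) , ~-++ h ~-refl
... | bumped {R′} {y} e s′ b′ py h rewrite e with insertP-rows Rs (rows ss bs) py (good-++ʳ (reverse R′) (good-~ h′ g))
  where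
  h′ : (x ∷ reverse R) ++ readT Rs ~ reverse R′ ++ y ∷ readT Rs
  h′ = ~-trans (~-++ h (~-refl {readT Rs})) (~-reflexive (++-assoc (reverse R′) [ y ] (readT Rs)))
...   | rows ss′ bs′ , h″ = rows (s′ ∷ ss′) (b′ ∷ bs′) ,
  ~-trans (~-++ h (~-refl {readT Rs})) (~-trans (~-reflexive (++-assoc (reverse R′) [ y ] (readT Rs))) (~-++ (~-refl {reverse R′}) h″))

-- Sorted lists as bit lists

to-bits : ∀ n v R → Sorted R → All (v ≤_) R → All (_< n + v) R → ∃[ A ] length A ≡ n × letters v A ≡ R
to-bits zero v [] s p q = [] , refl , refl
to-bits zero v (r ∷ R) s (p ∷ _) (q ∷ _) = ⊥-elim (<⇒≱ q p)
to-bits (suc n) v [] s p q with to-bits n (suc v) [] [] [] []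
... | A , refl , eq = false ∷ A , refl , eq
to-bits (suc n) v (r ∷ R) (h ∷ s) (p ∷ ps) (q ∷ qs) with m≤n⇒m<n∨m≡n p
... | inj₂ refl with to-bits n (suc v) R s h (All.map (λ lt → ≤-trans lt (≤-reflexive (sym (+-suc n v)))) qs)
...   | A , refl , refl = true ∷ A , refl , refl
to-bits (suc n) v (r ∷ R) (h ∷ s) (p ∷ ps) (q ∷ qs) | inj₁ lt
  with to-bits n (suc v) (r ∷ R) (h ∷ s) (lt ∷ All.map (<-trans lt) h) (All.map (λ lt → ≤-trans lt (≤-reflexive (sym (+-suc n v)))) (q ∷ qs))
... | A , refl , eq = false ∷ A , refl , eq

letters-sorted : ∀ v A → Sorted (letters v A)
letters-sorted v [] = []
letters-sorted v (true ∷ A) = letters-≥ (suc v) A ∷ letters-sorted (suc v) A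
letters-sorted v (false ∷ A) = letters-sorted (suc v) A

-- Fully commutative words are good

apart : ∀ {i y} → y ≢ i → suc y ≢ i → y ≢ suc i → Apart i y
apart {i} {y} p q r with <-cmp i y
... | tri< i<y _ _ = apart-< (≤∧≢⇒< i<y (r ∘ sym))
... | tri≈ _ refl _ = ⊥-elim (p refl)
... | tri> _ _ y<i = apart-> {i} {y} (≤∧≢⇒< y<i q)

-- For adjacent letters the hypothesis is contradictory; for distant ones a braid is composed of
-- commutations and idempotents.
good-braid : ∀ u v p q → Good (u ++ p ∷ q ∷ p ∷ v) → Good (u ++ q ∷ p ∷ q ∷ v)
good-braid u v p q g with q ≟ p | suc q ≟ p | q ≟ suc p
... | yes refl | _ | _ = g
... | no _ | yes refl | _ = ⊥-elim (good-below u q v g)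
... | no _ | no _ | yes refl = ⊥-elim (good-over u p [] v [] g)
... | no h₁ | no h₂ | no h₃ = good-~ (~-++ (~-refl {u})
    (~-trans (~-∷ p (~-comm qp v)) (~-trans (~-idem p (q ∷ v))
      (~-trans (~-comm pq v) (~-trans (~-sym (~-idem q (p ∷ v))) (~-∷ q (~-comm qp v))))))) g
  where
  pq : Apart p q
  pq = apart h₁ h₂ h₃
  qp : Apart q p
  qp = subst (1 <_) (∣-∣-comm p q) pq

good-step : ∀ {u v} → HeckeStep u v → Good u → Good v
good-step (comm u v p q h) = good-~ (~-++ (~-refl {u}) (~-comm h v))
good-step (braid u v p q) = good-braid u v p q
good-step (idem u v p) = good-~ (~-++ (~-refl {u}) (~-idem p v))

good-step⁻¹ : ∀ {u v} → HeckeStep u v → Good v → Good u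
good-step⁻¹ (comm u v p q h) = good-~ (~-sym (~-++ (~-refl {u}) (~-comm h v)))
good-step⁻¹ (braid u v p q) = good-braid u v q p
good-step⁻¹ (idem u v p) = good-~ (~-sym (~-++ (~-refl {u}) (~-idem p v)))

good-≈H : ∀ {u v} → u ≈H v → Good u → Good v
good-≈H ε g = g
good-≈H (fwd x ◅ xs) g = good-≈H xs (good-step x g)
good-≈H (bwd x ◅ xs) g = good-≈H xs (good-step⁻¹ x g)

-- Minimal words of a fully commutative class

≈H-trans : ∀ {u v w} → u ≈H v → v ≈H w → u ≈H w
≈H-trans = EqClosure.transitive HeckeStep

≈H-sym : ∀ {u v} → u ≈H v → v ≈H u
≈H-sym = EqClosure.symmetric HeckeStep

≈H-++ : ∀ (p : List ℕ) {u v} → u ≈H v → (p ++ u) ≈H (p ++ v)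
≈H-++ p = EqClosure.gmap (p ++_) step
  where
  step : ∀ {u v} → HeckeStep u v → HeckeStep (p ++ u) (p ++ v)
  step (comm u v a b h) rewrite sym (++-assoc p u (a ∷ b ∷ v)) | sym (++-assoc p u (b ∷ a ∷ v)) = comm (p ++ u) v a b h
  step (braid u v a b) rewrite sym (++-assoc p u (a ∷ b ∷ a ∷ v)) | sym (++-assoc p u (b ∷ a ∷ b ∷ v)) = braid (p ++ u) v a b
  step (idem u v a) rewrite sym (++-assoc p u (a ∷ a ∷ v)) | sym (++-assoc p u (a ∷ v)) = idem (p ++ u) v a

≈H-slide : ∀ {x} m v → All (Apart x) m → (x ∷ m ++ v) ≈H (m ++ x ∷ v)
≈H-slide [] v [] = ε
≈H-slide {x} (y ∷ m) v (p ∷ ps) = fwd (comm [] (m ++ v) x y p) ◅ ≈H-++ [ y ] (≈H-slide m v ps)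

length-slide : ∀ {x : ℕ} m v → length (m ++ x ∷ v) ≡ suc (length (m ++ v))
length-slide [] v = refl
length-slide (y ∷ m) v = cong suc (length-slide m v)

length-++-cong : ∀ (p : List ℕ) {u v : List ℕ} → length u ≡ length v → length (p ++ u) ≡ length (p ++ v)
length-++-cong [] eq = eq
length-++-cong (x ∷ p) eq = cong suc (length-++-cong p eq)

data Occurs (k : ℕ) : List ℕ → Set where
  never : ∀ {m} → All (_≢ k) m → Occurs k m
  once  : ∀ m₁ m₂ → All (_≢ k) m₁ → All (_≢ k) m₂ → Occurs k (m₁ ++ k ∷ m₂)
  more  : ∀ m₁ m₂ m₃ → All (_≢ k) m₂ → Occurs k (m₁ ++ k ∷ m₂ ++ k ∷ m₃)

occurs : ∀ k m → Occurs k m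
occurs k [] = never []
occurs k (x ∷ m) with x ≟ k | occurs k m
... | no h | never p = never (h ∷ p)
... | no h | once m₁ m₂ p q = once (x ∷ m₁) m₂ (h ∷ p) q
... | no h | more m₁ m₂ m₃ p = more (x ∷ m₁) m₂ m₃ p
... | yes refl | never p = once [] m [] p
... | yes refl | once m₁ m₂ p q = more [] m₁ m₂ p
... | yes refl | more m₁ m₂ m₃ p with occurs-first k m₁
  where
  occurs-first : ∀ k m → All (_≢ k) m ⊎ ∃[ a ] ∃[ b ] (m ≡ a ++ k ∷ b × All (_≢ k) a)
  occurs-first k [] = inj₁ []
  occurs-first k (y ∷ m) with y ≟ k | occurs-first k m
  ... | yes refl | _ = inj₂ ([] , m , refl , [])
  ... | no h | inj₁ p = inj₁ (h ∷ p)
  ... | no h | inj₂ (a , b , refl , p) = inj₂ (y ∷ a , b , refl , h ∷ p)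
...   | inj₁ q = more [] m₁ (m₂ ++ k ∷ m₃) q
...   | inj₂ (a , b , refl , q) = subst (λ t → Occurs k (k ∷ t)) (sym (++-assoc a (k ∷ b) _)) (more [] a (b ++ k ∷ m₂ ++ k ∷ m₃) q)

OneSided : ℕ → List ℕ → Set
OneSided i m = All (λ y → y ≢ i × suc y ≢ i) m ⊎ All (λ y → y ≢ i × y ≢ suc i) m

nested : ∀ (p : List ℕ) i m₁ k m₂ m₃ z →
  p ++ i ∷ (m₁ ++ k ∷ m₂ ++ k ∷ m₃) ++ i ∷ z ≡ (p ++ i ∷ m₁) ++ k ∷ m₂ ++ k ∷ (m₃ ++ i ∷ z)
nested p i m₁ k m₂ m₃ z = trans (cong (λ t → p ++ i ∷ t)
  (trans (++-assoc m₁ (k ∷ m₂ ++ k ∷ m₃) (i ∷ z)) (cong (λ t → m₁ ++ k ∷ t) (++-assoc m₂ (k ∷ m₃) (i ∷ z)))))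
  (sym (++-assoc p (i ∷ m₁) _))

nested-length : ∀ (m₁ : List ℕ) {k} m₂ m₃ → length m₂ < length (m₁ ++ k ∷ m₂ ++ k ∷ m₃)
nested-length [] {k} m₂ m₃ = s≤s (≤-trans (m≤m+n (length m₂) _) (≤-reflexive (sym (length-++ m₂))))
nested-length (x ∷ m₁) m₂ m₃ = m≤n⇒m≤1+n (nested-length m₁ m₂ m₃)

module _ {w : List ℕ} (fc : FullyCommutative w) {u : List ℕ} (mn : MinimalEquiv w u) where

  no-repeat : ∀ p i m z → u ≡ p ++ i ∷ m ++ i ∷ z → All (Apart i) m → ⊥
  no-repeat p i m z refl h = <⇒≱ shorter (proj₂ mn (p ++ m ++ i ∷ z) (≈H-trans (≈H-sym equiv) (proj₁ mn)))
    where
    equiv : (p ++ i ∷ m ++ i ∷ z) ≈H (p ++ m ++ i ∷ z)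
    equiv = ≈H-++ p (≈H-trans (≈H-slide m (i ∷ z) h) (≈H-++ m (fwd (idem [] z i) ◅ ε)))
    shorter : length (p ++ m ++ i ∷ z) < length (p ++ i ∷ m ++ i ∷ z)
    shorter = ≤-reflexive (sym (length-slide p (m ++ i ∷ z)))

  no-triple : ∀ p i j m₁ m₂ z → u ≡ p ++ i ∷ (m₁ ++ j ∷ m₂) ++ i ∷ z → All (Apart i) m₁ → All (Apart i) m₂ →
    MinimalEquiv w ((p ++ m₁) ++ i ∷ j ∷ i ∷ m₂ ++ z)
  no-triple p i j m₁ m₂ z refl h₁ h₂ = ≈H-trans (≈H-sym equiv) (proj₁ mn) ,
    λ v e → subst (_≤ length v) same-length (proj₂ mn v e)
    where
    assoc₁ : p ++ i ∷ (m₁ ++ j ∷ m₂) ++ i ∷ z ≡ p ++ i ∷ (m₁ ++ j ∷ m₂ ++ i ∷ z)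
    assoc₁ = cong (λ t → p ++ i ∷ t) (++-assoc m₁ (j ∷ m₂) (i ∷ z))
    assoc₂ : p ++ m₁ ++ i ∷ j ∷ i ∷ m₂ ++ z ≡ (p ++ m₁) ++ i ∷ j ∷ i ∷ m₂ ++ z
    assoc₂ = sym (++-assoc p m₁ _)
    equiv : (p ++ i ∷ (m₁ ++ j ∷ m₂) ++ i ∷ z) ≈H ((p ++ m₁) ++ i ∷ j ∷ i ∷ m₂ ++ z)
    equiv = subst₂ _≈H_ (sym assoc₁) assoc₂ (≈H-++ p (≈H-trans (≈H-slide m₁ _ h₁)
      (≈H-++ m₁ (≈H-++ (i ∷ j ∷ []) (≈H-sym (≈H-slide m₂ z h₂))))))
    same-length : length (p ++ i ∷ (m₁ ++ j ∷ m₂) ++ i ∷ z) ≡ length ((p ++ m₁) ++ i ∷ j ∷ i ∷ m₂ ++ z)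
    same-length = trans (cong length assoc₁) (trans (length-++-cong p (trans (sym (length-slide {i} m₁ (j ∷ m₂ ++ i ∷ z)))
      (length-++-cong m₁ (cong (suc ∘ suc) (length-slide m₂ z))))) (cong length assoc₂))

  -- Count the one neighbour of `i` that may occur in `m`. If it is absent, the two `i` can be
  -- merged, against minimality. If it occurs once, commutations expose a forbidden braid factor in
  -- a word of the same length. Otherwise two consecutive occurrences enclose no `i`, which gives a
  -- shorter one-sided factor.
  no-one-sided : ∀ n p i m z → length m < n → u ≡ p ++ i ∷ m ++ i ∷ z → OneSided i m → ⊥
  no-one-sided (suc n) p i m z (s≤s le) eq (inj₁ h) with occurs (suc i) m
  ... | never q = no-repeat p i m z eq (All.zipWith (λ { ((a , b) , c) → apart a b c }) (h , q))
  ... | once m₁ m₂ q₁ q₂ = proj₁ (fc _ (no-triple p i (suc i) m₁ m₂ z eq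
          (All.zipWith (λ { ((a , b) , c) → apart a b c }) (All.++⁻ˡ m₁ h , q₁))
          (All.zipWith (λ { ((a , b) , c) → apart a b c }) (All.tail (All.++⁻ʳ m₁ h) , q₂)))
          (p ++ m₁) (m₂ ++ z) i) refl
  ... | more m₁ m₂ m₃ q =
    no-one-sided n (p ++ i ∷ m₁) (suc i) m₂ (m₃ ++ i ∷ z) (<-≤-trans (nested-length m₁ m₂ m₃) le)
      (trans eq (nested p i m₁ (suc i) m₂ m₃ z))
      (inj₁ (All.zipWith (λ { ((a , _) , c) → c , a ∘ suc-injective }) (All.++⁻ˡ m₂ (All.tail (All.++⁻ʳ m₁ h)) , q)))
  no-one-sided (suc n) p zero m z le eq (inj₂ h) =
    no-repeat p zero m z eq (All.map (λ { (a , b) → apart a (λ ()) b }) h)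
  no-one-sided (suc n) p (suc j) m z (s≤s le) eq (inj₂ h) with occurs j m
  ... | never q = no-repeat p (suc j) m z eq (All.zipWith (λ { ((a , b) , c) → apart a (c ∘ suc-injective) b }) (h , q))
  ... | once m₁ m₂ q₁ q₂ = proj₂ (fc _ (no-triple p (suc j) j m₁ m₂ z eq
          (All.zipWith (λ { ((a , b) , c) → apart a (c ∘ suc-injective) b }) (All.++⁻ˡ m₁ h , q₁))
          (All.zipWith (λ { ((a , b) , c) → apart a (c ∘ suc-injective) b }) (All.tail (All.++⁻ʳ m₁ h) , q₂)))
          (p ++ m₁) (m₂ ++ z) j) refl
  ... | more m₁ m₂ m₃ q =
    no-one-sided n (p ++ suc j ∷ m₁) j m₂ (m₃ ++ suc j ∷ z) (<-≤-trans (nested-length m₁ m₂ m₃) le)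
      (trans eq (nested p (suc j) m₁ j m₂ m₃ z))
      (inj₂ (All.zipWith (λ { ((a , _) , c) → c , a }) (All.++⁻ˡ m₂ (All.tail (All.++⁻ʳ m₁ h)) , q)))

OneSidedFactor : ℕ → List ℕ → Set
OneSidedFactor i u = ∃[ p ] ∃[ m ] ∃[ z ] u ≡ p ++ i ∷ m ++ i ∷ z × OneSided i m

find-after : ∀ {u} i p m w l r → u ≡ p ++ i ∷ m ++ w → All (_≢ i) m →
  (l ≡ false → All (λ y → suc y ≢ i) m) → (r ≡ false → All (λ y → y ≢ suc i) m) →
  read i w (seen l r) ≡ dead → OneSidedFactor i u
find-after i p m (x ∷ w) l r e n hl hr d with locate i x
find-after i p m (_ ∷ w) true false e n hl hr d | at = p , m , w , e , inj₂ (All.zip (n , hr refl))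
find-after i p m (_ ∷ w) false true e n hl hr d | at = p , m , w , e , inj₁ (All.zip (n , hl refl))
find-after i p m (_ ∷ w) true true e n hl hr d | at =
  find-after i (p ++ i ∷ m) [] w false false (trans e (sym (++-assoc p (i ∷ m) (i ∷ w)))) [] (λ _ → []) (λ _ → []) d
find-after i p m (_ ∷ w) false false e n hl hr d | at =
  find-after i (p ++ i ∷ m) [] w false false (trans e (sym (++-assoc p (i ∷ m) (i ∷ w)))) [] (λ _ → []) (λ _ → []) d
find-after _ p m (x ∷ w) l r e n hl hr d | below =
  find-after (suc x) p (m ++ [ x ]) w true r (trans e (cong (λ t → p ++ suc x ∷ t) (sym (++-assoc m [ x ] w))))
    (All.∷ʳ⁺ n (1+n≢n ∘ sym)) (λ ()) (λ q → All.∷ʳ⁺ (hr q) (m≢1+n+m x {1})) d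
find-after i p m (_ ∷ w) l r e n hl hr d | over =
  find-after i p (m ++ [ suc i ]) w l true (trans e (cong (λ t → p ++ i ∷ t) (sym (++-assoc m [ suc i ] w))))
    (All.∷ʳ⁺ n 1+n≢n) (λ q → All.∷ʳ⁺ (hl q) (m≢1+n+m i {1} ∘ sym)) (λ ()) d
find-after i p m (x ∷ w) l r e n hl hr d | far a b c =
  find-after i p (m ++ [ x ]) w l r (trans e (cong (λ t → p ++ i ∷ t) (sym (++-assoc m [ x ] w))))
    (All.∷ʳ⁺ n a) (λ q → All.∷ʳ⁺ (hl q) b) (λ q → All.∷ʳ⁺ (hr q) c) d

-- From `seen true true` the first `i` is always harmless, so dying here exhibits two actual letters
-- `i` of the word.
find-factor : ∀ {u} i p w → u ≡ p ++ w → read i w (seen true true) ≡ dead → OneSidedFactor i u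
find-factor i p (x ∷ w) e d with locate i x
... | at = find-after i p [] w false false e [] (λ _ → []) (λ _ → []) d
... | below = find-factor (suc x) (p ++ [ x ]) w (trans e (sym (++-assoc p [ x ] w))) d
... | over = find-factor i (p ++ [ suc i ]) w (trans e (sym (++-assoc p [ suc i ] w))) d
... | far _ _ _ = find-factor i (p ++ [ x ]) w (trans e (sym (++-assoc p [ x ] w))) d

minimal-good : ∀ {w u} → FullyCommutative w → MinimalEquiv w u → Good u
minimal-good {u = u} fc mn = good λ i h → let p , m , z , e , o = find-factor i [] u refl (h (seen true true)) in
  no-one-sided fc mn (suc (length m)) p i m z ≤-refl e o

minimal-exists : ∀ w n u → u ≈H w → length u < n → ¬ ¬ (∃[ v ] MinimalEquiv w v)
minimal-exists w (suc n) u e (s≤s le) k = k (u , e , λ v e′ → ≮⇒≥ λ lt →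
  minimal-exists w n v e′ (<-≤-trans lt le) k)

fullyCommutative-good : ∀ {w} → FullyCommutative w → Good w
fullyCommutative-good {w} fc = good λ i h → minimal-exists w (suc (length w)) w ε ≤-refl
  λ { (u , mn) → alive (good-≈H (proj₁ mn) (minimal-good fc mn)) i h }

-- The operator f⋆ on bit lists

free : ℕ → Bits → Bits → List ℕ
free v (false ∷ A) (false ∷ B) = free (suc v) A B
free v (true ∷ A) (false ∷ B) = v ∷ free (suc v) A B
free v (false ∷ A) (true ∷ B) = drop 1 (free (suc v) A B)
free v (true ∷ A) (true ∷ B) = free (suc v) A B
free v _ _ = []

sorted-tail : ∀ {F} → Sorted F → Sorted (drop 1 F)
sorted-tail [] = []
sorted-tail (_ ∷ s) = s

free-sorted : ∀ v A B → Sorted (free v A B) × All (v ≤_) (free v A B)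
free-sorted v [] [] = [] , []
free-sorted v [] (_ ∷ _) = [] , []
free-sorted v (false ∷ A) [] = [] , []
free-sorted v (true ∷ A) [] = [] , []
free-sorted v (a ∷ A) (b ∷ B) with free-sorted (suc v) A B
free-sorted v (false ∷ A) (false ∷ B) | s , p = s , All.map <⇒≤ p
free-sorted v (true ∷ A) (false ∷ B) | s , p = p ∷ s , ≤-refl ∷ All.map <⇒≤ p
free-sorted v (false ∷ A) (true ∷ B) | s , p = sorted-tail s , All.drop⁺ 1 (All.map <⇒≤ p)
free-sorted v (true ∷ A) (true ∷ B) | s , p = s , All.map <⇒≤ p

≤ᵇ-true : ∀ {m n} → m ≤ n → (m ≤ᵇ n) ≡ true
≤ᵇ-true p = T⇒≡ (≤⇒≤ᵇ p)

≤ᵇ-false : ∀ {m n} → n < m → (m ≤ᵇ n) ≡ false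
≤ᵇ-false {m} {n} p = ¬T⇒≡ (λ t → <⇒≱ p (≤ᵇ⇒≤ m n t))

minGE-nothing : ∀ {v low} → All (_< v) low → minGE v low ≡ nothing
minGE-nothing [] = refl
minGE-nothing (p ∷ ps) rewrite ≤ᵇ-false p = minGE-nothing ps

minGE-just : ∀ {v f} X {low} → v ≤ f → All (f <_) X → All (_< v) low → minGE v (X ++ f ∷ low) ≡ just f
minGE-just [] p [] q rewrite minGE-nothing q | ≤ᵇ-true p = refl
minGE-just {v} {f} (x ∷ X) {low} p (h ∷ hs) q
  rewrite minGE-just {v} {f} X {low} p hs q | ≤ᵇ-true (≤-trans p (<⇒≤ h)) | <ᵇ-false (<⇒≤ h) = refl

remove-absent : ∀ {x X} → All (_≢ x) X → remove x X ≡ X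
remove-absent [] = refl
remove-absent {x} {y ∷ X} (p ∷ ps) rewrite ≡ᵇ-false p = cong (y ∷_) (remove-absent ps)

remove-++ : ∀ x X Y → remove x (X ++ Y) ≡ remove x X ++ remove x Y
remove-++ x [] Y = refl
remove-++ x (y ∷ X) Y with y ≡ᵇ x
... | true = remove-++ x X Y
... | false = cong (y ∷_) (remove-++ x X Y)

remove-mid : ∀ {x X Y} → All (_≢ x) X → All (_≢ x) Y → remove x (X ++ x ∷ Y) ≡ X ++ Y
remove-mid {x} {X} {Y} p q = trans (remove-++ x X (x ∷ Y)) (cong₂ _++_ (remove-absent p) eq)
  where
  eq : remove x (x ∷ Y) ≡ Y
  eq rewrite ≡ᵇ-refl x = remove-absent q

pairOff-least : ∀ {v} F low → Sorted F → All (v ≤_) F → All (_< v) low →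
  pairOff (reverse F ++ low) v ≡ reverse (drop 1 F) ++ low
pairOff-least [] low s p q rewrite minGE-nothing q = refl
pairOff-least {v} (f ∷ F) low (h ∷ s) (p ∷ _) q
  rewrite unfold-reverse f F | ++-assoc (reverse F) [ f ] low
        | minGE-just {v} {f} (reverse F) {low} p (all-reverse h) q =
  remove-mid (all-reverse (All.map >⇒≢ h)) (All.map (λ l<v → <⇒≢ (<-≤-trans l<v p)) q)

down-++ : ∀ v A low → down v (true ∷ A) ++ low ≡ down (suc v) A ++ v ∷ low
down-++ v A low = trans (cong (_++ low) (down-true v A)) (++-assoc (down (suc v) A) [ v ] low)

-- Letters of the second factor from `v` on never pair with `low`. Among them `v` is processed last,
-- so it takes the least letter still unpaired, which explains the `drop 1` in `free`.
unpaired-free : ∀ v A B low → length A ≡ length B → All (_< v) low →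
  unpaired (down v A ++ low) (down v B) ≡ reverse (free v A B) ++ low
unpaired-free v [] [] low e p = refl
unpaired-free v (false ∷ A) (false ∷ B) low e p =
  unpaired-free (suc v) A B low (suc-injective e) (All.map m≤n⇒m≤1+n p)
unpaired-free v (true ∷ A) (false ∷ B) low e p = begin
  unpaired (down v (true ∷ A) ++ low) (down (suc v) B)  ≡⟨ cong (λ t → unpaired t (down (suc v) B)) (down-++ v A low) ⟩
  unpaired (down (suc v) A ++ v ∷ low) (down (suc v) B) ≡⟨ unpaired-free (suc v) A B (v ∷ low) (suc-injective e) (≤-refl ∷ All.map m≤n⇒m≤1+n p) ⟩
  reverse (free (suc v) A B) ++ v ∷ low                 ≡⟨ ++-assoc (reverse (free (suc v) A B)) [ v ] low ⟨
  (reverse (free (suc v) A B) ++ [ v ]) ++ low          ≡⟨ cong (_++ low) (unfold-reverse v (free (suc v) A B)) ⟨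
  reverse (v ∷ free (suc v) A B) ++ low                 ∎
  where open ≡-Reasoning
unpaired-free v (false ∷ A) (true ∷ B) low e p = begin
  unpaired (down (suc v) A ++ low) (down v (true ∷ B))         ≡⟨ cong (unpaired (down (suc v) A ++ low)) (down-true v B) ⟩
  unpaired (down (suc v) A ++ low) (down (suc v) B ++ [ v ])   ≡⟨ foldl-++ pairOff _ (down (suc v) B) [ v ] ⟩
  pairOff (unpaired (down (suc v) A ++ low) (down (suc v) B)) v
    ≡⟨ cong (λ t → pairOff t v) (unpaired-free (suc v) A B low (suc-injective e) (All.map m≤n⇒m≤1+n p)) ⟩
  pairOff (reverse (free (suc v) A B) ++ low) v
    ≡⟨ pairOff-least (free (suc v) A B) low (proj₁ s) (All.map <⇒≤ (proj₂ s)) p ⟩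
  reverse (drop 1 (free (suc v) A B)) ++ low                   ∎
  where
  open ≡-Reasoning
  s = free-sorted (suc v) A B
unpaired-free v (true ∷ A) (true ∷ B) low e p = begin
  unpaired (down v (true ∷ A) ++ low) (down v (true ∷ B))          ≡⟨ cong₂ unpaired (down-++ v A low) (down-true v B) ⟩
  unpaired (down (suc v) A ++ v ∷ low) (down (suc v) B ++ [ v ])   ≡⟨ foldl-++ pairOff _ (down (suc v) B) [ v ] ⟩
  pairOff (unpaired (down (suc v) A ++ v ∷ low) (down (suc v) B)) v
    ≡⟨ cong (λ t → pairOff t v) (unpaired-free (suc v) A B (v ∷ low) (suc-injective e) (≤-refl ∷ All.map m≤n⇒m≤1+n p)) ⟩
  pairOff (reverse (free (suc v) A B) ++ v ∷ low) v
    ≡⟨ cong (λ t → pairOff t v) (trans (cong (_++ low) (unfold-reverse v (free (suc v) A B))) (++-assoc (reverse (free (suc v) A B)) [ v ] low)) ⟨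
  pairOff (reverse (v ∷ free (suc v) A B) ++ low) v
    ≡⟨ pairOff-least (v ∷ free (suc v) A B) low (proj₂ s ∷ proj₁ s) (≤-refl ∷ All.map <⇒≤ (proj₂ s)) p ⟩
  reverse (free (suc v) A B) ++ low                                ∎
  where
  open ≡-Reasoning
  s = free-sorted (suc v) A B

-- The brackets left open below `v` take the least `proj₂ s` letters of `free`.
paired-free : ∀ {s} v A B → Paired s A B → drop (proj₂ s) (free v A B) ≡ []
paired-free {u , zero} v [] [] p = refl
paired-free {u , zero} v [] (_ ∷ _) p = refl
paired-free {u , zero} v (false ∷ A) [] p = refl
paired-free {u , zero} v (true ∷ A) [] p = refl
paired-free {u , suc o} v [] [] p = refl
paired-free {u , suc o} v [] (_ ∷ _) p = refl
paired-free {u , suc o} v (false ∷ A) [] p = refl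
paired-free {u , suc o} v (true ∷ A) [] p = refl
paired-free v (false ∷ A) (false ∷ B) p = paired-free (suc v) A B (paired-tail false false p)
paired-free {u , zero} v (true ∷ A) (false ∷ B) p = ⊥-elim (closing-unpaired refl p)
paired-free {u , suc o} v (true ∷ A) (false ∷ B) p = paired-free (suc v) A B (paired-tail true false p)
paired-free {u , o} v (false ∷ A) (true ∷ B) p =
  trans (drop-drop 1 o (free (suc v) A B)) (paired-free (suc v) A B (paired-tail false true p))
paired-free v (true ∷ A) (true ∷ B) p = paired-free (suc v) A B (paired-tail true true p)

insertDec-low : ∀ {x X} → All (x <_) X → insertDec x X ≡ X ++ [ x ]
insertDec-low [] = refl
insertDec-low {x} {y ∷ X} (p ∷ ps) rewrite ≡ᵇ-false (>⇒≢ p) | <ᵇ-false (<⇒≤ p) = cong (y ∷_) (insertDec-low ps)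

insertDec-∷ʳ : ∀ {x v} X → v < x → insertDec x (X ++ [ v ]) ≡ insertDec x X ++ [ v ]
insertDec-∷ʳ [] p rewrite ≡ᵇ-false (<⇒≢ p) | <ᵇ-true p = refl
insertDec-∷ʳ {x} (y ∷ X) p with y ≡ᵇ x | y <ᵇ x
... | true | _ = refl
... | false | true = refl
... | false | false = cong (y ∷_) (insertDec-∷ʳ X p)

elem-∷ʳ : ∀ {x v} X → v ≢ x → elem x (X ++ [ v ]) ≡ elem x X
elem-∷ʳ [] p rewrite ≡ᵇ-false p = refl
elem-∷ʳ {x} (y ∷ X) p with y ≡ᵇ x
... | true = refl
... | false = elem-∷ʳ X p

remove-∷ʳ : ∀ {x v} X → v ≢ x → remove x (X ++ [ v ]) ≡ remove x X ++ [ v ]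
remove-∷ʳ {x} {v} X p = trans (remove-++ x X [ v ]) (cong (remove x X ++_) (remove-absent (p ∷ [])))

both : ℕ → List ℕ → List ℕ → Bool
both x X Y = elem (suc x) X ∧ elem (suc x) Y

target : Bool → ℕ → ℕ
target true x = suc x
target false x = x

record Lowers (v : ℕ) (A B A′ B′ : Bits) (x : ℕ) : Set where
  field
    bound  : v ≤ x
    first  : remove (target (both x (down v A) (down v B)) x) (down v A) ≡ down v A′
    second : insertDec x (down v B) ≡ down v B′

down-far : ∀ v A → elem v (down (suc v) A) ≡ false
down-far v A = elem-false (All.map >⇒≢ (down-≥ (suc v) A))

remove-last : ∀ v A → remove v (down v (true ∷ A)) ≡ down (suc v) A
remove-last v A = trans (cong (remove v) (down-true v A))
  (trans (remove-mid (All.map >⇒≢ (down-≥ (suc v) A)) []) (++-identityʳ _))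

down-∷ : ∀ v a A {C : Set} (f : List ℕ → C) → f (down (suc v) A ++ [ v ]) ≡ f (down (suc v) A) →
  f (down v (a ∷ A)) ≡ f (down (suc v) A)
down-∷ v true A f e = trans (cong f (down-true v A)) e
down-∷ v false A f e = refl

lowers-skip : ∀ {v a b A B A′ B′ x} → Lowers (suc v) A B A′ B′ x → Lowers v (a ∷ A) (b ∷ B) (a ∷ A′) (b ∷ B′) x
lowers-skip {v} {a} {b} {A} {B} {A′} {B′} {x} l = record
  { bound = <⇒≤ bound
  ; first = trans (cong (λ t → remove (target t x) (down v (a ∷ A))) both≡) (remove≡ a)
  ; second = insert≡ b
  }
  where
  open Lowers l
  both≡ : both x (down v (a ∷ A)) (down v (b ∷ B)) ≡ both x (down (suc v) A) (down (suc v) B)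
  both≡ = cong₂ _∧_ (down-∷ v a A (elem (suc x)) (elem-∷ʳ (down (suc v) A) (<⇒≢ (m≤n⇒m≤1+n bound))))
                    (down-∷ v b B (elem (suc x)) (elem-∷ʳ (down (suc v) B) (<⇒≢ (m≤n⇒m≤1+n bound))))
  y = target (both x (down (suc v) A) (down (suc v) B)) x
  v≢target : ∀ t → v ≢ target t x
  v≢target true = <⇒≢ (m≤n⇒m≤1+n bound)
  v≢target false = <⇒≢ bound
  remove≡ : ∀ a → remove y (down v (a ∷ A)) ≡ down v (a ∷ A′)
  remove≡ false = first
  remove≡ true = trans (cong (remove y) (down-true v A)) (trans (remove-∷ʳ (down (suc v) A) (v≢target _))
    (trans (cong (_++ [ v ]) first) (sym (down-true v A′))))
  insert≡ : ∀ b → insertDec x (down v (b ∷ B)) ≡ down v (b ∷ B′)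
  insert≡ false = second
  insert≡ true = trans (cong (insertDec x) (down-true v B)) (trans (insertDec-∷ʳ (down (suc v) B) bound)
    (trans (cong (_++ [ v ]) second) (sym (down-true v B′))))

free-prepend : ∀ v A B {F x} a b s → drop (proj₂ (feed a b s)) (free (suc v) A B) ≡ F ++ [ x ] →
  ∃[ F′ ] drop (proj₂ s) (free v (a ∷ A) (b ∷ B)) ≡ F′ ++ [ x ]
free-prepend v A B {F} false false s e = F , e
free-prepend v A B {F} true false (u , zero) e = v ∷ F , cong (v ∷_) e
free-prepend v A B {F} true false (u , suc o) e = F , e
free-prepend v A B {F} false true (u , o) e = F , trans (drop-drop 1 o (free (suc v) A B)) e
free-prepend v A B {F} true true s e = F , e

lower-lowers : ∀ {s A B A′ B′} v → Lower s A B A′ B′ →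
  ∃[ x ] ∃[ F ] drop (proj₂ s) (free v A B) ≡ F ++ [ x ] × Lowers v A B A′ B′ x
lower-lowers v (skip {s} {a} {b} {A} {B} l) with lower-lowers (suc v) l
... | x , F , e , h with free-prepend v A B a b s e
...   | F′ , e′ = x , F′ , e′ , lowers-skip h
lower-lowers v (hit {u} {A} {B} nb p) = v , [] , cong (v ∷_) (paired-free (suc v) A B p) , record
  { bound = ≤-refl
  ; first = trans (cong (λ t → remove (target t v) (down v (true ∷ A))) (notBoth A B nb)) (remove-last v A)
  ; second = trans (insertDec-low (down-≥ (suc v) B)) (sym (down-true v B))
  }
  where
  absent : ∀ A → elem (suc v) (down (suc v) (false ∷ A)) ≡ false
  absent A = down-far (suc v) A
  notBoth : ∀ A B → NotBoth A B → both v (down v (true ∷ A)) (down v (false ∷ B)) ≡ false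
  notBoth [] B nb rewrite ≡ᵇ-false (m≢1+n+m v {0}) = refl
  notBoth (false ∷ A) B nb rewrite down-true v (false ∷ A) | elem-∷ʳ (down (suc v) (false ∷ A)) (1+n≢n {v} ∘ sym) | absent A = refl
  notBoth (true ∷ A) [] nb = ∧-zeroʳ _
  notBoth (true ∷ A) (false ∷ B) nb rewrite absent B = ∧-zeroʳ _
lower-lowers v (hit₂ {u} {A} {B} p) = v , [] , cong (v ∷_) (paired-free (suc (suc v)) A B p) , record
  { bound = ≤-refl
  ; first = trans (cong (λ t → remove (target t v) (down v (true ∷ true ∷ A))) both-true) first′
  ; second = trans (insertDec-low (down-≥ (suc v) (true ∷ B))) (sym (down-true v (true ∷ B)))
  }
  where
  member : ∀ A → elem (suc v) (down (suc v) (true ∷ A)) ≡ true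
  member A rewrite down-true (suc v) A = elem-mid (suc v) (down (suc (suc v)) A)
  both-true : both v (down v (true ∷ true ∷ A)) (down v (false ∷ true ∷ B)) ≡ true
  both-true rewrite down-true v (true ∷ A) | elem-∷ʳ (down (suc v) (true ∷ A)) (1+n≢n {v} ∘ sym) | member A | member B = refl
  first′ : remove (suc v) (down v (true ∷ true ∷ A)) ≡ down v (true ∷ false ∷ A)
  first′ = trans (cong (remove (suc v)) (down-true v (true ∷ A)))
    (trans (remove-∷ʳ (down (suc v) (true ∷ A)) (1+n≢n {v} ∘ sym))
    (trans (cong (_++ [ v ]) (remove-last (suc v) A)) (sym (down-true v (false ∷ A)))))

foldr-⊔ : ∀ {x us} → All (_< x) us → foldr _⊔_ x us ≡ x
foldr-⊔ [] = refl
foldr-⊔ {x} {u ∷ us} (p ∷ ps) = trans (cong (u ⊔_) (foldr-⊔ ps)) (m≤n⇒m⊔n≡n (<⇒≤ p))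

fstarPair-nothing : ∀ X Y → unpaired X Y ≡ [] → fstarPair X Y ≡ nothing
fstarPair-nothing X Y e rewrite e = refl

fstarPair-just : ∀ X Y {x us} → unpaired X Y ≡ x ∷ us → All (_< x) us →
  fstarPair X Y ≡ just (remove (target (both x X Y) x) X , insertDec x Y)
fstarPair-just X Y {x} {us} e p rewrite e | foldr-⊔ p with both x X Y
... | true = refl
... | false = refl

unpaired-free₀ : ∀ A B → length A ≡ length B → unpaired (down 0 A) (down 0 B) ≡ reverse (free 0 A B)
unpaired-free₀ A B e = trans (cong (λ t → unpaired t (down 0 B)) (sym (++-identityʳ (down 0 A))))
  (trans (unpaired-free 0 A B [] e []) (++-identityʳ _))

fstarPair-paired : ∀ {A B} → length A ≡ length B → Paired (0 , 0) A B → fstarPair (down 0 A) (down 0 B) ≡ nothing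
fstarPair-paired {A} {B} e p = fstarPair-nothing (down 0 A) (down 0 B) (trans (unpaired-free₀ A B e) (cong reverse (paired-free 0 A B p)))

fstarPair-lower : ∀ {A B A′ B′} → length A ≡ length B → Lower (0 , 0) A B A′ B′ →
  fstarPair (down 0 A) (down 0 B) ≡ just (down 0 A′ , down 0 B′)
fstarPair-lower {A} {B} e l with lower-lowers 0 l
... | x , F , eq , h = trans
  (fstarPair-just (down 0 A) (down 0 B) {us = reverse F} (trans (unpaired-free₀ A B e) (trans (cong reverse eq) (reverse-∷ʳ F x)))
    (all-reverse (proj₁ (proj₂ (sorted-drop F (subst Sorted eq (proj₁ (free-sorted 0 A B))))))))
  (cong just (cong₂ _,_ first second))
  where open Lowers h

-- Insertion of two consecutive factors into a tableau

insSeq : ℕ → List ℕ → Tableau × Tableau → Tableau × Tableau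
insSeq q xs S = foldl starStep S (map (q ,_) xs)

_∷ₜ_ : List ℕ × List ℕ → Tableau × Tableau → Tableau × Tableau
(R , W) ∷ₜ (P , Q) = (R ∷ P) , (W ∷ Q)

-- A row is not affected by the rows above it, so the whole sequence may pass through it before any
-- bumped letter moves on.
insSeq-row : ∀ q xs R Rs W Ws → let R′ , ys , k = insRow xs R in
  insSeq q xs (R ∷ Rs , W ∷ Ws) ≡ (R′ , W ++ replicate k q) ∷ₜ insSeq q ys (Rs , Ws)
insSeq-row q [] R Rs W Ws = cong (λ t → R ∷ Rs , t ∷ Ws) (sym (++-identityʳ W))
insSeq-row q (x ∷ xs) R Rs W Ws with rowIns x R
... | R′ , nothing = trans (insSeq-row q xs R′ Rs (W ++ [ q ]) Ws)
  (cong (λ t → (proj₁ (insRow xs R′) , t) ∷ₜ _) (++-assoc W [ q ] _))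
... | R′ , just y = insSeq-row q xs R′ (proj₁ (insertP y Rs)) W (addCell q (proj₂ (insertP y Rs)) Ws)

pairIns : ℕ → Bits → Bits → Tableau × Tableau → Tableau × Tableau
pairIns i A B S = insSeq (suc i) (letters 0 B) (insSeq i (letters 0 A) S)

-- A row of the recording tableau: smaller entries, then the entries i and i + 1, then larger ones.
record RowForm : Set where
  constructor row
  field
    pre  : List ℕ
    is js : ℕ
    post : List ℕ

render : ℕ → RowForm → List ℕ
render i (row W α β Z) = W ++ replicate α i ++ replicate β (suc i) ++ Z

-- Forms are listed from the bottom but read from the top, so the tail comes earlier in the reading
-- word; within a row the entries `i` close before the entries `i + 1` open.
openForm : List RowForm → ℕ
openForm [] = 0
openForm (row W α β Z ∷ F) = β + (openForm F ∸ α)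

-- The rightmost unbracketed `i` is in the lowest row that has one, and is the last `i` there.
lowerForm : List RowForm → Maybe (List RowForm)
lowerForm [] = nothing
lowerForm (row W α β Z ∷ F) =
  if openForm F <ᵇ α then just (row W (pred α) (suc β) Z ∷ F)
  else Maybe.map (row W α β Z ∷_) (lowerForm F)

Other : ℕ → ℕ → Set
Other i x = x ≢ i × x ≢ suc i

Clean : ℕ → RowForm → Set
Clean i (row W α β Z) = All (Other i) W × All (Other i) Z

pairIns-row : ∀ i {A B R R₁ R₂ Ã B̃ α β} Rs W Ws →
  Run false (norm 0 gap) A R Ã R₁ α → Run false (norm 0 gap) B R₁ B̃ R₂ β →
  pairIns i A B (letters 0 R ∷ Rs , W ∷ Ws) ≡
    (letters 0 R₂ , render i (row W α β [])) ∷ₜ pairIns i Ã B̃ (Rs , Ws)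
pairIns-row i {A} {B} {R} {R₁} {R₂} {Ã} {B̃} {α} {β} Rs W Ws ra rb = begin
  insSeq (suc i) (letters 0 B) (insSeq i (letters 0 A) (letters 0 R ∷ Rs , W ∷ Ws))
    ≡⟨ cong (insSeq (suc i) (letters 0 B)) (row-eq i A R Rs W Ws (insRow-run ra)) ⟩
  insSeq (suc i) (letters 0 B) ((letters 0 R₁ , W ++ replicate α i) ∷ₜ S)
    ≡⟨ row-eq (suc i) B R₁ (proj₁ S) (W ++ replicate α i) (proj₂ S) (insRow-run rb) ⟩
  (letters 0 R₂ , (W ++ replicate α i) ++ replicate β (suc i)) ∷ₜ pairIns i Ã B̃ (Rs , Ws)
    ≡⟨ cong (λ t → (letters 0 R₂ , t) ∷ₜ pairIns i Ã B̃ (Rs , Ws))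
         (trans (++-assoc W (replicate α i) _) (cong (λ t → W ++ replicate α i ++ t) (sym (++-identityʳ _)))) ⟩
  (letters 0 R₂ , render i (row W α β [])) ∷ₜ pairIns i Ã B̃ (Rs , Ws) ∎
  where
  open ≡-Reasoning
  S = insSeq i (letters 0 Ã) (Rs , Ws)
  row-eq : ∀ q A R {R₁ ys k} Rs W Ws → insRow (letters 0 A) (letters 0 R) ≡ (R₁ , ys , k) →
    insSeq q (letters 0 A) (letters 0 R ∷ Rs , W ∷ Ws) ≡ (R₁ , W ++ replicate k q) ∷ₜ insSeq q ys (Rs , Ws)
  row-eq q A R Rs W Ws e = trans (insSeq-row q (letters 0 A) (letters 0 R) Rs W Ws)
    (cong (λ { (R₁ , ys , k) → (R₁ , W ++ replicate k q) ∷ₜ insSeq q ys (Rs , Ws) }) e)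

-- `opened` ties the comparison made by `lowerForm` to the one that separates the two outcomes of a
-- row. In `moves` the insertion tableau `tab` is unchanged, so later factors add their cells in the
-- same places.
record PairInsertion (i : ℕ) (A B : Bits) (P W : Tableau) : Set where
  field
    tab    : Tableau
    form   : List RowForm
    result : pairIns i A B (P , W) ≡ (tab , map (render i) form)
    opened : openForm form ≡ proj₂ (scan (0 , 0) A B)
    clean  : All (Clean i) form
    stuck  : Paired (0 , 0) A B → lowerForm form ≡ nothing
    moves  : ∀ {A′ B′} → Lower (0 , 0) A B A′ B′ →
             ∃[ form′ ] lowerForm form ≡ just form′ × pairIns i A′ B′ (P , W) ≡ (tab , map (render i) form′)

pairInsertion-row : ∀ {i A B R R₁ R₂ Ã B̃ α β Rs W Ws} → All (Other i) W →
  Run true (norm 0 gap) A R Ã R₁ α → Run true (norm 0 gap) B R₁ B̃ R₂ β →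
  PairInsertion i Ã B̃ Rs Ws → PairInsertion i A B (letters 0 R ∷ Rs) (W ∷ Ws)
pairInsertion-row {i} {A} {B} {R} {R₁} {R₂} {Ã} {B̃} {α} {β} {Rs} {W} {Ws} cl ra rb rec = record
  { tab    = letters 0 R₂ ∷ tab
  ; form   = row W α β [] ∷ form
  ; result = trans (pairIns-row i Rs W Ws (loosen ra) (loosen rb))
               (cong ((letters 0 R₂ , render i (row W α β [])) ∷ₜ_) result)
  ; opened = trans (cong (λ t → β + (t ∸ α)) opened) (sym (row-opens ra rb))
  ; clean  = (cl , []) ∷ clean
  ; stuck  = stuck′
  ; moves  = λ l → moves′ l (row-lower ra rb l)
  }
  where
  open PairInsertion rec
  stuck′ : Paired (0 , 0) A B → lowerForm (row W α β [] ∷ form) ≡ nothing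
  stuck′ p with row-paired ra rb p
  ... | p′ , le rewrite <ᵇ-false (≤-trans le (≤-reflexive (sym opened))) | stuck p′ = refl
  moves′ : ∀ {A′ B′} → Lower (0 , 0) A B A′ B′ → Outcome (norm 0 gap) (norm 0 gap) A′ B′ R R₂ Ã B̃ α β (0 , 0) →
    ∃[ form′ ] lowerForm (row W α β [] ∷ form) ≡ just form′ ×
      pairIns i A′ B′ (letters 0 R ∷ Rs , W ∷ Ws) ≡ (letters 0 R₂ ∷ tab , map (render i) form′)
  moves′ l (lowered {R₁′} {Ã′} {B̃′} ra′ rb′ l′ le) with moves l′
  ... | form′ , e₁ , e₂ rewrite <ᵇ-false (≤-trans le (≤-reflexive (sym opened))) | e₁ =
    row W α β [] ∷ form′ , refl ,
    trans (pairIns-row i Rs W Ws ra′ rb′) (cong ((letters 0 R₂ , render i (row W α β [])) ∷ₜ_) e₂)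
  moves′ l (moved {R₁′} {α′} ra′ rb′ refl le)
    rewrite <ᵇ-true {openForm form} {suc α′} (s≤s (≤-trans (≤-reflexive opened) le)) =
    row W α′ (suc β) [] ∷ form , refl ,
    trans (pairIns-row i Rs W Ws ra′ rb′) (cong ((letters 0 R₂ , render i (row W α′ (suc β) [])) ∷ₜ_) result)

run-length : ∀ {g s A R Ã R₁ α} → Run g s A R Ã R₁ α → length Ã ≡ length A × length R₁ ≡ length A
run-length done = refl , refl
run-length (x ∷ ra) with run-length ra
... | e₁ , e₂ = cong suc e₁ , cong suc e₂

run-~ : ∀ {A R Ã R₁ α} → Run true (norm 0 gap) A R Ã R₁ α → Good (down 0 A ++ down 0 R) →
  down 0 A ++ down 0 R ~ down 0 R₁ ++ down 0 Ã
run-~ {A} {R} ra g = subst (λ t → down 0 A ++ down 0 R ~ reverse (proj₁ t) ++ reverse (proj₁ (proj₂ t)))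
  (insRow-run (loosen ra)) (insRow-~ (letters 0 A) (letters 0 R) (letters-sorted 0 R) g)

record RowRuns (N : ℕ) (A B R : Bits) (rest : List ℕ) : Set where
  field
    {Ã B̃ R₁ R₂} : Bits
    {α β} : ℕ
    first  : Run true (norm 0 gap) A R Ã R₁ α
    second : Run true (norm 0 gap) B R₁ B̃ R₂ β
    lengthÃ : length Ã ≡ N
    lengthB̃ : length B̃ ≡ N
    still-good : Good (down 0 B̃ ++ down 0 Ã ++ rest)

row-runs : ∀ {N} A B R rest → length A ≡ N → length B ≡ N → length R ≡ N →
  Good (down 0 B ++ down 0 A ++ down 0 R ++ rest) → RowRuns N A B R rest
row-runs A B R rest refl eB eR g = record
  { first = ra ; second = rb
  ; lengthÃ = proj₁ (run-length ra) ; lengthB̃ = trans (proj₁ (run-length rb)) eB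
  ; still-good = good-++ʳ (down 0 R₂) (good-~ (~-trans (~-++ (run-~ rb gB) (~-refl {down 0 Ã ++ rest}))
      (~-reflexive (++-assoc (down 0 R₂) (down 0 B̃) _))) g₂)
  }
  where
  gA : Good (down 0 A ++ down 0 R)
  gA = good-++ˡ _ (subst Good (sym (++-assoc (down 0 A) (down 0 R) rest)) (good-++ʳ (down 0 B) g))
  runsA = good-runs A R (sym eR) gA
  Ã = proj₁ runsA
  R₁ = proj₁ (proj₂ runsA)
  ra = proj₂ (proj₂ (proj₂ runsA))
  g₁ : Good (down 0 B ++ down 0 R₁ ++ down 0 Ã ++ rest)
  g₁ = good-~ (~-++ (~-refl {down 0 B}) (~-trans (~-reflexive (sym (++-assoc (down 0 A) (down 0 R) rest)))
    (~-trans (~-++ (run-~ ra gA) (~-refl {rest})) (~-reflexive (++-assoc (down 0 R₁) (down 0 Ã) rest))))) g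
  g₂ : Good ((down 0 B ++ down 0 R₁) ++ down 0 Ã ++ rest)
  g₂ = subst Good (sym (++-assoc (down 0 B) (down 0 R₁) _)) g₁
  gB : Good (down 0 B ++ down 0 R₁)
  gB = good-++ˡ _ g₂
  runsB = good-runs B R₁ (trans eB (sym (proj₂ (run-length ra)))) gB
  B̃ = proj₁ runsB
  R₂ = proj₁ (proj₂ runsB)
  rb = proj₂ (proj₂ (proj₂ runsB))

size : Bits → Bits → ℕ
size A B = length (letters 0 A) + length (letters 0 B)

insRow-length : ∀ xs R → length (proj₁ (proj₂ (insRow xs R))) + proj₂ (proj₂ (insRow xs R)) ≡ length xs
insRow-length [] R = refl
insRow-length (x ∷ xs) R with rowIns x R
... | R′ , just y = cong suc (insRow-length xs R′)
... | R′ , nothing = trans (+-suc _ _) (cong suc (insRow-length xs R′))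

run-size : ∀ {g A R Ã R₁ α} → Run g (norm 0 gap) A R Ã R₁ α → length (letters 0 Ã) + α ≡ length (letters 0 A)
run-size {true} ra = run-size (loosen ra)
run-size {false} {A} {R} ra = trans (cong (λ t → length (proj₁ (proj₂ t)) + proj₂ (proj₂ t)) (sym (insRow-run ra)))
  (insRow-length (letters 0 A) (letters 0 R))

letters-off : ∀ n v → letters v (replicate n false) ≡ []
letters-off zero v = refl
letters-off (suc n) v = letters-off n (suc v)

run-appends : ∀ {g A R Ã R₁ α x xs} → Run g (norm 0 gap) A R Ã R₁ α → letters 0 R ≡ [] → letters 0 A ≡ x ∷ xs → 1 ≤ α
run-appends {true} ra eR eA = run-appends (loosen ra) eR eA
run-appends {false} {x = x} {xs} ra eR eA = subst (1 ≤_)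
  (cong (λ t → proj₂ (proj₂ t)) (trans (sym (cong₂ insRow eA eR)) (insRow-run ra))) (s≤s z≤n)

run-nothing : ∀ {g A R Ã R₁ α} → Run g (norm 0 gap) A R Ã R₁ α → letters 0 R ≡ [] → letters 0 A ≡ [] → letters 0 R₁ ≡ []
run-nothing {true} ra eR eA = run-nothing (loosen ra) eR eA
run-nothing {false} ra eR eA = cong proj₁ (trans (sym (insRow-run ra)) (cong₂ insRow eA eR))

scan-off : ∀ v A B s → letters v A ≡ [] → letters v B ≡ [] → scan s A B ≡ s
scan-off v [] [] s eA eB = refl
scan-off v [] (_ ∷ _) s eA eB = refl
scan-off v (_ ∷ _) [] s eA eB = refl
scan-off v (false ∷ A) (false ∷ B) s eA eB = scan-off (suc v) A B s eA eB

lower-letters : ∀ {s A B A′ B′} v → Lower s A B A′ B′ → letters v B′ ≢ []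
lower-letters v (skip {b = false} l) e = lower-letters (suc v) l e

pairIns-start : ∀ i A B → (letters 0 A ≡ [] → letters 0 B ≢ []) →
  pairIns i A B ([] , []) ≡ pairIns i A B ([ [] ] , [ [] ])
pairIns-start i A B h with letters 0 A | letters 0 B
... | [] | [] = ⊥-elim (h refl refl)
... | [] | y ∷ ys = refl
... | x ∷ xs | _ = refl

-- Once a letter is inserted, an empty tableau behaves like one empty row, so the row step also
-- covers the creation of rows.
pairInsertion-start : ∀ {i A B} → (letters 0 A ≡ [] → letters 0 B ≢ []) →
  PairInsertion i A B [ [] ] [ [] ] → PairInsertion i A B [] []
pairInsertion-start {i} {A} {B} h pin = record
  { tab = tab ; form = form ; result = trans (pairIns-start i A B h) result
  ; opened = opened ; clean = clean ; stuck = stuck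
  ; moves = λ {A′} {B′} l → let F , e₁ , e₂ = moves l in
      F , e₁ , trans (pairIns-start i A′ B′ (λ _ → lower-letters 0 l)) e₂
  }
  where open PairInsertion pin

pairInsertion-nil : ∀ {i A B} → letters 0 A ≡ [] → letters 0 B ≡ [] → PairInsertion i A B [] []
pairInsertion-nil {i} {A} {B} ea eb = record
  { tab = [] ; form = [] ; result = cong₂ (λ xs ys → insSeq (suc i) ys (insSeq i xs ([] , []))) ea eb
  ; opened = sym (cong proj₂ off) ; clean = [] ; stuck = λ _ → refl
  ; moves = λ l → ⊥-elim (lower-unpaired l (paired (cong proj₁ off)))
  }
  where
  off : scan (0 , 0) A B ≡ (0 , 0)
  off = scan-off 0 A B (0 , 0) ea eb

null? : ∀ (xs ys : List ℕ) → (xs ≡ [] × ys ≡ []) ⊎ (xs ≡ [] → ys ≢ [])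
null? [] [] = inj₁ (refl , refl)
null? [] (_ ∷ _) = inj₂ λ _ ()
null? (_ ∷ _) _ = inj₂ λ ()

-- The first letter inserted into an empty row stays there.
appends : ∀ {A B R R₁ R₂ Ã B̃ α β} → Run true (norm 0 gap) A R Ã R₁ α → Run true (norm 0 gap) B R₁ B̃ R₂ β →
  letters 0 R ≡ [] → (letters 0 A ≡ [] → letters 0 B ≢ []) → 1 ≤ α + β
appends {A} {B} {α = α} ra rb eR h with letters 0 A in eA
... | x ∷ xs = ≤-trans (run-appends ra eR eA) (m≤m+n _ _)
... | [] with letters 0 B in eB
...   | [] = ⊥-elim (h refl refl)
...   | y ∷ ys = ≤-trans (run-appends rb (run-nothing ra eR eA) eB) (m≤n+m _ α)

size-drop : ∀ {A B R R₁ R₂ Ã B̃ α β} → Run true (norm 0 gap) A R Ã R₁ α → Run true (norm 0 gap) B R₁ B̃ R₂ β →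
  letters 0 R ≡ [] → (letters 0 A ≡ [] → letters 0 B ≢ []) → size Ã B̃ < size A B
size-drop {A} {B} {Ã = Ã} {B̃} {α} {β} ra rb eR h = begin
  1 + size Ã B̃        ≡⟨ +-comm 1 (size Ã B̃) ⟩
  size Ã B̃ + 1        ≤⟨ +-monoʳ-≤ (size Ã B̃) (appends ra rb eR h) ⟩
  size Ã B̃ + (α + β)  ≡⟨ interchange +-commutativeSemigroup (length (letters 0 Ã)) (length (letters 0 B̃)) α β ⟩
  (length (letters 0 Ã) + α) + (length (letters 0 B̃) + β) ≡⟨ cong₂ _+_ (run-size ra) (run-size rb) ⟩
  size A B             ∎
  where open ≤-Reasoning

-- The recursion ends because every new row retains at least one of the letters.
pairInsertion-empty : ∀ {N} i n A B → size A B < n → length A ≡ N → length B ≡ N →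
  Good (down 0 B ++ down 0 A) → PairInsertion i A B [] []
pairInsertion-empty {N} i (suc n) A B (s≤s le) eA eB g with null? (letters 0 A) (letters 0 B)
... | inj₁ (ea , eb) = pairInsertion-nil ea eb
... | inj₂ h = pairInsertion-start h (subst (λ t → PairInsertion i A B [ t ] [ [] ]) off
    (pairInsertion-row [] first second
      (pairInsertion-empty i n Ã B̃ (<-≤-trans (size-drop first second off h) le) lengthÃ lengthB̃
        (subst (λ t → Good (down 0 B̃ ++ t)) (++-identityʳ (down 0 Ã)) still-good))))
  where
  off : letters 0 (replicate N false) ≡ []
  off = letters-off N 0
  open RowRuns (row-runs A B (replicate N false) [] eA eB (length-replicate N)
    (subst (λ t → Good (down 0 B ++ t)) (trans (sym (++-identityʳ (down 0 A)))
      (cong (λ t → down 0 A ++ reverse t ++ []) (sym off))) g))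

pairInsertion : ∀ {N} i A B P W → Rows N P → length W ≡ length P → All (All (Other i)) W →
  length A ≡ N → length B ≡ N → Good (down 0 B ++ down 0 A ++ readT P) → PairInsertion i A B P W
pairInsertion i A B [] [] rs e cl eA eB g = pairInsertion-empty i (suc (size A B)) A B ≤-refl eA eB
  (subst (λ t → Good (down 0 B ++ t)) (++-identityʳ (down 0 A)) g)
pairInsertion {N} i A B (R ∷ P) (W ∷ Ws) (rows (s ∷ ss) (b ∷ bs)) e (c ∷ cl) eA eB g
  with to-bits N 0 R s (All.universal (λ _ → z≤n) R) (subst (λ t → All (_< t) R) (sym (+-identityʳ N)) b)
... | Rb , eR , refl = pairInsertion-row c first second
    (pairInsertion i Ã B̃ P Ws (rows ss bs) (suc-injective e) cl lengthÃ lengthB̃ still-good)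
  where open RowRuns (row-runs A B Rb (readT P) eA eB eR g)

-- The operator f_i on the recording tableau

cells : (r c : ℕ) → List ℕ → List (ℕ × ℕ × ℕ)
cells r c R = map (λ p → (r , proj₁ p , proj₂ p)) (indexed c R)

cells-++ : ∀ r c X Y → cells r c (X ++ Y) ≡ cells r c X ++ cells r (c + length X) Y
cells-++ r c [] Y = cong (λ t → cells r t Y) (sym (+-identityʳ c))
cells-++ r c (x ∷ X) Y = cong ((r , c , x) ∷_)
  (trans (cells-++ r (suc c) X Y) (cong (λ t → cells r (suc c) X ++ cells r t Y) (sym (+-suc c (length X)))))

bracketScan-other : ∀ {i X} r c o cand rest → All (Other i) X →
  bracketScan i o cand (cells r c X ++ rest) ≡ bracketScan i o cand rest
bracketScan-other r c o cand rest [] = refl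
bracketScan-other r c o cand rest ((p , q) ∷ h)
  rewrite ≡ᵇ-false p | ≡ᵇ-false q = bracketScan-other r (suc c) o cand rest h

lastOpen : (r c o α : ℕ) → Maybe (ℕ × ℕ) → Maybe (ℕ × ℕ)
lastOpen r c o α cand = if o <ᵇ α then just (r , c + pred α) else cand

lastOpen-suc : ∀ r c o α cand → lastOpen r (suc c) o α cand ≡ lastOpen r c (suc o) (suc α) cand
lastOpen-suc r c o zero cand = refl
lastOpen-suc r c o (suc α) cand rewrite +-suc c α = refl

lastOpen-zero : ∀ r c α cand → lastOpen r (suc c) 0 α (just (r , c)) ≡ lastOpen r c 0 (suc α) cand
lastOpen-zero r c zero cand = cong (λ t → just (r , t)) (sym (+-identityʳ c))
lastOpen-zero r c (suc α) cand = cong (λ t → just (r , t)) (sym (+-suc c α))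

bracketScan-i : ∀ i r c α o cand rest →
  bracketScan i o cand (cells r c (replicate α i) ++ rest) ≡ bracketScan i (o ∸ α) (lastOpen r c o α cand) rest
bracketScan-i i r c zero o cand rest = refl
bracketScan-i i r c (suc α) zero cand rest rewrite ≡ᵇ-refl i =
  trans (bracketScan-i i r (suc c) α 0 (just (r , c)) rest)
    (cong₂ (λ s t → bracketScan i s t rest) (0∸n≡0 α) (lastOpen-zero r c α cand))
bracketScan-i i r c (suc α) (suc o) cand rest rewrite ≡ᵇ-refl i =
  trans (bracketScan-i i r (suc c) α o cand rest)
    (cong (λ t → bracketScan i (o ∸ α) t rest) (lastOpen-suc r c o α cand))

bracketScan-j : ∀ i r c β o cand rest →
  bracketScan i o cand (cells r c (replicate β (suc i)) ++ rest) ≡ bracketScan i (β + o) cand rest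
bracketScan-j i r c zero o cand rest = refl
bracketScan-j i r c (suc β) o cand rest rewrite ≡ᵇ-false (1+n≢n {i}) | ≡ᵇ-refl i =
  trans (bracketScan-j i r (suc c) β (suc o) cand rest) (cong (λ t → bracketScan i t cand rest) (+-suc β o))

bracketScan-row : ∀ {i} r o cand rest W α β Z → Clean i (row W α β Z) →
  bracketScan i o cand (cells r 0 (render i (row W α β Z)) ++ rest) ≡
  bracketScan i (β + (o ∸ α)) (lastOpen r (length W) o α cand) rest
bracketScan-row {i} r o cand rest W α β Z (cW , cZ) = begin
  scan′ o cand (cells r 0 (W ++ X ++ Y ++ Z) ++ rest)
    ≡⟨ cong (scan′ o cand) (split r 0 W (X ++ Y ++ Z) rest) ⟩
  scan′ o cand (cells r 0 W ++ cells r (length W) (X ++ Y ++ Z) ++ rest)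
    ≡⟨ bracketScan-other r 0 o cand _ cW ⟩
  scan′ o cand (cells r (length W) (X ++ Y ++ Z) ++ rest)
    ≡⟨ cong (scan′ o cand) (split r (length W) X (Y ++ Z) rest) ⟩
  scan′ o cand (cells r (length W) X ++ cells r c₁ (Y ++ Z) ++ rest)
    ≡⟨ bracketScan-i i r (length W) α o cand _ ⟩
  scan′ (o ∸ α) cand′ (cells r c₁ (Y ++ Z) ++ rest)
    ≡⟨ cong (scan′ (o ∸ α) cand′) (split r c₁ Y Z rest) ⟩
  scan′ (o ∸ α) cand′ (cells r c₁ Y ++ cells r c₂ Z ++ rest)
    ≡⟨ bracketScan-j i r c₁ β (o ∸ α) cand′ _ ⟩
  scan′ (β + (o ∸ α)) cand′ (cells r c₂ Z ++ rest)
    ≡⟨ bracketScan-other r c₂ (β + (o ∸ α)) cand′ rest cZ ⟩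
  scan′ (β + (o ∸ α)) cand′ rest ∎
  where
  open ≡-Reasoning
  scan′ = bracketScan i
  X = replicate α i
  Y = replicate β (suc i)
  c₁ = length W + length X
  c₂ = c₁ + length Y
  cand′ = lastOpen r (length W) o α cand
  split : ∀ r c X Y rest → cells r c (X ++ Y) ++ rest ≡ cells r c X ++ cells r (c + length X) Y ++ rest
  split r c X Y rest = trans (cong (_++ rest) (cells-++ r c X Y)) (++-assoc (cells r c X) _ rest)

position : ℕ → List RowForm → Maybe (ℕ × ℕ)
position r [] = nothing
position r (row W α β Z ∷ F) = lastOpen r (length W) (openForm F) α (position (suc r) F)

concat-reverse : ∀ {A : Set} (x : List A) xs → concat (reverse (x ∷ xs)) ≡ concat (reverse xs) ++ x
concat-reverse x xs = trans (cong concat (unfold-reverse x xs))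
  (trans (sym (concat-++ (reverse xs) [ x ])) (cong (concat (reverse xs) ++_) (++-identityʳ x)))

bracketScan-form : ∀ {i} r F rest → All (Clean i) F →
  bracketScan i 0 nothing (concat (reverse (rowCells r (map (render i) F))) ++ rest) ≡
  bracketScan i (openForm F) (position r F) rest
bracketScan-form r [] rest [] = refl
bracketScan-form {i} r (row W α β Z ∷ F) rest (c ∷ cs) = begin
  bracketScan i 0 nothing (concat (reverse (cells r 0 (render i (row W α β Z)) ∷ upper)) ++ rest)
    ≡⟨ cong (bracketScan i 0 nothing) (trans (cong (_++ rest) (concat-reverse _ upper)) (++-assoc (concat (reverse upper)) _ rest)) ⟩
  bracketScan i 0 nothing (concat (reverse upper) ++ cells r 0 (render i (row W α β Z)) ++ rest)
    ≡⟨ bracketScan-form (suc r) F _ cs ⟩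
  bracketScan i (openForm F) (position (suc r) F) (cells r 0 (render i (row W α β Z)) ++ rest)
    ≡⟨ bracketScan-row r (openForm F) (position (suc r) F) rest W α β Z c ⟩
  bracketScan i (β + (openForm F ∸ α)) (position r (row W α β Z ∷ F)) rest ∎
  where
  open ≡-Reasoning
  upper = rowCells (suc r) (map (render i) F)

updateAt-length : ∀ {A : Set} (f : A → A) X {y Y} → updateAt (length X) f (X ++ y ∷ Y) ≡ X ++ f y ∷ Y
updateAt-length f [] = refl
updateAt-length f (x ∷ X) = cong (x ∷_) (updateAt-length f X)

updateAt-render : ∀ i W α β Z → updateAt (length W + α) (λ _ → suc i) (render i (row W (suc α) β Z)) ≡ render i (row W α (suc β) Z)
updateAt-render i (w ∷ W) α β Z = cong (w ∷_) (updateAt-render i W α β Z)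
updateAt-render i [] zero β Z = refl
updateAt-render i [] (suc α) β Z = cong (i ∷_) (updateAt-render i [] α β Z)

setCell-form : ∀ i T F →
  Maybe.map (λ p → setCell (proj₁ p) (proj₂ p) (suc i) (T ++ map (render i) F)) (position (length T) F) ≡
  Maybe.map (λ F′ → T ++ map (render i) F′) (lowerForm F)
setCell-form i T [] = refl
setCell-form i T (row W α β Z ∷ F) with openForm F <ᵇ α in lt
setCell-form i T (row W (suc α) β Z ∷ F) | true =
  cong just (trans (updateAt-length _ T) (cong (λ t → T ++ t ∷ map (render i) F) (updateAt-render i W α β Z)))
setCell-form i T (f@(row W α β Z) ∷ F) | false = begin
  Maybe.map (set (T ++ render i f ∷ map (render i) F)) (position (suc (length T)) F)
    ≡⟨ cong₂ (λ s t → Maybe.map (set s) (position t F)) (sym (++-assoc T [ render i f ] _))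
         (sym (trans (length-++ T) (+-comm (length T) 1))) ⟩
  Maybe.map (set ((T ++ [ render i f ]) ++ map (render i) F)) (position (length (T ++ [ render i f ])) F)
    ≡⟨ setCell-form i (T ++ [ render i f ]) F ⟩
  Maybe.map (λ F′ → (T ++ [ render i f ]) ++ map (render i) F′) (lowerForm F)
    ≡⟨ reassoc (lowerForm F) ⟩
  Maybe.map (λ F′ → T ++ map (render i) F′) (Maybe.map (f ∷_) (lowerForm F)) ∎
  where
  open ≡-Reasoning
  set : Tableau → ℕ × ℕ → Tableau
  set S p = setCell (proj₁ p) (proj₂ p) (suc i) S
  reassoc : ∀ m → Maybe.map (λ F′ → (T ++ [ render i f ]) ++ map (render i) F′) m ≡
    Maybe.map (λ F′ → T ++ map (render i) F′) (Maybe.map (f ∷_) m)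
  reassoc nothing = refl
  reassoc (just F′) = cong just (++-assoc T [ render i f ] _)

fKN-form : ∀ {i} F → All (Clean i) F → fKN i (map (render i) F) ≡ Maybe.map (map (render i)) (lowerForm F)
fKN-form {i} F cl = trans (cong (Maybe.map _) (trans
  (cong (bracketScan i 0 nothing) (sym (++-identityʳ (readingCells (map (render i) F)))))
  (bracketScan-form 0 F [] cl))) (setCell-form i [] F)

-- Later factors have labels above `i + 1`, so their entries go to `post` and do not take part in
-- the bracketing.
addForm : ℕ → ℕ → List RowForm → List RowForm
addForm q zero [] = [ row [] 0 0 [ q ] ]
addForm q zero (row W α β Z ∷ F) = row W α β (Z ++ [ q ]) ∷ F
addForm q (suc k) [] = [ row [] 0 0 [ q ] ]
addForm q (suc k) (f ∷ F) = f ∷ addForm q k F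

addCell-form : ∀ i q k F → addCell q k (map (render i) F) ≡ map (render i) (addForm q k F)
addCell-form i q zero [] = refl
addCell-form i q (suc k) [] = refl
addCell-form i q zero (row W α β Z ∷ F) = cong (_∷ map (render i) F)
  (trans (++-assoc W _ [ q ]) (cong (W ++_) (trans (++-assoc (replicate α i) _ [ q ])
    (cong (replicate α i ++_) (++-assoc (replicate β (suc i)) Z [ q ])))))
addCell-form i q (suc k) (f ∷ F) = cong (render i f ∷_) (addCell-form i q k F)

openForm-add : ∀ q k F → openForm (addForm q k F) ≡ openForm F
openForm-add q zero [] = refl
openForm-add q (suc k) [] = refl
openForm-add q zero (row W α β Z ∷ F) = refl
openForm-add q (suc k) (row W α β Z ∷ F) = cong (λ t → β + (t ∸ α)) (openForm-add q k F)

lowerForm-add : ∀ q k F → lowerForm (addForm q k F) ≡ Maybe.map (addForm q k) (lowerForm F)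
lowerForm-add q zero [] = refl
lowerForm-add q (suc k) [] = refl
lowerForm-add q zero (row W α β Z ∷ F) with openForm F <ᵇ α | lowerForm F
... | true | _ = refl
... | false | nothing = refl
... | false | just _ = refl
lowerForm-add q (suc k) (row W α β Z ∷ F) rewrite openForm-add q k F | lowerForm-add q k F with openForm F <ᵇ α | lowerForm F
... | true | _ = refl
... | false | nothing = refl
... | false | just _ = refl

clean-add : ∀ {i q} k F → Other i q → All (Clean i) F → All (Clean i) (addForm q k F)
clean-add zero [] o [] = ([] , o ∷ []) ∷ []
clean-add (suc k) [] o [] = ([] , o ∷ []) ∷ []
clean-add zero (row W α β Z ∷ F) o ((cW , cZ) ∷ cs) = (cW , All.++⁺ cZ (o ∷ [])) ∷ cs
clean-add (suc k) (f ∷ F) o (c ∷ cs) = c ∷ clean-add k F o cs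

-- The later insertions see only the insertion tableau.
addForms : List (ℕ × ℕ) → Tableau → List RowForm → List RowForm
addForms [] P F = F
addForms ((q , x) ∷ L) P F = addForms L (proj₁ (insertP x P)) (addForm q (proj₂ (insertP x P)) F)

star-form : ∀ i L P F → proj₂ (foldl starStep (P , map (render i) F) L) ≡ map (render i) (addForms L P F)
star-form i [] P F = refl
star-form i ((q , x) ∷ L) P F rewrite addCell-form i q (proj₂ (insertP x P)) F = star-form i L _ _

lowerForm-adds : ∀ L P F → lowerForm (addForms L P F) ≡ Maybe.map (addForms L P) (lowerForm F)
lowerForm-adds [] P F with lowerForm F
... | nothing = refl
... | just _ = refl
lowerForm-adds ((q , x) ∷ L) P F = trans (lowerForm-adds L _ _)
  (trans (cong (Maybe.map _) (lowerForm-add q (proj₂ (insertP x P)) F)) (fuse (lowerForm F)))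
  where
  fuse : ∀ m → Maybe.map (addForms L (proj₁ (insertP x P))) (Maybe.map (addForm q (proj₂ (insertP x P))) m) ≡
    Maybe.map (addForms ((q , x) ∷ L) P) m
  fuse nothing = refl
  fuse (just _) = refl

clean-adds : ∀ {i} L P F → All (Other i ∘ proj₁) L → All (Clean i) F → All (Clean i) (addForms L P F)
clean-adds [] P F [] cl = cl
clean-adds ((q , x) ∷ L) P F (o ∷ os) cl = clean-adds L _ _ os (clean-add (proj₂ (insertP x P)) F o cl)

-- The insertion of a whole factorization

star-length : ∀ q x P Q → length Q ≡ length P →
  length (addCell q (proj₂ (insertP x P)) Q) ≡ length (proj₁ (insertP x P))
star-length q x [] [] e = refl
star-length q x (R ∷ P) (W ∷ Q) e with rowIns x R
... | R′ , nothing = e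
... | R′ , just y = cong suc (star-length q y P Q (suc-injective e))

addCell-other : ∀ {i q} k Q → Other i q → All (All (Other i)) Q → All (All (Other i)) (addCell q k Q)
addCell-other zero [] o [] = (o ∷ []) ∷ []
addCell-other (suc k) [] o [] = (o ∷ []) ∷ []
addCell-other zero (W ∷ Q) o (c ∷ cs) = All.++⁺ c (o ∷ []) ∷ cs
addCell-other (suc k) (W ∷ Q) o (c ∷ cs) = c ∷ addCell-other k Q o cs

-- `u` is the word of letters still to come; it stands on the left because the factorization is
-- inserted from its last letter backwards.
record Initial (N i : ℕ) (u : List ℕ) (S : Tableau × Tableau) : Set where
  constructor initial
  field
    isRows : Rows N (proj₁ S)
    sameLength : length (proj₂ S) ≡ length (proj₁ S)
    others : All (All (Other i)) (proj₂ S)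
    isGood : Good (u ++ readT (proj₁ S))

good-last : ∀ u x w v → Good ((u ++ reverse (x ∷ w)) ++ v) → Good ((u ++ reverse w) ++ x ∷ v)
good-last u x w v = subst Good (trans (cong (λ t → (u ++ t) ++ v) (unfold-reverse x w))
  (trans (cong (_++ v) (sym (++-assoc u (reverse w) [ x ]))) (++-assoc (u ++ reverse w) [ x ] v)))

initial-star : ∀ {N i u} L S → Initial N i (u ++ reverse (map proj₂ L)) S →
  All (Other i ∘ proj₁) L → All ((_< N) ∘ proj₂) L → Initial N i u (foldl starStep S L)
initial-star {N} {i} {u} [] S (initial rs e cl g) [] [] = initial rs e cl (subst (λ t → Good (t ++ readT (proj₁ S))) (++-identityʳ u) g)
initial-star {N} {i} {u} ((q , x) ∷ L) (P , Q) (initial rs e cl g) (o ∷ os) (b ∷ bs)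
  with insertP-rows P rs b (good-++ʳ (u ++ reverse (map proj₂ L)) (good-last u x (map proj₂ L) (readT P) g))
... | rs′ , h = initial-star L _ (initial rs′ (star-length q x P Q e) (addCell-other (proj₂ (insertP x P)) Q o cl)
    (good-~ (~-++ (~-refl {u ++ reverse (map proj₂ L)}) h) (good-last u x (map proj₂ L) (readT P) g))) os bs

map-label : ∀ (j : ℕ) (xs : List ℕ) → map proj₂ (map (j ,_) xs) ≡ xs
map-label j xs = trans (sym (map-∘ xs)) (map-id xs)

processing-word : ∀ j ws → reverse (map proj₂ (processingOrder j ws)) ≡ concat (reverse ws)
processing-word j [] = refl
processing-word j (w ∷ ws) = begin
  reverse (map proj₂ (map (j ,_) (reverse w) ++ rest))       ≡⟨ cong reverse (map-++ proj₂ (map (j ,_) (reverse w)) rest) ⟩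
  reverse (map proj₂ (map (j ,_) (reverse w)) ++ map proj₂ rest) ≡⟨ cong (λ t → reverse (t ++ map proj₂ rest)) (map-label j (reverse w)) ⟩
  reverse (reverse w ++ map proj₂ rest)                      ≡⟨ reverse-++ (reverse w) (map proj₂ rest) ⟩
  reverse (map proj₂ rest) ++ reverse (reverse w)            ≡⟨ cong₂ _++_ (processing-word (suc j) ws) (reverse-involutive w) ⟩
  concat (reverse ws) ++ w                                   ≡⟨ concat-reverse w ws ⟨
  concat (reverse (w ∷ ws))                                  ∎
  where
  open ≡-Reasoning
  rest = processingOrder (suc j) ws

processing-++ : ∀ j us ws → processingOrder j (us ++ ws) ≡ processingOrder j us ++ processingOrder (length us + j) ws
processing-++ j [] ws = refl
processing-++ j (u ∷ us) ws = trans (cong (map (j ,_) (reverse u) ++_)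
  (trans (processing-++ (suc j) us ws) (cong (λ t → processingOrder (suc j) us ++ processingOrder t ws) (+-suc (length us) j))))
  (sym (++-assoc (map (j ,_) (reverse u)) _ _))

labels : ∀ {P : ℕ → Set} j ws → (∀ k → k < length ws → P (k + j)) → All (P ∘ proj₁) (processingOrder j ws)
labels j [] h = []
labels {P} j (w ∷ ws) h = All.++⁺ (All.map⁺ (All.universal (λ _ → h 0 (s≤s z≤n)) (reverse w)))
  (labels (suc j) ws (λ k lt → subst P (sym (+-suc k j)) (h (suc k) (s≤s lt))))

values : ∀ {P : ℕ → Set} j ws → All (All P) ws → All (P ∘ proj₂) (processingOrder j ws)
values j [] [] = []
values j (w ∷ ws) (p ∷ ps) = All.++⁺ (All.map⁺ (all-reverse p)) (values (suc j) ws ps)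

-- Splitting a factorization at two consecutive factors

-- a and b are the factors h^{k+1} and h^{k+2}.
record PairAt {m} (k : ℕ) (h : Factorization m) : Set where
  field
    before after₂ : List (List ℕ)
    a b : List ℕ
    factors : toList h ≡ before ++ a ∷ b ∷ after₂
    lengthBefore : length before ≡ k
    zeroCase : fstarPair a b ≡ nothing → atPair k h ≡ nothing
    justCase : ∀ {a′ b′} → fstarPair a b ≡ just (a′ , b′) →
      ∃[ h′ ] atPair k h ≡ just h′ × toList h′ ≡ before ++ a′ ∷ b′ ∷ after₂

pairAt : ∀ {m} k (h : Factorization m) → suc k < m → PairAt k h
pairAt zero (a Vec.∷ b Vec.∷ rest) lt = record
  { before = [] ; after₂ = toList rest ; a = a ; b = b ; factors = refl ; lengthBefore = refl
  ; zeroCase = λ e → cong (Maybe.map _) e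
  ; justCase = λ e → _ , cong (Maybe.map _) e , refl
  }
pairAt zero (a Vec.∷ Vec.[]) (s≤s ())
pairAt (suc k) (c Vec.∷ rest) (s≤s lt) = record
  { before = c ∷ before ; after₂ = after₂ ; a = a ; b = b
  ; factors = cong (c ∷_) factors ; lengthBefore = cong suc lengthBefore
  ; zeroCase = λ e → cong (Maybe.map (c Vec.∷_)) (zeroCase e)
  ; justCase = λ e → let h′ , e₁ , e₂ = justCase e in
      c Vec.∷ h′ , cong (Maybe.map (c Vec.∷_)) e₁ , cong (c ∷_) e₂
  }
  where open PairAt (pairAt k rest lt)

bound : ∀ xs → ∃[ N ] All (_< N) xs
bound [] = 0 , []
bound (x ∷ xs) with bound xs
... | N , p = suc x ⊔ N , m≤m⊔n (suc x) N ∷ All.map (λ lt → ≤-trans lt (m≤n⊔m (suc x) N)) p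

bounds : ∀ xss → ∃[ N ] All (All (_< N)) xss
bounds [] = 0 , []
bounds (xs ∷ xss) with bound xs | bounds xss
... | M , p | N , q = M ⊔ N , All.map (λ lt → ≤-trans lt (m≤m⊔n M N)) p ∷
  All.map (All.map (λ lt → ≤-trans lt (m≤n⊔m M N))) q

sorted-reverse : ∀ {xs} → AllPairs (λ x y → y < x) xs → Sorted (reverse xs)
sorted-reverse [] = []
sorted-reverse {x ∷ xs} (p ∷ ps) = subst Sorted (sym (unfold-reverse x xs))
  (sorted-++ (reverse xs) (subst Sorted (sym (++-identityʳ (reverse xs))) (sorted-reverse ps)) (all-reverse p) [])

factor-bits : ∀ {N} w → StrictlyDecreasing w → All (_< N) w → ∃[ A ] length A ≡ N × letters 0 A ≡ reverse w
factor-bits {N} w s b = to-bits N 0 (reverse w) (sorted-reverse (Linked⇒AllPairs (λ p q → <-trans q p) s))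
  (All.universal (λ _ → z≤n) _) (subst (λ t → All (_< t) (reverse w)) (sym (+-identityʳ N)) (all-reverse b))

starAll : List (List ℕ) → Tableau × Tableau
starAll ws = foldl starStep ([] , []) (processingOrder 1 ws)

starAll-split : ∀ before A B rest → let i = suc (length before) in
  starAll (before ++ down 0 A ∷ down 0 B ∷ rest) ≡
  foldl starStep (pairIns i A B (starAll before)) (processingOrder (suc (suc i)) rest)
starAll-split before A B rest = begin
  foldl starStep ([] , []) (processingOrder 1 (before ++ down 0 A ∷ down 0 B ∷ rest))
    ≡⟨ cong (foldl starStep ([] , [])) (processing-++ 1 before _) ⟩
  foldl starStep ([] , []) (processingOrder 1 before ++ processingOrder (length before + 1) (down 0 A ∷ down 0 B ∷ rest))
    ≡⟨ foldl-++ starStep ([] , []) (processingOrder 1 before) _ ⟩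
  foldl starStep (starAll before) (processingOrder (length before + 1) (down 0 A ∷ down 0 B ∷ rest))
    ≡⟨ cong (λ t → foldl starStep (starAll before) (processingOrder t (down 0 A ∷ down 0 B ∷ rest))) (+-comm (length before) 1) ⟩
  foldl starStep (starAll before) (map (i ,_) (reverse (down 0 A)) ++ map (suc i ,_) (reverse (down 0 B)) ++ L)
    ≡⟨ cong₂ (λ s t → foldl starStep (starAll before) (map (i ,_) s ++ map (suc i ,_) t ++ L))
         (reverse-involutive (letters 0 A)) (reverse-involutive (letters 0 B)) ⟩
  foldl starStep (starAll before) (map (i ,_) (letters 0 A) ++ map (suc i ,_) (letters 0 B) ++ L)
    ≡⟨ foldl-++ starStep (starAll before) (map (i ,_) (letters 0 A)) _ ⟩
  foldl starStep (insSeq i (letters 0 A) (starAll before)) (map (suc i ,_) (letters 0 B) ++ L)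
    ≡⟨ foldl-++ starStep (insSeq i (letters 0 A) (starAll before)) (map (suc i ,_) (letters 0 B)) L ⟩
  foldl starStep (pairIns i A B (starAll before)) L ∎
  where
  open ≡-Reasoning
  i = suc (length before)
  L = processingOrder (suc (suc i)) rest

word-split : ∀ (before : List (List ℕ)) a b rest →
  concat (reverse (before ++ a ∷ b ∷ rest)) ≡ concat (reverse rest) ++ b ++ a ++ concat (reverse before)
word-split before a b rest = begin
  concat (reverse (before ++ a ∷ b ∷ rest))                       ≡⟨ cong concat (reverse-++ before (a ∷ b ∷ rest)) ⟩
  concat (reverse (a ∷ b ∷ rest) ++ reverse before)               ≡⟨ concat-++ (reverse (a ∷ b ∷ rest)) (reverse before) ⟨
  concat (reverse (a ∷ b ∷ rest)) ++ concat (reverse before)      ≡⟨ cong (_++ concat (reverse before)) (trans (concat-reverse a (b ∷ rest)) (cong (_++ a) (concat-reverse b rest))) ⟩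
  ((concat (reverse rest) ++ b) ++ a) ++ concat (reverse before)  ≡⟨ ++-assoc (concat (reverse rest) ++ b) a _ ⟩
  (concat (reverse rest) ++ b) ++ a ++ concat (reverse before)    ≡⟨ ++-assoc (concat (reverse rest)) b _ ⟩
  concat (reverse rest) ++ b ++ a ++ concat (reverse before)      ∎
  where open ≡-Reasoning

initial-before : ∀ {N} before u → Good (u ++ concat (reverse before)) → All (All (_< N)) before →
  Initial N (suc (length before)) u (starAll before)
initial-before before u g b = initial-star (processingOrder 1 before) ([] , [])
  (initial (rows [] []) refl [] (subst Good (trans (cong (u ++_) (sym (processing-word 1 before))) (sym (++-identityʳ _))) g))
  (labels 1 before (λ k lt → <⇒≢ (lt′ k lt) , <⇒≢ (m≤n⇒m≤1+n (lt′ k lt)))) (values 1 before b)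
  where
  lt′ : ∀ k → k < length before → k + 1 < suc (length before)
  lt′ k lt = ≤-trans (≤-reflexive (cong suc (+-comm k 1))) (s≤s lt)

star-lowered : ∀ {N} before A B rest → let i = suc (length before) in
  length A ≡ N → length B ≡ N → All (All (_< N)) before →
  Good (down 0 B ++ down 0 A ++ concat (reverse before)) →
  (Paired (0 , 0) A B → fKN i (proj₂ (starAll (before ++ down 0 A ∷ down 0 B ∷ rest))) ≡ nothing) ×
  (∀ {A′ B′} → Lower (0 , 0) A B A′ B′ →
    fKN i (proj₂ (starAll (before ++ down 0 A ∷ down 0 B ∷ rest))) ≡
    just (proj₂ (starAll (before ++ down 0 A′ ∷ down 0 B′ ∷ rest))))
star-lowered {N} before A B rest eA eB bs g =
  (λ p → trans fKN≡ (cong (Maybe.map _) (cong (Maybe.map _) (stuck p)))) ,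
  λ {A′} {B′} l → let form′ , e₁ , e₂ = moves l in
    trans fKN≡ (trans (cong (λ t → Maybe.map (map (render i)) (Maybe.map (addForms L tab) t)) e₁)
      (cong just (sym (trans (cong proj₂ (trans (starAll-split before A′ B′ rest) (cong (λ t → foldl starStep t L) e₂)))
        (star-form i L tab form′)))))
  where
  i = suc (length before)
  L = processingOrder (suc (suc i)) rest
  S = starAll before
  open Initial (initial-before {N} before (down 0 B ++ down 0 A)
    (subst Good (sym (++-assoc (down 0 B) (down 0 A) _)) g) bs)
  open PairInsertion (pairInsertion i A B (proj₁ S) (proj₂ S) isRows sameLength others eA eB
    (subst Good (++-assoc (down 0 B) (down 0 A) _) isGood))
  Q≡ : proj₂ (starAll (before ++ down 0 A ∷ down 0 B ∷ rest)) ≡ map (render i) (addForms L tab form)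
  Q≡ = trans (cong proj₂ (trans (starAll-split before A B rest) (cong (λ t → foldl starStep t L) result)))
    (star-form i L tab form)
  otherL : All (Other i ∘ proj₁) L
  otherL = labels (suc (suc i)) rest (λ k _ → >⇒≢ (≤-trans (n≤1+n _) (m≤n+m _ k)) , >⇒≢ (m≤n+m _ k))
  fKN≡ : fKN i (proj₂ (starAll (before ++ down 0 A ∷ down 0 B ∷ rest))) ≡
    Maybe.map (map (render i)) (Maybe.map (addForms L tab) (lowerForm form))
  fKN≡ = trans (cong (fKN i) Q≡) (trans (fKN-form _ (clean-adds L tab form otherL clean))
    (cong (Maybe.map (map (render i))) (lowerForm-adds L tab form)))

down-letters : ∀ w A → letters 0 A ≡ reverse w → w ≡ down 0 A
down-letters w A e = sym (trans (cong reverse e) (reverse-involutive w))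

nothing≢just : ∀ {A : Set} {x : A} → nothing ≢ just x
nothing≢just ()

fstarPair-fKN : ∀ before a b rest → let i = suc (length before) in
  All StrictlyDecreasing (before ++ a ∷ b ∷ rest) → Good (concat (reverse (before ++ a ∷ b ∷ rest))) →
  (fstarPair a b ≡ nothing × fKN i (proj₂ (starAll (before ++ a ∷ b ∷ rest))) ≡ nothing) ⊎
  (∃[ a′ ] ∃[ b′ ] fstarPair a b ≡ just (a′ , b′) ×
    fKN i (proj₂ (starAll (before ++ a ∷ b ∷ rest))) ≡ just (proj₂ (starAll (before ++ a′ ∷ b′ ∷ rest))))
fstarPair-fKN before a b rest ds g with bounds (before ++ a ∷ b ∷ rest)
... | N , bs with All.++⁻ʳ before ds | All.++⁻ before bs
... | da ∷ db ∷ _ | bs₀ , ba ∷ bb ∷ _ with factor-bits a da ba | factor-bits b db bb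
... | A , eA , lA | B , eB , lB with down-letters a A lA | down-letters b B lB | lower-exists (0 , 0) A B
...   | refl | refl | inj₁ p = inj₁ (fstarPair-paired eAB p , proj₁ lowering p)
  where
  eAB = trans eA (sym eB)
  lowering = star-lowered before A B rest eA eB bs₀ (good-++ʳ (concat (reverse rest)) (subst Good (word-split before (down 0 A) (down 0 B) rest) g))
...   | refl | refl | inj₂ (A′ , B′ , l) = inj₂ (down 0 A′ , down 0 B′ , fstarPair-lower eAB l , proj₂ lowering l)
  where
  eAB = trans eA (sym eB)
  lowering = star-lowered before A B rest eA eB bs₀ (good-++ʳ (concat (reverse rest)) (subst Good (word-split before (down 0 A) (down 0 B) rest) g))

fstar-fKN : ∀ {m} (h : Factorization m) → InHstar h → ∀ k → suc k < m →
  (fstar (suc k) h ≡ nothing × fKN (suc k) (Qstar h) ≡ nothing) ⊎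
  (∃[ h′ ] fstar (suc k) h ≡ just h′ × fKN (suc k) (Qstar h) ≡ just (Qstar h′))
fstar-fKN h (dec , _ , fc) k lt = assemble (pairAt k h lt)
  where
  assemble : PairAt k h → _
  assemble record { before = before ; after₂ = rest ; a = a ; b = b ; factors = f ; lengthBefore = refl
                  ; zeroCase = zeroCase ; justCase = justCase }
    with fstarPair-fKN before a b rest (subst (All StrictlyDecreasing) f (VecAll.toList⁺ dec))
           (subst (Good ∘ concat ∘ reverse) f (fullyCommutative-good fc))
  ... | inj₁ (e₁ , e₂) = inj₁ (zeroCase e₁ , trans (cong (fKN _ ∘ proj₂ ∘ starAll) f) e₂)
  ... | inj₂ (a′ , b′ , e₁ , e₂) with justCase e₁
  ...   | h′ , e₃ , f′ = inj₂ (h′ , e₃ , trans (cong (fKN _ ∘ proj₂ ∘ starAll) f)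
                                  (trans e₂ (cong (just ∘ proj₂ ∘ starAll) (sym f′))))

theorem4p22 : ∀ (m : ℕ) (h : Factorization m) → InHstar h →
    ∀ (i : ℕ) → 1 ≤ i → i < m →
    ((fstar i h ≢ nothing) ⇔ (fKN i (Qstar h) ≢ nothing))
    × (∀ (h′ : Factorization m) → fstar i h ≡ just h′ →
    just (Qstar h′) ≡ fKN i (Qstar h))
theorem4p22 m h hh (suc k) _ lt with fstar-fKN h hh k lt
... | inj₁ (e₁ , e₂) = mk⇔ (λ n → ⊥-elim (n e₁)) (λ n → ⊥-elim (n e₂)) ,
  λ h′ e → ⊥-elim (nothing≢just (trans (sym e₁) e))
... | inj₂ (h₁ , e₁ , e₂) = mk⇔ (λ _ e → nothing≢just (trans (sym e) e₂)) (λ _ e → nothing≢just (trans (sym e) e₁)) ,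
  λ h′ e → trans (cong (just ∘ Qstar) (just-injective (trans (sym e) e₁))) (sym e₂)
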